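{- The deterministic greedy algorithm, which assigns each arriving item $i$ to a bidder $j$ maximizing the marginal value $f_j(S_j\cup\{i\})-f_j(S_j)$ (where $S_j$ is the set of items assigned to bidder $j$ so far) if this maximum marginal value is non-negative and discards $i$ otherwise, achieves a competitive ratio of approximately $0.27493$ (namely $\frac{1}{\sqrt5}\big(e^{ -ax^*}-e^{ -bx^*}\big)$ with $a=\frac{3-\sqrt5}{2}$, $b=\frac{3+\sqrt5}{2}$, $x^*=\frac{\ln(b/a)}{\sqrt5}$) for online Submodular Welfare in the random order setting with general (not necessarily monotone) non-negative submodular utilities; i.e., for every instance, the expected value (over the uniformly random arrival order) of the greedy allocation is at least this constant times the optimal offline value.
   Context: A set function $f:2^{\mathcal N}\to\mathbb R_{\ge 0}$ is submodular if $f(A\cup B)+f(A\cap B)\le f(A)+f(B)$ for all $A,B\subseteq\mathcal N$. Online Submodular Welfare: there are $n$ bidders, bidder $j$ having a non-negative submodular (not necessarily monotone) utility $f_j$ over a set $\mathcal N$ of $m$ items that arrive one by one. When an item arrives, the algorithm must immediately and irrevocably assign it to one bidder or discard it; the goal is to maximize $\sum_j f_j(S_j)$ where the sets $S_j$ of items assigned to the bidders are pairwise disjoint. The optimal offline value is $\max\{\sum_j f_j(O_j): O_1,\dots,O_n\subseteq\mathcal N\text{ pairwise disjoint}\}$. In the random order setting the items arrive in a uniformly random order. -}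

module Defs where

open import Data.Fin.Base using (Fin)
open import Data.Fin.Properties using (_≟_; all?)
open import Data.Fin.Subset as Subset using (Subset; inside; outside; _∪_; _∩_; ⁅_⁆; Empty)
open import Data.Fin.Subset.Properties using (nonempty?)
open import Data.Integer.Base as ℤ using (+_)
import Data.Integer.Properties as ℤₚ
open import Data.List.Base using (List; []; _∷_; map; concatMap; filter; foldr; reverse)
open import Data.List.Relation.Unary.Unique.Propositional using (Unique)
open import Data.Maybe.Base using (Maybe; just; nothing)
open import Data.Nat.Base as ℕ using (ℕ; zero; suc; _!; z≤n; s≤s)
import Data.Nat.Properties as ℕₚ
import Data.Nat.Solver as ℕ-Solver
open import Data.Product.Base using (∃-syntax; _×_; _,_; proj₁; proj₂)
open import Data.Rational.Base as ℚ using (ℚ; 0ℚ; 1ℚ; ½)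
import Data.Rational.Properties as ℚₚ
import Data.Rational.Solver as ℚ-Solver
import Data.Rational.Unnormalised.Base as ℚᵘ
import Data.Rational.Unnormalised.Properties as ℚᵘₚ
open import Data.Sum.Base using (_⊎_; inj₁; inj₂; [_,_]′)
open import Data.Vec.Base using (Vec; []; _∷_; lookup; allFin; toList)
open import Data.Vec.Functional as Vector using (updateAt)
open import Relation.Binary.PropositionalEquality using (_≡_; _≢_; refl; sym; trans; cong; cong₂; subst)
open import Relation.Nullary using (¬_; Dec; yes; no; ¬?; contradiction)
open import Relation.Nullary.Decidable using (_→-dec_)

module _ where
  open import Data.Rational.Base using (mkℚ; _/_; _≤_; _<_; _+_; _*_; _-_; -_; ∣_∣; 1/_; Positive; NonZero; positive; nonNegative)
  open ℚₚ.≤-Reasoning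
  open ℚ-Solver.+-*-Solver

  ι : ℕ → ℚ
  ι n = + n / 1

  /-mono : ∀ a b c d .{{_ : ℕ.NonZero b}} .{{_ : ℕ.NonZero d}} → a ℕ.* d ℕ.≤ c ℕ.* b → + a / b ≤ + c / d
  /-mono a b@(suc _) c d@(suc _) le = ℚₚ.toℚᵘ-cancel-≤
    (ℚᵘₚ.≤-trans (ℚᵘₚ.≤-reflexive (ℚₚ.toℚᵘ-fromℚᵘ (ℚᵘ.mkℚᵘ (+ a) _)))
    (ℚᵘₚ.≤-trans (ℚᵘ.*≤* (ℤₚ.≤-trans (ℤₚ.≤-reflexive (sym (ℤₚ.pos-* a d)))
                         (ℤₚ.≤-trans (ℤ.+≤+ le) (ℤₚ.≤-reflexive (ℤₚ.pos-* c b)))))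
                 (ℚᵘₚ.≤-reflexive (ℚᵘₚ.≃-sym (ℚₚ.toℚᵘ-fromℚᵘ (ℚᵘ.mkℚᵘ (+ c) _))))))

  /-split : ∀ a k → + a / suc k ≡ ι a * (+ 1 / suc k)
  /-split a k = ℚₚ.toℚᵘ-injective (ℚᵘₚ.≃-trans (ℚₚ.toℚᵘ-fromℚᵘ (ℚᵘ.mkℚᵘ (+ a) k))
    (ℚᵘₚ.≃-sym (ℚᵘₚ.≃-trans (ℚₚ.toℚᵘ-homo-* (ι a) (+ 1 / suc k))
    (ℚᵘₚ.≃-trans (ℚᵘₚ.*-cong (ℚₚ.toℚᵘ-fromℚᵘ (ℚᵘ.mkℚᵘ (+ a) 0)) (ℚₚ.toℚᵘ-fromℚᵘ (ℚᵘ.mkℚᵘ (+ 1) k)))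
      (ℚᵘ.*≡* (cong₂ ℤ._*_ (ℤₚ.*-identityʳ (+ a)) (cong +_ (sym (ℕₚ.*-identityˡ (suc k))))))))))

  ι-mono : ∀ {a c} → a ℕ.≤ c → ι a ≤ ι c
  ι-mono {a} {c} le = /-mono a 1 c 1 (ℕₚ.*-monoˡ-≤ 1 le)

  ι-suc : ∀ n → ι (suc n) ≡ 1ℚ + ι n
  ι-suc n = ℚₚ.toℚᵘ-injective (ℚᵘₚ.≃-trans (ℚₚ.toℚᵘ-fromℚᵘ (ℚᵘ.mkℚᵘ (+ suc n) 0))
    (ℚᵘₚ.≃-sym (ℚᵘₚ.≃-trans (ℚₚ.toℚᵘ-homo-+ 1ℚ (ι n))
    (ℚᵘₚ.≃-trans (ℚᵘₚ.+-cong (ℚᵘₚ.≃-refl {ℚᵘ.1ℚᵘ}) (ℚₚ.toℚᵘ-fromℚᵘ (ℚᵘ.mkℚᵘ (+ n) 0)))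
      (ℚᵘ.*≡* (cong (ℤ._* (+ 1)) (cong (λ z → (+ 1) ℤ.+ z) (ℤₚ.*-identityʳ (+ n)))))))))

  ι-suc*/ : ∀ k → ι (suc k) * (+ 1 / suc k) ≡ 1ℚ
  ι-suc*/ k = trans (sym (/-split (suc k) k)) (ℚₚ.≤-antisym
    (/-mono (suc k) (suc k) 1 1 (ℕₚ.≤-reflexive (ℕₚ.*-comm (suc k) 1)))
    (/-mono 1 1 (suc k) (suc k) (ℕₚ.≤-reflexive (ℕₚ.*-comm 1 (suc k)))))

  suc/ : ∀ n k → + suc n / suc k ≡ + n / suc k + + 1 / suc k
  suc/ n k = begin-equality
    + suc n / suc k                    ≡⟨ /-split (suc n) k ⟩
    ι (suc n) * (+ 1 / suc k)          ≡⟨ cong (_* (+ 1 / suc k)) (ι-suc n) ⟩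
    (1ℚ + ι n) * (+ 1 / suc k)         ≡⟨ solve 2 (λ a b → (con 1ℚ :+ a) :* b := a :* b :+ b) refl (ι n) (+ 1 / suc k) ⟩
    ι n * (+ 1 / suc k) + + 1 / suc k  ≡⟨ cong (_+ (+ 1 / suc k)) (/-split n k) ⟨
    + n / suc k + + 1 / suc k          ∎

  0≤/ : ∀ k → 0ℚ ≤ + 1 / suc k
  0≤/ k = /-mono 0 1 1 (suc k) z≤n

  archimedean : ∀ q → ∃[ n ] q ≤ ι n
  archimedean q@(mkℚ z d _) = ℤ.∣ z ∣ , ℚₚ.toℚᵘ-cancel-≤
    (ℚᵘₚ.≤-trans (ℚᵘ.*≤* (ℤₚ.≤-trans (ℤₚ.≤-reflexive (ℤₚ.*-identityʳ z))
        (ℤₚ.≤-trans (z≤∣z∣ z) (ℤₚ.≤-trans (ℤ.+≤+ (ℕₚ.m≤m*n ℤ.∣ z ∣ (suc d)))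
          (ℤₚ.≤-reflexive (ℤₚ.pos-* ℤ.∣ z ∣ (suc d)))))))
      (ℚᵘₚ.≤-reflexive (ℚᵘₚ.≃-sym (ℚₚ.toℚᵘ-fromℚᵘ (ℚᵘ.mkℚᵘ (+ ℤ.∣ z ∣) 0)))))
    where
    z≤∣z∣ : ∀ z → z ℤ.≤ + ℤ.∣ z ∣
    z≤∣z∣ (+ n) = ℤₚ.≤-refl
    z≤∣z∣ (ℤ.-[1+ n ]) = ℤ.-≤+

  *-monoˡ : ∀ {p q r} → 0ℚ ≤ r → p ≤ q → r * p ≤ r * q
  *-monoˡ {r = r} 0≤r = ℚₚ.*-monoˡ-≤-nonNeg r {{nonNegative 0≤r}}

  *-monoʳ : ∀ {p q r} → 0ℚ ≤ r → p ≤ q → p * r ≤ q * r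
  *-monoʳ {r = r} 0≤r = ℚₚ.*-monoʳ-≤-nonNeg r {{nonNegative 0≤r}}

  *-mono : ∀ {p q r s} → 0ℚ ≤ p → 0ℚ ≤ s → p ≤ q → r ≤ s → p * r ≤ q * s
  *-mono 0≤p 0≤s p≤q r≤s = ℚₚ.≤-trans (*-monoˡ 0≤p r≤s) (*-monoʳ 0≤s p≤q)

  0≤* : ∀ {p q} → 0ℚ ≤ p → 0ℚ ≤ q → 0ℚ ≤ p * q
  0≤* {p} {q} 0≤p 0≤q = ℚₚ.≤-trans (ℚₚ.≤-reflexive (sym (ℚₚ.*-zeroʳ p))) (*-monoˡ 0≤p 0≤q)

  0≤+ : ∀ {p q} → 0ℚ ≤ p → 0ℚ ≤ q → 0ℚ ≤ p + q
  0≤+ = ℚₚ.+-mono-≤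

  0<* : ∀ {p q} → 0ℚ < p → 0ℚ < q → 0ℚ < p * q
  0<* {p} {q} 0<p 0<q =
    ℚₚ.≤-<-trans (ℚₚ.≤-reflexive (sym (ℚₚ.*-zeroʳ p))) (ℚₚ.*-monoʳ-<-pos p {{positive 0<p}} 0<q)

  0<⇒∃/ : ∀ {p} → 0ℚ < p → ∃[ r ] 0ℚ < r × p * r ≡ 1ℚ
  0<⇒∃/ {p} 0<p = (1/ p) , ℚₚ.positive⁻¹ _ {{ℚₚ.1/pos⇒pos p}} , ℚₚ.*-inverseʳ p
    where instance
      p-pos : Positive p
      p-pos = positive 0<p
      p-nz : NonZero p
      p-nz = ℚₚ.pos⇒nonZero p

  ∣∣≤ : ∀ {p q} → p ≤ q → - p ≤ q → ∣ p ∣ ≤ q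
  ∣∣≤ {p} p≤q -p≤q with ℚₚ.∣p∣≡p∨∣p∣≡-p p
  ... | inj₁ eq = ℚₚ.≤-trans (ℚₚ.≤-reflexive eq) p≤q
  ... | inj₂ eq = ℚₚ.≤-trans (ℚₚ.≤-reflexive eq) -p≤q

  p≤∣p∣ : ∀ p → p ≤ ∣ p ∣
  p≤∣p∣ p with ℚₚ.≤-total 0ℚ p
  ... | inj₁ 0≤p = ℚₚ.≤-reflexive (sym (ℚₚ.0≤p⇒∣p∣≡p 0≤p))
  ... | inj₂ p≤0 = ℚₚ.≤-trans p≤0 (ℚₚ.0≤∣p∣ p)

  ∣-∣-comm : ∀ p q → ∣ p - q ∣ ≡ ∣ q - p ∣
  ∣-∣-comm p q = trans (sym (ℚₚ.∣-p∣≡∣p∣ (p - q)))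
    (cong ∣_∣ (solve 2 (λ p q → :- (p :- q) := q :- p) refl p q))

  ∣-∣-via : ∀ p q r → ∣ p - r ∣ ≤ ∣ p - q ∣ + ∣ q - r ∣
  ∣-∣-via p q r = ℚₚ.≤-trans (ℚₚ.≤-reflexive (cong ∣_∣ (solve 3 (λ p q r → p :- r := (p :- q) :+ (q :- r)) refl p q r)))
    (ℚₚ.∣p+q∣≤∣p∣+∣q∣ (p - q) (q - r))

  ∣-∣≤⇒ : ∀ p q {ε} → ∣ p - q ∣ ≤ ε → p ≤ q + ε
  ∣-∣≤⇒ p q {ε} h = begin
    p            ≡⟨ solve 2 (λ p q → p := q :+ (p :- q)) refl p q ⟩
    q + (p - q)  ≤⟨ ℚₚ.+-monoʳ-≤ q (ℚₚ.≤-trans (p≤∣p∣ (p - q)) h) ⟩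
    q + ε        ∎

  ⇒∣-∣≤ : ∀ {p q ε} → p ≤ q + ε → q ≤ p + ε → ∣ p - q ∣ ≤ ε
  ⇒∣-∣≤ {p} {q} {ε} h k = ∣∣≤ (lem h)
    (ℚₚ.≤-trans (ℚₚ.≤-reflexive (solve 2 (λ p q → :- (p :- q) := q :- p) refl p q)) (lem k))
    where
    lem : ∀ {p q} → p ≤ q + ε → p - q ≤ ε
    lem {p} {q} h = ℚₚ.≤-trans (ℚₚ.+-monoˡ-≤ (- q) h)
      (ℚₚ.≤-reflexive (solve 2 (λ q ε → (q :+ ε) :- q := ε) refl q ε))

  /-small : ∀ {ε} → 0ℚ < ε → ∃[ N ] ∀ n → N ℕ.≤ n → + 1 / suc n ≤ ε
  /-small {ε} 0<ε =
    let r , _ , εr≡1 = 0<⇒∃/ 0<ε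
        N , r≤N = archimedean r
    in N , λ n N≤n → begin
      + 1 / suc n                  ≡⟨ ℚₚ.*-identityˡ _ ⟨
      1ℚ * (+ 1 / suc n)           ≡⟨ cong (_* (+ 1 / suc n)) εr≡1 ⟨
      ε * r * (+ 1 / suc n)        ≤⟨ *-monoʳ (0≤/ n) (*-monoˡ (ℚₚ.<⇒≤ 0<ε)
                                        (ℚₚ.≤-trans r≤N (ι-mono (ℕₚ.≤-trans N≤n (ℕₚ.n≤1+n n))))) ⟩
      ε * ι (suc n) * (+ 1 / suc n) ≡⟨ ℚₚ.*-assoc ε _ _ ⟩
      ε * (ι (suc n) * (+ 1 / suc n)) ≡⟨ cong (ε *_) (ι-suc*/ n) ⟩
      ε * 1ℚ                       ≡⟨ ℚₚ.*-identityʳ ε ⟩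
      ε                            ∎

IsCauchy : (ℕ → ℚ) → Set
IsCauchy s = ∀ ε → 0ℚ ℚ.< ε →
  ∃[ N ] ∀ i j → N ℕ.≤ i → N ℕ.≤ j → ℚ.∣ s i ℚ.- s j ∣ ℚ.≤ ε

-- Equality of reals is _≃_, not _≡_; all operations below act termwise on the
-- approximating sequences.
record ℝ : Set where
  constructor mkℝ
  field
    seq    : ℕ → ℚ
    cauchy : IsCauchy seq

open ℝ public

infix 4 _≤_ _<_ _≃_

_≤_ : ℝ → ℝ → Set
x ≤ y = ∀ ε → 0ℚ ℚ.< ε → ∃[ N ] ∀ i → N ℕ.≤ i → seq x i ℚ.≤ seq y i ℚ.+ ε

_<_ : ℝ → ℝ → Set
x < y = ∃[ δ ] 0ℚ ℚ.< δ × (∃[ N ] ∀ i → N ℕ.≤ i → seq x i ℚ.+ δ ℚ.≤ seq y i)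

_≃_ : ℝ → ℝ → Set
x ≃ y = x ≤ y × y ≤ x

module _ where
  open import Data.Rational.Base using (_*_; _+_; _-_; -_; ∣_∣; _⊔_)
  open ℚₚ.≤-Reasoning
  open ℚ-Solver.+-*-Solver

  IsCauchyUpTo : ℚ → (ℕ → ℚ) → Set
  IsCauchyUpTo C s = ∀ ε → 0ℚ ℚ.< ε →
    ∃[ N ] ∀ i j → N ℕ.≤ i → N ℕ.≤ j → ∣ s i - s j ∣ ℚ.≤ C * ε

  cauchy-scale : ∀ C s → 0ℚ ℚ.< C → IsCauchyUpTo C s → IsCauchy s
  cauchy-scale C s 0<C h ε 0<ε =
    let r , 0<r , Cr≡1 = 0<⇒∃/ 0<C
        N , p = h (r * ε) (0<* 0<r 0<ε)
    in N , λ i j N≤i N≤j → begin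
      ∣ s i - s j ∣   ≤⟨ p i j N≤i N≤j ⟩
      C * (r * ε)     ≡⟨ ℚₚ.*-assoc C r ε ⟨
      C * r * ε       ≡⟨ cong (_* ε) Cr≡1 ⟩
      1ℚ * ε          ≡⟨ ℚₚ.*-identityˡ ε ⟩
      ε               ∎

  0<1 : 0ℚ ℚ.< 1ℚ
  0<1 = ℚₚ.positive⁻¹ 1ℚ

  0<½ : 0ℚ ℚ.< ½
  0<½ = ℚₚ.positive⁻¹ ½

  EventuallyBounded : (ℕ → ℚ) → Set
  EventuallyBounded s = ∃[ B ] 0ℚ ℚ.< B × (∃[ N ] ∀ i → N ℕ.≤ i → ∣ s i ∣ ℚ.≤ B)

  bounded : ∀ s → IsCauchy s → EventuallyBounded s
  bounded s c =
    let N , p = c 1ℚ 0<1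
    in ∣ s N ∣ + 1ℚ , ℚₚ.+-mono-≤-< (ℚₚ.0≤∣p∣ (s N)) 0<1 , N , λ i N≤i → begin
      ∣ s i ∣                  ≡⟨ cong ∣_∣ (solve 2 (λ a b → a := b :+ (a :- b)) refl (s i) (s N)) ⟩
      ∣ s N + (s i - s N) ∣    ≤⟨ ℚₚ.∣p+q∣≤∣p∣+∣q∣ (s N) (s i - s N) ⟩
      ∣ s N ∣ + ∣ s i - s N ∣  ≤⟨ ℚₚ.+-monoʳ-≤ ∣ s N ∣ (p i N N≤i ℕₚ.≤-refl) ⟩
      ∣ s N ∣ + 1ℚ             ∎

  const-cauchy : ∀ q → IsCauchy (λ _ → q)
  const-cauchy q ε 0<ε = 0 , λ _ _ _ _ →
    ℚₚ.≤-trans (ℚₚ.≤-reflexive (cong ∣_∣ (ℚₚ.+-inverseʳ q))) (ℚₚ.<⇒≤ 0<ε)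

  +-cauchy : ∀ s t → IsCauchy s → IsCauchy t → IsCauchy (λ i → s i + t i)
  +-cauchy s t c d = cauchy-scale (1ℚ + 1ℚ) (λ i → s i + t i) (ℚₚ.+-mono-< 0<1 0<1) λ ε 0<ε →
    let N , p = c ε 0<ε
        M , q = d ε 0<ε
    in N ℕ.⊔ M , λ i j ≤i ≤j → begin
      ∣ (s i + t i) - (s j + t j) ∣
        ≡⟨ cong ∣_∣ (solve 4 (λ a b c d → (a :+ b) :- (c :+ d) := (a :- c) :+ (b :- d)) refl (s i) (t i) (s j) (t j)) ⟩
      ∣ (s i - s j) + (t i - t j) ∣
        ≤⟨ ℚₚ.∣p+q∣≤∣p∣+∣q∣ (s i - s j) (t i - t j) ⟩
      ∣ s i - s j ∣ + ∣ t i - t j ∣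
        ≤⟨ ℚₚ.+-mono-≤ (p i j (ℕₚ.m⊔n≤o⇒m≤o N M ≤i) (ℕₚ.m⊔n≤o⇒m≤o N M ≤j))
                       (q i j (ℕₚ.m⊔n≤o⇒n≤o N M ≤i) (ℕₚ.m⊔n≤o⇒n≤o N M ≤j)) ⟩
      ε + ε
        ≡⟨ solve 1 (λ e → e :+ e := (con 1ℚ :+ con 1ℚ) :* e) refl ε ⟩
      (1ℚ + 1ℚ) * ε ∎

  neg-cauchy : ∀ s → IsCauchy s → IsCauchy (λ i → - s i)
  neg-cauchy s c ε 0<ε =
    let N , p = c ε 0<ε
    in N , λ i j ≤i ≤j → ℚₚ.≤-trans (ℚₚ.≤-reflexive (trans
      (cong ∣_∣ (solve 2 (λ a b → :- a :- :- b := b :- a) refl (s i) (s j))) (∣-∣-comm (s j) (s i)))) (p i j ≤i ≤j)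

  *-cauchy : ∀ s t → IsCauchy s → IsCauchy t → IsCauchy (λ i → s i * t i)
  *-cauchy s t c d =
    let B , 0<B , K , b = bounded s c
        D , 0<D , L , e = bounded t d
    in cauchy-scale (B + D) (λ i → s i * t i) (ℚₚ.+-mono-< 0<B 0<D) λ ε 0<ε →
    let N , p = c ε 0<ε
        M , q = d ε 0<ε
        X = (N ℕ.⊔ M) ℕ.⊔ (K ℕ.⊔ L)
        N≤ = ℕₚ.≤-trans (ℕₚ.m≤m⊔n N M) (ℕₚ.m≤m⊔n _ (K ℕ.⊔ L))
        M≤ = ℕₚ.≤-trans (ℕₚ.m≤n⊔m N M) (ℕₚ.m≤m⊔n _ (K ℕ.⊔ L))
        K≤ = ℕₚ.≤-trans (ℕₚ.m≤m⊔n K L) (ℕₚ.m≤n⊔m (N ℕ.⊔ M) _)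
        L≤ = ℕₚ.≤-trans (ℕₚ.m≤n⊔m K L) (ℕₚ.m≤n⊔m (N ℕ.⊔ M) _)
    in X , λ i j ≤i ≤j → begin
      ∣ s i * t i - s j * t j ∣
        ≡⟨ cong ∣_∣ (solve 4 (λ a b c d → a :* b :- c :* d := a :* (b :- d) :+ (a :- c) :* d) refl (s i) (t i) (s j) (t j)) ⟩
      ∣ s i * (t i - t j) + (s i - s j) * t j ∣
        ≤⟨ ℚₚ.∣p+q∣≤∣p∣+∣q∣ (s i * (t i - t j)) ((s i - s j) * t j) ⟩
      ∣ s i * (t i - t j) ∣ + ∣ (s i - s j) * t j ∣
        ≡⟨ cong₂ _+_ (ℚₚ.∣p*q∣≡∣p∣*∣q∣ (s i) (t i - t j)) (ℚₚ.∣p*q∣≡∣p∣*∣q∣ (s i - s j) (t j)) ⟩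
      ∣ s i ∣ * ∣ t i - t j ∣ + ∣ s i - s j ∣ * ∣ t j ∣
        ≤⟨ ℚₚ.+-mono-≤
             (*-mono (ℚₚ.0≤∣p∣ (s i)) (ℚₚ.<⇒≤ 0<ε) (b i (ℕₚ.≤-trans K≤ ≤i)) (q i j (ℕₚ.≤-trans M≤ ≤i) (ℕₚ.≤-trans M≤ ≤j)))
             (*-mono (ℚₚ.0≤∣p∣ (s i - s j)) (ℚₚ.<⇒≤ 0<D) (p i j (ℕₚ.≤-trans N≤ ≤i) (ℕₚ.≤-trans N≤ ≤j)) (e j (ℕₚ.≤-trans L≤ ≤j))) ⟩
      B * ε + ε * D
        ≡⟨ solve 3 (λ B D ε → B :* ε :+ ε :* D := (B :+ D) :* ε) refl B D ε ⟩
      (B + D) * ε ∎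

  ⊔-cauchy : ∀ s t → IsCauchy s → IsCauchy t → IsCauchy (λ i → s i ⊔ t i)
  ⊔-cauchy s t c d ε 0<ε =
    let N , p = c ε 0<ε
        M , q = d ε 0<ε
        half = λ i j ≤i ≤j → lem i j (p i j (ℕₚ.m⊔n≤o⇒m≤o N M ≤i) (ℕₚ.m⊔n≤o⇒m≤o N M ≤j))
                                     (q i j (ℕₚ.m⊔n≤o⇒n≤o N M ≤i) (ℕₚ.m⊔n≤o⇒n≤o N M ≤j))
    in N ℕ.⊔ M , λ i j ≤i ≤j → ⇒∣-∣≤ (half i j ≤i ≤j) (half j i ≤j ≤i)
    where
    lem : ∀ i j → ∣ s i - s j ∣ ℚ.≤ ε → ∣ t i - t j ∣ ℚ.≤ ε → s i ⊔ t i ℚ.≤ (s j ⊔ t j) + ε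
    lem i j h k = ℚₚ.⊔-lub
      (ℚₚ.≤-trans (∣-∣≤⇒ (s i) (s j) h) (ℚₚ.+-monoˡ-≤ ε (ℚₚ.p≤p⊔q (s j) (t j))))
      (ℚₚ.≤-trans (∣-∣≤⇒ (t i) (t j) k) (ℚₚ.+-monoˡ-≤ ε (ℚₚ.p≤q⊔p (s j) (t j))))

  -- Total, with recip 0 = 0: a positive real may have finitely many approximations
  -- that vanish.
  recip : ℚ → ℚ
  recip q with q ℚₚ.≟ 0ℚ
  ... | yes _   = 0ℚ
  ... | no  q≢0 = (ℚ.1/ q) {{ℚ.≢-nonZero q≢0}}

  recip-inverse : ∀ {q} → 0ℚ ℚ.< q → q * recip q ≡ 1ℚ
  recip-inverse {q} 0<q with q ℚₚ.≟ 0ℚ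
  ... | yes q≡0 = contradiction (sym q≡0) (ℚₚ.<⇒≢ 0<q)
  ... | no  q≢0 = ℚₚ.*-inverseʳ q {{ℚ.≢-nonZero q≢0}}

  recip-nonNeg : ∀ {q} → 0ℚ ℚ.< q → 0ℚ ℚ.≤ recip q
  recip-nonNeg {q} 0<q = ℚₚ.*-cancelˡ-≤-pos q {{ℚ.positive 0<q}} (begin
    q * 0ℚ       ≡⟨ ℚₚ.*-zeroʳ q ⟩
    0ℚ           ≤⟨ ℚₚ.<⇒≤ 0<1 ⟩
    1ℚ           ≡⟨ recip-inverse 0<q ⟨
    q * recip q  ∎)

  recip-anti : ∀ {p q} → 0ℚ ℚ.< p → p ℚ.≤ q → recip q ℚ.≤ recip p
  recip-anti {p} {q} 0<p p≤q = let 0<q = ℚₚ.<-≤-trans 0<p p≤q in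
    ℚₚ.*-cancelˡ-≤-pos p {{ℚ.positive 0<p}} (begin
    p * recip q  ≤⟨ *-monoʳ (recip-nonNeg 0<q) p≤q ⟩
    q * recip q  ≡⟨ recip-inverse 0<q ⟩
    1ℚ           ≡⟨ recip-inverse 0<p ⟨
    p * recip p  ∎)

  inv-cauchy : ∀ s δ → 0ℚ ℚ.< δ → (∃[ N ] ∀ i → N ℕ.≤ i → 0ℚ + δ ℚ.≤ s i) → IsCauchy s → IsCauchy (λ i → recip (s i))
  inv-cauchy s δ 0<δ (M , low) c = cauchy-scale (D * D) (λ i → recip (s i)) (0<* 0<D 0<D) λ ε 0<ε →
    let N , p = c ε 0<ε
    in N ℕ.⊔ M , λ i j ≤i ≤j →
      let δ≤i = low′ i (ℕₚ.m⊔n≤o⇒n≤o N M ≤i)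
          δ≤j = low′ j (ℕₚ.m⊔n≤o⇒n≤o N M ≤j)
          0<i = ℚₚ.<-≤-trans 0<δ δ≤i
          0<j = ℚₚ.<-≤-trans 0<δ δ≤j
          x = s i ; y = s j ; u = recip (s i) ; v = recip (s j)
          0≤u = recip-nonNeg 0<i
          0≤v = recip-nonNeg 0<j
      in begin
      ∣ u - v ∣
        ≡⟨ cong ∣_∣ (cong₂ _-_ (sym (ℚₚ.*-identityʳ u)) (sym (ℚₚ.*-identityʳ v))) ⟩
      ∣ u * 1ℚ - v * 1ℚ ∣
        ≡⟨ cong ∣_∣ (cong₂ (λ a b → u * a - v * b) (sym (recip-inverse 0<j)) (sym (recip-inverse 0<i))) ⟩
      ∣ u * (y * v) - v * (x * u) ∣
        ≡⟨ cong ∣_∣ (solve 4 (λ x y u v → u :* (y :* v) :- v :* (x :* u) := (u :* v) :* (y :- x)) refl x y u v) ⟩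
      ∣ u * v * (y - x) ∣
        ≡⟨ ℚₚ.∣p*q∣≡∣p∣*∣q∣ (u * v) (y - x) ⟩
      ∣ u * v ∣ * ∣ y - x ∣
        ≡⟨ cong (_* ∣ y - x ∣) (ℚₚ.0≤p⇒∣p∣≡p (0≤* 0≤u 0≤v)) ⟩
      u * v * ∣ y - x ∣
        ≤⟨ *-mono (0≤* 0≤u 0≤v) (ℚₚ.<⇒≤ 0<ε)
             (*-mono 0≤u (ℚₚ.<⇒≤ 0<D) (recip-anti 0<δ δ≤i) (recip-anti 0<δ δ≤j))
             (p j i (ℕₚ.m⊔n≤o⇒m≤o N M ≤j) (ℕₚ.m⊔n≤o⇒m≤o N M ≤i)) ⟩
      D * D * ε ∎
    where
    D = recip δ
    low′ : ∀ i → M ℕ.≤ i → δ ℚ.≤ s i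
    low′ i M≤i = ℚₚ.≤-trans (ℚₚ.≤-reflexive (sym (ℚₚ.+-identityˡ δ))) (low i M≤i)
    0<D : 0ℚ ℚ.< D
    0<D = ℚₚ.*-cancelˡ-<-nonNeg δ {{ℚ.nonNegative (ℚₚ.<⇒≤ 0<δ)}} (begin-strict
      δ * 0ℚ  ≡⟨ ℚₚ.*-zeroʳ δ ⟩
      0ℚ      <⟨ 0<1 ⟩
      1ℚ      ≡⟨ recip-inverse 0<δ ⟨
      δ * D   ∎)

isqrt : ℕ → ℕ
isqrt zero = 0
isqrt (suc n) with suc (isqrt n) ℕ.* suc (isqrt n) ℕₚ.≤? suc n
... | yes _ = suc (isqrt n)
... | no  _ = isqrt n

isqrt-lower : ∀ n → isqrt n ℕ.* isqrt n ℕ.≤ n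
isqrt-lower zero = z≤n
isqrt-lower (suc n) with suc (isqrt n) ℕ.* suc (isqrt n) ℕₚ.≤? suc n
... | yes p = p
... | no  _ = ℕₚ.m≤n⇒m≤1+n (isqrt-lower n)

isqrt-upper : ∀ n → n ℕ.< suc (isqrt n) ℕ.* suc (isqrt n)
isqrt-upper zero = s≤s z≤n
isqrt-upper (suc n) with suc (isqrt n) ℕ.* suc (isqrt n) ℕₚ.≤? suc n
... | yes _ = ℕₚ.≤-<-trans (isqrt-upper n) (ℕₚ.*-mono-< (ℕₚ.n<1+n (suc (isqrt n))) (ℕₚ.n<1+n (suc (isqrt n))))
... | no ¬p = ℕₚ.≰⇒> ¬p

sq-cancel-< : ∀ {a b} → a ℕ.* a ℕ.< b ℕ.* b → a ℕ.< b
sq-cancel-< {a} {b} h = ℕₚ.≰⇒> λ b≤a → ℕₚ.<⇒≱ h (ℕₚ.*-mono-≤ b≤a b≤a)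

-- ⌊√(n(k+1)²)⌋ / (k+1), within 1/(k+1) of √n.
√-approx : ℕ → ℕ → ℚ
√-approx n k = + isqrt (n ℕ.* (suc k ℕ.* suc k)) ℚ./ suc k

√-step : ∀ n j k → √-approx n j ℚ.≤ √-approx n k ℚ.+ + 1 ℚ./ suc k
√-step n j k = ℚₚ.≤-trans (/-mono p J (suc q) K (ℕₚ.<⇒≤ (sq-cancel-< squares))) (ℚₚ.≤-reflexive (suc/ q k))
  where
  module NS = ℕ-Solver.+-*-Solver
  J = suc j
  K = suc k
  p = isqrt (n ℕ.* (J ℕ.* J))
  q = isqrt (n ℕ.* (K ℕ.* K))
  squares : (p ℕ.* K) ℕ.* (p ℕ.* K) ℕ.< (suc q ℕ.* J) ℕ.* (suc q ℕ.* J)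
  squares = ℕₚ.≤-<-trans
    (ℕₚ.≤-trans (ℕₚ.≤-reflexive (NS.solve 2 (λ p K → (p NS.:* K) NS.:* (p NS.:* K) NS.:= (p NS.:* p) NS.:* (K NS.:* K)) refl p K))
    (ℕₚ.≤-trans (ℕₚ.*-monoˡ-≤ (K ℕ.* K) (isqrt-lower (n ℕ.* (J ℕ.* J))))
      (ℕₚ.≤-reflexive (NS.solve 3 (λ n J K → (n NS.:* (J NS.:* J)) NS.:* (K NS.:* K) NS.:= (n NS.:* (K NS.:* K)) NS.:* (J NS.:* J)) refl n J K))))
    (ℕₚ.<-≤-trans (ℕₚ.*-monoˡ-< (J ℕ.* J) (isqrt-upper (n ℕ.* (K ℕ.* K))))
      (ℕₚ.≤-reflexive (NS.solve 2 (λ p K → (p NS.:* p) NS.:* (K NS.:* K) NS.:= (p NS.:* K) NS.:* (p NS.:* K)) refl (suc q) J)))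

√-cauchy : ∀ n → IsCauchy (√-approx n)
√-cauchy n ε 0<ε =
  let N , small = /-small 0<ε
      half = λ i j N≤j → ℚₚ.≤-trans (√-step n i j) (ℚₚ.+-monoʳ-≤ (√-approx n j) (small j N≤j))
  in N , λ i j N≤i N≤j → ⇒∣-∣≤ (half i j N≤j) (half j i N≤i)

expTerm : ℚ → ℕ → ℚ
expTerm q zero    = 1ℚ
expTerm q (suc k) = expTerm q k ℚ.* (q ℚ.* (+ 1 ℚ./ suc k))

expSum : ℚ → ℕ → ℚ
expSum q zero    = expTerm q zero
expSum q (suc k) = expSum q k ℚ.+ expTerm q (suc k)

module _ where
  open import Data.Rational.Base using (_*_; _+_; _-_; -_; ∣_∣; _/_)
  open ℚₚ.≤-Reasoning
  open ℚ-Solver.+-*-Solver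

  ∣*/∣ : ∀ q k → ∣ q * (+ 1 / suc k) ∣ ≡ ∣ q ∣ * (+ 1 / suc k)
  ∣*/∣ q k = trans (ℚₚ.∣p*q∣≡∣p∣*∣q∣ q (+ 1 / suc k)) (cong (∣ q ∣ *_) (ℚₚ.0≤p⇒∣p∣≡p (0≤/ k)))

  expTerm-nonNeg : ∀ {q} → 0ℚ ℚ.≤ q → ∀ k → 0ℚ ℚ.≤ expTerm q k
  expTerm-nonNeg 0≤q zero    = ℚₚ.<⇒≤ 0<1
  expTerm-nonNeg 0≤q (suc k) = 0≤* (expTerm-nonNeg 0≤q k) (0≤* 0≤q (0≤/ k))

  expTerm-bound : ∀ {q C} → ∣ q ∣ ℚ.≤ C → ∀ k → ∣ expTerm q k ∣ ℚ.≤ expTerm C k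
  expTerm-bound h zero = ℚₚ.≤-refl
  expTerm-bound {q} {C} h (suc k) = begin
    ∣ expTerm q k * (q * (+ 1 / suc k)) ∣    ≡⟨ ℚₚ.∣p*q∣≡∣p∣*∣q∣ (expTerm q k) _ ⟩
    ∣ expTerm q k ∣ * ∣ q * (+ 1 / suc k) ∣  ≡⟨ cong (∣ expTerm q k ∣ *_) (∣*/∣ q k) ⟩
    ∣ expTerm q k ∣ * (∣ q ∣ * (+ 1 / suc k))
      ≤⟨ *-mono (ℚₚ.0≤∣p∣ (expTerm q k)) (0≤* (ℚₚ.≤-trans (ℚₚ.0≤∣p∣ q) h) (0≤/ k)) (expTerm-bound h k) (*-monoʳ (0≤/ k) h) ⟩
    expTerm C k * (C * (+ 1 / suc k))        ∎

  expTerm-lipschitz : ∀ {p q B} → ∣ p ∣ ℚ.≤ B → ∣ q ∣ ℚ.≤ B → ∀ k →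
                      ∣ expTerm p k - expTerm q k ∣ ℚ.≤ ∣ p - q ∣ * expTerm (B + 1ℚ) k
  expTerm-lipschitz {p} {q} {B} _ _ zero = begin
    0ℚ              ≤⟨ ℚₚ.0≤∣p∣ (p - q) ⟩
    ∣ p - q ∣       ≡⟨ ℚₚ.*-identityʳ ∣ p - q ∣ ⟨
    ∣ p - q ∣ * 1ℚ  ∎
  expTerm-lipschitz {p} {q} {B} hp hq (suc k) = begin
    ∣ u * (p * r) - v * (q * r) ∣
      ≡⟨ cong ∣_∣ (solve 5 (λ u v p q r → u :* (p :* r) :- v :* (q :* r) := (u :* (p :- q) :+ (u :- v) :* q) :* r) refl u v p q r) ⟩
    ∣ (u * (p - q) + (u - v) * q) * r ∣
      ≡⟨ ∣*/∣ (u * (p - q) + (u - v) * q) k ⟩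
    ∣ u * (p - q) + (u - v) * q ∣ * r
      ≤⟨ *-monoʳ (0≤/ k) (ℚₚ.∣p+q∣≤∣p∣+∣q∣ (u * (p - q)) ((u - v) * q)) ⟩
    (∣ u * (p - q) ∣ + ∣ (u - v) * q ∣) * r
      ≡⟨ cong (_* r) (cong₂ _+_ (ℚₚ.∣p*q∣≡∣p∣*∣q∣ u (p - q)) (ℚₚ.∣p*q∣≡∣p∣*∣q∣ (u - v) q)) ⟩
    (∣ u ∣ * d + ∣ u - v ∣ * ∣ q ∣) * r
      ≤⟨ *-monoʳ (0≤/ k) (ℚₚ.+-mono-≤ (*-monoʳ (ℚₚ.0≤∣p∣ (p - q)) (expTerm-bound p≤ k))
           (*-mono (ℚₚ.0≤∣p∣ (u - v)) 0≤B (expTerm-lipschitz hp hq k) hq)) ⟩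
    (w * d + d * w * B) * r
      ≡⟨ solve 4 (λ w d B r → (w :* d :+ d :* w :* B) :* r := d :* (w :* ((B :+ con 1ℚ) :* r))) refl w d B r ⟩
    d * (w * ((B + 1ℚ) * r)) ∎
    where
    r = + 1 / suc k
    u = expTerm p k
    v = expTerm q k
    w = expTerm (B + 1ℚ) k
    d = ∣ p - q ∣
    0≤B = ℚₚ.≤-trans (ℚₚ.0≤∣p∣ p) hp
    p≤ : ∣ p ∣ ℚ.≤ B + 1ℚ
    p≤ = ℚₚ.≤-trans (ℚₚ.≤-reflexive (sym (ℚₚ.+-identityʳ ∣ p ∣))) (ℚₚ.+-mono-≤ hp (ℚₚ.<⇒≤ 0<1))

  expSum-lipschitz : ∀ {p q B} → ∣ p ∣ ℚ.≤ B → ∣ q ∣ ℚ.≤ B → ∀ k →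
                     ∣ expSum p k - expSum q k ∣ ℚ.≤ ∣ p - q ∣ * expSum (B + 1ℚ) k
  expSum-lipschitz hp hq zero = expTerm-lipschitz hp hq zero
  expSum-lipschitz {p} {q} {B} hp hq (suc k) = begin
    ∣ (a + t) - (b + u) ∣       ≡⟨ cong ∣_∣ (solve 4 (λ a t b u → (a :+ t) :- (b :+ u) := (a :- b) :+ (t :- u)) refl a t b u) ⟩
    ∣ (a - b) + (t - u) ∣       ≤⟨ ℚₚ.∣p+q∣≤∣p∣+∣q∣ (a - b) (t - u) ⟩
    ∣ a - b ∣ + ∣ t - u ∣       ≤⟨ ℚₚ.+-mono-≤ (expSum-lipschitz hp hq k) (expTerm-lipschitz hp hq (suc k)) ⟩
    ∣ p - q ∣ * expSum (B + 1ℚ) k + ∣ p - q ∣ * expTerm (B + 1ℚ) (suc k)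
                                ≡⟨ ℚₚ.*-distribˡ-+ ∣ p - q ∣ _ _ ⟨
    ∣ p - q ∣ * expSum (B + 1ℚ) (suc k) ∎
    where
    a = expSum p k
    b = expSum q k
    t = expTerm p (suc k)
    u = expTerm q (suc k)

  expSum-tail : ∀ {q C} → ∣ q ∣ ℚ.≤ C → ∀ k d →
                ∣ expSum q (d ℕ.+ k) - expSum q k ∣ ℚ.≤ expSum C (d ℕ.+ k) - expSum C k
  expSum-tail {q} {C} h k zero = ℚₚ.≤-reflexive (trans (cong ∣_∣ (ℚₚ.+-inverseʳ (expSum q k))) (sym (ℚₚ.+-inverseʳ (expSum C k))))
  expSum-tail {q} {C} h k (suc d) = begin
    ∣ (a + t) - b ∣        ≡⟨ cong ∣_∣ (solve 3 (λ a t b → (a :+ t) :- b := (a :- b) :+ t) refl a t b) ⟩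
    ∣ (a - b) + t ∣        ≤⟨ ℚₚ.∣p+q∣≤∣p∣+∣q∣ (a - b) t ⟩
    ∣ a - b ∣ + ∣ t ∣      ≤⟨ ℚₚ.+-mono-≤ (expSum-tail h k d) (expTerm-bound h (suc d ℕ.+ k)) ⟩
    (A - B) + T            ≡⟨ solve 3 (λ a t b → (a :+ t) :- b := (a :- b) :+ t) refl A T B ⟨
    (A + T) - B            ∎
    where
    a = expSum q (d ℕ.+ k)
    b = expSum q k
    t = expTerm q (suc d ℕ.+ k)
    A = expSum C (d ℕ.+ k)
    B = expSum C k
    T = expTerm C (suc d ℕ.+ k)

  module ExpTail {C : ℚ} (0≤C : 0ℚ ℚ.≤ C) (K : ℕ) (C+C≤K : C + C ℚ.≤ ι K) where

    halving : ∀ k → K ℕ.≤ k → expTerm C (suc k) ℚ.≤ expTerm C k * ½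
    halving k K≤k = *-monoˡ (expTerm-nonNeg 0≤C k) (begin
      C * r              ≡⟨ solve 2 (λ C r → C :* r := con ½ :* ((C :+ C) :* r)) refl C r ⟩
      ½ * ((C + C) * r)  ≤⟨ *-monoˡ (ℚₚ.<⇒≤ 0<½) (*-monoʳ (0≤/ k)
                              (ℚₚ.≤-trans C+C≤K (ι-mono (ℕₚ.≤-trans K≤k (ℕₚ.n≤1+n k))))) ⟩
      ½ * (ι (suc k) * r) ≡⟨ cong (½ *_) (ι-suc*/ k) ⟩
      ½ * 1ℚ             ≡⟨⟩
      ½                  ∎)
      where r = + 1 / suc k

    sum+term-anti : ∀ k → K ℕ.≤ k → ∀ d → expSum C (d ℕ.+ k) + expTerm C (d ℕ.+ k) ℚ.≤ expSum C k + expTerm C k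
    sum+term-anti k K≤k zero = ℚₚ.≤-refl
    sum+term-anti k K≤k (suc d) = begin
      (S + t′) + t′         ≡⟨ ℚₚ.+-assoc S t′ t′ ⟩
      S + (t′ + t′)         ≤⟨ ℚₚ.+-monoʳ-≤ S (ℚₚ.+-mono-≤ h h) ⟩
      S + (t * ½ + t * ½)   ≡⟨ cong (λ x → S + x) (solve 1 (λ t → t :* con ½ :+ t :* con ½ := t) refl t) ⟩
      S + t                 ≤⟨ sum+term-anti k K≤k d ⟩
      expSum C k + expTerm C k ∎
      where
      S = expSum C (d ℕ.+ k)
      t = expTerm C (d ℕ.+ k)
      t′ = expTerm C (suc d ℕ.+ k)
      h = halving (d ℕ.+ k) (ℕₚ.≤-trans K≤k (ℕₚ.m≤n+m k d))

    tail≤term : ∀ k → K ℕ.≤ k → ∀ d → expSum C (d ℕ.+ k) - expSum C k ℚ.≤ expTerm C k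
    tail≤term k K≤k d = begin
      S′ - S                 ≤⟨ ℚₚ.+-monoˡ-≤ (- S) (ℚₚ.≤-trans (ℚₚ.≤-reflexive (sym (ℚₚ.+-identityʳ S′)))
                                 (ℚₚ.≤-trans (ℚₚ.+-monoʳ-≤ S′ (expTerm-nonNeg 0≤C (d ℕ.+ k))) (sum+term-anti k K≤k d))) ⟩
      (S + expTerm C k) - S  ≡⟨ solve 2 (λ S t → (S :+ t) :- S := t) refl S (expTerm C k) ⟩
      expTerm C k            ∎
      where
      S = expSum C k
      S′ = expSum C (d ℕ.+ k)

    decay : ∀ d → expTerm C (d ℕ.+ K) * ι (suc d) ℚ.≤ expTerm C K
    decay zero = ℚₚ.≤-reflexive (ℚₚ.*-identityʳ (expTerm C K))
    decay (suc d) = begin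
      t′ * ι (suc (suc d))            ≤⟨ *-monoʳ (ι-mono {0} {suc (suc d)} z≤n) (halving (d ℕ.+ K) (ℕₚ.m≤n+m K d)) ⟩
      t * ½ * ι (suc (suc d))         ≡⟨ cong (t * ½ *_) (trans (ι-suc (suc d)) (cong (λ x → 1ℚ + x) (ι-suc d))) ⟩
      t * ½ * (1ℚ + (1ℚ + ι d))       ≡⟨ solve 2 (λ t n → t :* con ½ :* (con 1ℚ :+ (con 1ℚ :+ n)) := t :* (con 1ℚ :+ con ½ :* n)) refl t (ι d) ⟩
      t * (1ℚ + ½ * ι d)              ≤⟨ *-monoˡ (expTerm-nonNeg 0≤C (d ℕ.+ K)) (ℚₚ.+-monoʳ-≤ 1ℚ
                                           (ℚₚ.≤-trans (*-monoʳ (ι-mono {0} {d} z≤n) ½≤1) (ℚₚ.≤-reflexive (ℚₚ.*-identityˡ (ι d))))) ⟩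
      t * (1ℚ + ι d)                  ≡⟨ cong (t *_) (ι-suc d) ⟨
      t * ι (suc d)                   ≤⟨ decay d ⟩
      expTerm C K                     ∎
      where
      t = expTerm C (d ℕ.+ K)
      t′ = expTerm C (suc d ℕ.+ K)
      ½≤1 : ½ ℚ.≤ 1ℚ
      ½≤1 = /-mono 1 2 1 1 (s≤s z≤n)

    term-small : ∀ {ε} → 0ℚ ℚ.< ε → ∃[ N ] K ℕ.≤ N × expTerm C N ℚ.≤ ε
    term-small {ε} 0<ε =
      let r , 0<r , εr≡1 = 0<⇒∃/ 0<ε
          J , h = archimedean (expTerm C K * r)
          t = expTerm C (J ℕ.+ K)
      in J ℕ.+ K , ℕₚ.m≤n+m K J , (begin
        t                              ≡⟨ ℚₚ.*-identityʳ t ⟨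
        t * 1ℚ                         ≡⟨ cong (t *_) (ι-suc*/ J) ⟨
        t * (ι (suc J) * (+ 1 / suc J)) ≡⟨ ℚₚ.*-assoc t _ _ ⟨
        t * ι (suc J) * (+ 1 / suc J)  ≤⟨ *-monoʳ (0≤/ J) (decay J) ⟩
        expTerm C K * (+ 1 / suc J)    ≡⟨ cong (_* (+ 1 / suc J)) (trans (sym (ℚₚ.*-identityʳ (expTerm C K))) (cong (expTerm C K *_) (sym εr≡1))) ⟩
        expTerm C K * (ε * r) * (+ 1 / suc J)
          ≡⟨ solve 4 (λ T e r u → T :* (e :* r) :* u := e :* ((T :* r) :* u)) refl (expTerm C K) ε r (+ 1 / suc J) ⟩
        ε * (expTerm C K * r * (+ 1 / suc J))
          ≤⟨ *-monoˡ (ℚₚ.<⇒≤ 0<ε) (*-monoʳ (0≤/ J) (ℚₚ.≤-trans h (ι-mono (ℕₚ.n≤1+n J)))) ⟩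
        ε * (ι (suc J) * (+ 1 / suc J)) ≡⟨ cong (ε *_) (ι-suc*/ J) ⟩
        ε * 1ℚ                         ≡⟨ ℚₚ.*-identityʳ ε ⟩
        ε                              ∎)

    sum-bound : ∀ k → K ℕ.≤ k → expSum C k ℚ.≤ expSum C K + expTerm C K
    sum-bound k K≤k = subst (λ k → expSum C k ℚ.≤ expSum C K + expTerm C K) (ℕₚ.m∸n+n≡m K≤k) (begin
      expSum C (k ℕ.∸ K ℕ.+ K)          ≡⟨ ℚₚ.+-identityʳ _ ⟨
      expSum C (k ℕ.∸ K ℕ.+ K) + 0ℚ     ≤⟨ ℚₚ.+-monoʳ-≤ (expSum C (k ℕ.∸ K ℕ.+ K)) (expTerm-nonNeg 0≤C (k ℕ.∸ K ℕ.+ K)) ⟩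
      expSum C (k ℕ.∸ K ℕ.+ K) + expTerm C (k ℕ.∸ K ℕ.+ K) ≤⟨ sum+term-anti K ℕₚ.≤-refl (k ℕ.∸ K) ⟩
      expSum C K + expTerm C K          ∎)

  1≤expSum : ∀ {q} → 0ℚ ℚ.≤ q → ∀ k → 1ℚ ℚ.≤ expSum q k
  1≤expSum 0≤q zero    = ℚₚ.≤-refl
  1≤expSum 0≤q (suc k) = ℚₚ.+-mono-≤ (1≤expSum 0≤q k) (expTerm-nonNeg 0≤q (suc k))

  p≤p+ : ∀ p {q} → 0ℚ ℚ.≤ q → p ℚ.≤ p + q
  p≤p+ p 0≤q = ℚₚ.≤-trans (ℚₚ.≤-reflexive (sym (ℚₚ.+-identityʳ p))) (ℚₚ.+-monoʳ-≤ p 0≤q)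

  module ExpOn (B : ℚ) (0<B : 0ℚ ℚ.< B) where

    C : ℚ
    C = B + 1ℚ

    B≤C : B ℚ.≤ C
    B≤C = p≤p+ B (ℚₚ.<⇒≤ 0<1)

    0≤C : 0ℚ ℚ.≤ C
    0≤C = ℚₚ.≤-trans (ℚₚ.<⇒≤ 0<B) B≤C

    K : ℕ
    K = proj₁ (archimedean (C + C))

    open ExpTail 0≤C K (proj₂ (archimedean (C + C)))

    D : ℚ
    D = expSum C K + expTerm C K

    0<D : 0ℚ ℚ.< D
    0<D = ℚₚ.<-≤-trans 0<1 (ℚₚ.≤-trans (1≤expSum 0≤C K) (p≤p+ (expSum C K) (expTerm-nonNeg 0≤C K)))

    lipschitz : ∀ p q k → ∣ p ∣ ℚ.≤ B → ∣ q ∣ ℚ.≤ B → K ℕ.≤ k → ∣ expSum p k - expSum q k ∣ ℚ.≤ ∣ p - q ∣ * D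
    lipschitz p q k hp hq K≤k = ℚₚ.≤-trans (expSum-lipschitz hp hq k) (*-monoˡ (ℚₚ.0≤∣p∣ (p - q)) (sum-bound k K≤k))

    uniform : ∀ ε → 0ℚ ℚ.< ε → ∃[ M ] K ℕ.≤ M × (∀ q → ∣ q ∣ ℚ.≤ B → ∀ i → M ℕ.≤ i → ∣ expSum q i - expSum q M ∣ ℚ.≤ ε)
    uniform ε 0<ε = let M , K≤M , term≤ε = term-small 0<ε in
      M , K≤M , λ q hq i M≤i → subst (λ k → ∣ expSum q k - expSum q M ∣ ℚ.≤ ε) (ℕₚ.m∸n+n≡m M≤i)
        (ℚₚ.≤-trans (expSum-tail (ℚₚ.≤-trans hq B≤C) M (i ℕ.∸ M)) (ℚₚ.≤-trans (tail≤term M K≤M (i ℕ.∸ M)) term≤ε))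

  exp-cauchy : ∀ s → IsCauchy s → IsCauchy (λ i → expSum (s i) i)
  exp-cauchy s c =
    let B , 0<B , L , bound = bounded s c
        open ExpOn B 0<B
    in cauchy-scale (1ℚ + D + 1ℚ) (λ i → expSum (s i) i) (ℚₚ.+-mono-< (ℚₚ.+-mono-< 0<1 0<D) 0<1) λ ε 0<ε →
    let M , K≤M , tail = uniform ε 0<ε
        N , p = c ε 0<ε
        X = (M ℕ.⊔ N) ℕ.⊔ L
        M≤ = ℕₚ.≤-trans (ℕₚ.m≤m⊔n M N) (ℕₚ.m≤m⊔n _ L)
        N≤ = ℕₚ.≤-trans (ℕₚ.m≤n⊔m M N) (ℕₚ.m≤m⊔n _ L)
        L≤ = ℕₚ.m≤n⊔m (M ℕ.⊔ N) L
        tail′ : ∀ i → X ℕ.≤ i → ∣ expSum (s i) i - expSum (s i) M ∣ ℚ.≤ ε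
        tail′ i X≤i = tail (s i) (bound i (ℕₚ.≤-trans L≤ X≤i)) i (ℕₚ.≤-trans M≤ X≤i)
    in X , λ i j X≤i X≤j → begin
      ∣ expSum (s i) i - expSum (s j) j ∣
        ≤⟨ ∣-∣-via (expSum (s i) i) (expSum (s j) M) (expSum (s j) j) ⟩
      ∣ expSum (s i) i - expSum (s j) M ∣ + ∣ expSum (s j) M - expSum (s j) j ∣
        ≤⟨ ℚₚ.+-mono-≤ (∣-∣-via (expSum (s i) i) (expSum (s i) M) (expSum (s j) M))
             (ℚₚ.≤-trans (ℚₚ.≤-reflexive (∣-∣-comm (expSum (s j) M) (expSum (s j) j))) (tail′ j X≤j)) ⟩
      ∣ expSum (s i) i - expSum (s i) M ∣ + ∣ expSum (s i) M - expSum (s j) M ∣ + ε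
        ≤⟨ ℚₚ.+-monoˡ-≤ ε (ℚₚ.+-mono-≤ (tail′ i X≤i) (ℚₚ.≤-trans
             (lipschitz (s i) (s j) M (bound i (ℕₚ.≤-trans L≤ X≤i)) (bound j (ℕₚ.≤-trans L≤ X≤j)) K≤M)
             (*-monoʳ (ℚₚ.<⇒≤ 0<D) (p i j (ℕₚ.≤-trans N≤ X≤i) (ℕₚ.≤-trans N≤ X≤j))))) ⟩
      ε + ε * D + ε
        ≡⟨ solve 2 (λ e D → e :+ e :* D :+ e := (con 1ℚ :+ D :+ con 1ℚ) :* e) refl ε D ⟩
      (1ℚ + D + 1ℚ) * ε ∎

lastBelow : (ℕ → ℚ) → ℚ → ℕ → ℕ
lastBelow g y zero = 0
lastBelow g y (suc k) with g (suc k) ℚₚ.≤? y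
... | yes _ = suc k
... | no  _ = lastBelow g y k

lnIndex : ℚ → ℕ → ℕ
lnIndex y i = lastBelow (λ k → expSum (+ k ℚ./ suc i) i) y (proj₁ (archimedean y) ℕ.* suc i)

-- The largest multiple q of 1/(i+1), up to an integer bound for y, such that
-- Σ_{k≤i} qᵏ / k! ≤ y.
lnApprox : ℚ → ℕ → ℚ
lnApprox y i = + lnIndex y i ℚ./ suc i

module _ where
  open import Data.Rational.Base using (_*_; _+_; _-_; -_; ∣_∣; _/_)
  open ℚₚ.≤-Reasoning
  open ℚ-Solver.+-*-Solver

  lastBelow-below : ∀ (g : ℕ → ℚ) y M → g 0 ℚ.≤ y → g (lastBelow g y M) ℚ.≤ y
  lastBelow-below g y zero    h = h
  lastBelow-below g y (suc k) h with g (suc k) ℚₚ.≤? y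
  ... | yes p = p
  ... | no  _ = lastBelow-below g y k h

  lastBelow-last : ∀ (g : ℕ → ℚ) y M → lastBelow g y M ≡ M ⊎ y ℚ.≤ g (suc (lastBelow g y M))
  lastBelow-last g y zero = inj₁ refl
  lastBelow-last g y (suc k) with g (suc k) ℚₚ.≤? y
  ... | yes _ = inj₁ refl
  ... | no ¬p with lastBelow-last g y k
  ...   | inj₁ eq = inj₂ (subst (λ n → y ℚ.≤ g (suc n)) (sym eq) (ℚₚ.<⇒≤ (ℚₚ.≰⇒> ¬p)))
  ...   | inj₂ q  = inj₂ q

  expTerm-mono : ∀ {p q} → 0ℚ ℚ.≤ p → p ℚ.≤ q → ∀ k → expTerm p k ℚ.≤ expTerm q k
  expTerm-mono 0≤p p≤q zero    = ℚₚ.≤-refl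
  expTerm-mono 0≤p p≤q (suc k) = *-mono (expTerm-nonNeg 0≤p k) (0≤* (ℚₚ.≤-trans 0≤p p≤q) (0≤/ k))
    (expTerm-mono 0≤p p≤q k) (*-monoʳ (0≤/ k) p≤q)

  expSum-mono : ∀ {p q} → 0ℚ ℚ.≤ p → p ℚ.≤ q → ∀ k → expSum p k ℚ.≤ expSum q k
  expSum-mono 0≤p p≤q zero    = ℚₚ.≤-refl
  expSum-mono 0≤p p≤q (suc k) = ℚₚ.+-mono-≤ (expSum-mono 0≤p p≤q k) (expTerm-mono 0≤p p≤q (suc k))

  expSum-slope : ∀ {p q} → 0ℚ ℚ.≤ p → p ℚ.≤ q → ∀ k → expSum p (suc k) + (q - p) ℚ.≤ expSum q (suc k)
  expSum-slope {p} {q} 0≤p p≤q zero = ℚₚ.≤-reflexive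
    (solve 2 (λ p q → (con 1ℚ :+ con 1ℚ :* (p :* con (+ 1 / 1))) :+ (q :- p) := con 1ℚ :+ con 1ℚ :* (q :* con (+ 1 / 1))) refl p q)
  expSum-slope {p} {q} 0≤p p≤q (suc k) = begin
    (S + t) + (q - p)  ≡⟨ solve 4 (λ S t q p → (S :+ t) :+ (q :- p) := (S :+ (q :- p)) :+ t) refl S t q p ⟩
    (S + (q - p)) + t  ≤⟨ ℚₚ.+-mono-≤ (expSum-slope 0≤p p≤q k) (expTerm-mono 0≤p p≤q (suc (suc k))) ⟩
    expSum q (suc k) + expTerm q (suc (suc k)) ∎
    where
    S = expSum p (suc k)
    t = expTerm p (suc (suc k))

  expSum-expanding : ∀ p q → 0ℚ ℚ.≤ p → 0ℚ ℚ.≤ q → ∀ k → 1 ℕ.≤ k → ∣ p - q ∣ ℚ.≤ ∣ expSum p k - expSum q k ∣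
  expSum-expanding p q 0≤p 0≤q (suc k) _ with ℚₚ.≤-total p q
  ... | inj₁ p≤q = ℚₚ.≤-trans (ℚₚ.≤-reflexive (∣-∣-comm p q)) (ℚₚ.≤-trans (lem p q 0≤p p≤q)
                     (ℚₚ.≤-reflexive (∣-∣-comm (expSum q (suc k)) (expSum p (suc k)))))
    where
    lem : ∀ p q → 0ℚ ℚ.≤ p → p ℚ.≤ q → ∣ q - p ∣ ℚ.≤ ∣ expSum q (suc k) - expSum p (suc k) ∣
    lem p q 0≤p p≤q = begin
      ∣ q - p ∣                  ≡⟨ ℚₚ.0≤p⇒∣p∣≡p (ℚₚ.≤-trans (ℚₚ.≤-reflexive (sym (ℚₚ.+-inverseʳ p))) (ℚₚ.+-monoˡ-≤ (- p) p≤q)) ⟩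
      q - p                      ≡⟨ solve 2 (λ S d → d := (S :+ d) :- S) refl (expSum p (suc k)) (q - p) ⟩
      (expSum p (suc k) + (q - p)) - expSum p (suc k) ≤⟨ ℚₚ.+-monoˡ-≤ (- expSum p (suc k)) (expSum-slope 0≤p p≤q k) ⟩
      expSum q (suc k) - expSum p (suc k) ≤⟨ p≤∣p∣ (expSum q (suc k) - expSum p (suc k)) ⟩
      ∣ expSum q (suc k) - expSum p (suc k) ∣ ∎
  ... | inj₂ q≤p = begin
      ∣ p - q ∣                  ≡⟨ ℚₚ.0≤p⇒∣p∣≡p (ℚₚ.≤-trans (ℚₚ.≤-reflexive (sym (ℚₚ.+-inverseʳ q))) (ℚₚ.+-monoˡ-≤ (- q) q≤p)) ⟩
      p - q                      ≡⟨ solve 2 (λ S d → d := (S :+ d) :- S) refl (expSum q (suc k)) (p - q) ⟩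
      (expSum q (suc k) + (p - q)) - expSum q (suc k) ≤⟨ ℚₚ.+-monoˡ-≤ (- expSum q (suc k)) (expSum-slope 0≤q q≤p k) ⟩
      expSum p (suc k) - expSum q (suc k) ≤⟨ p≤∣p∣ (expSum p (suc k) - expSum q (suc k)) ⟩
      ∣ expSum p (suc k) - expSum q (suc k) ∣ ∎

  expSum-zero : ∀ k → expSum 0ℚ k ≡ 1ℚ
  expSum-zero zero    = refl
  expSum-zero (suc k) = trans (cong₂ _+_ (expSum-zero k)
    (trans (cong (expTerm 0ℚ k *_) (ℚₚ.*-zeroˡ (+ 1 / suc k))) (ℚₚ.*-zeroʳ (expTerm 0ℚ k)))) (ℚₚ.+-identityʳ 1ℚ)

  1+q≤expSum : ∀ {q} → 0ℚ ℚ.≤ q → ∀ k → 1 ℕ.≤ k → 1ℚ + q ℚ.≤ expSum q k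
  1+q≤expSum {q} 0≤q (suc k) _ = begin
    1ℚ + q                        ≡⟨ cong₂ _+_ (expSum-zero (suc k)) (ℚₚ.+-identityʳ q) ⟨
    expSum 0ℚ (suc k) + (q - 0ℚ)  ≤⟨ expSum-slope ℚₚ.≤-refl 0≤q k ⟩
    expSum q (suc k)              ∎

  q≤expSum : ∀ {q} → 0ℚ ℚ.≤ q → ∀ k → 1 ℕ.≤ k → q ℚ.≤ expSum q k
  q≤expSum {q} 0≤q k 1≤k = ℚₚ.≤-trans (ℚₚ.≤-trans (p≤p+ q (ℚₚ.<⇒≤ 0<1)) (ℚₚ.≤-reflexive (ℚₚ.+-comm q 1ℚ))) (1+q≤expSum 0≤q k 1≤k)

  0≤lnApprox : ∀ y i → 0ℚ ℚ.≤ lnApprox y i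
  0≤lnApprox y i = /-mono 0 1 (lnIndex y i) (suc i) z≤n

  lnApprox-below : ∀ y i → 1ℚ ℚ.≤ y → expSum (lnApprox y i) i ℚ.≤ y
  lnApprox-below y i 1≤y = lastBelow-below (λ k → expSum (+ k / suc i) i) y (proj₁ (archimedean y) ℕ.* suc i)
    (ℚₚ.≤-trans (ℚₚ.≤-reflexive (trans (cong (λ q → expSum q i) 0/≡0) (expSum-zero i))) 1≤y)
    where
    0/≡0 : + 0 / suc i ≡ 0ℚ
    0/≡0 = ℚₚ.≤-antisym (/-mono 0 (suc i) 0 1 z≤n) (/-mono 0 1 0 (suc i) z≤n)

  lnApprox-above : ∀ y i → 1 ℕ.≤ i → y ℚ.≤ expSum (lnApprox y i + + 1 / suc i) i
  lnApprox-above y i 1≤i = [ top , (λ h → ℚₚ.≤-trans h (ℚₚ.≤-reflexive (cong (λ q → expSum q i) (suc/ k i)))) ]′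
    (lastBelow-last g y (n ℕ.* suc i))
    where
    g : ℕ → ℚ
    g k = expSum (+ k / suc i) i
    n = proj₁ (archimedean y)
    k = lnIndex y i
    top : k ≡ n ℕ.* suc i → y ℚ.≤ expSum (lnApprox y i + + 1 / suc i) i
    top k≡ = begin
      y                                   ≤⟨ proj₂ (archimedean y) ⟩
      ι n                                 ≤⟨ /-mono n 1 (n ℕ.* suc i) (suc i) (ℕₚ.≤-reflexive (sym (ℕₚ.*-identityʳ (n ℕ.* suc i)))) ⟩
      + (n ℕ.* suc i) / suc i             ≡⟨ cong (λ k → + k / suc i) k≡ ⟨
      lnApprox y i                        ≤⟨ q≤expSum (0≤lnApprox y i) i 1≤i ⟩
      expSum (lnApprox y i) i             ≤⟨ expSum-mono (0≤lnApprox y i) (p≤p+ (lnApprox y i) (0≤/ i)) i ⟩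
      expSum (lnApprox y i + + 1 / suc i) i ∎

  module Ln (s : ℕ → ℚ) (c : IsCauchy s) (N₁ : ℕ) (1≤s : ∀ i → N₁ ℕ.≤ i → 1ℚ ℚ.≤ s i) where

    Y : ℚ
    Y = proj₁ (bounded s c)

    L : ℕ
    L = proj₁ (proj₂ (proj₂ (bounded s c)))

    0<Y+1 : 0ℚ ℚ.< Y + 1ℚ
    0<Y+1 = ℚₚ.+-mono-< (proj₁ (proj₂ (bounded s c))) 0<1

    open ExpOn (Y + 1ℚ) 0<Y+1

    q : ℕ → ℚ
    q i = lnApprox (s i) i

    N₀ : ℕ
    N₀ = (1 ℕ.⊔ N₁) ℕ.⊔ (L ℕ.⊔ K)

    1≤N₀ : 1 ℕ.≤ N₀
    1≤N₀ = ℕₚ.≤-trans (ℕₚ.m≤m⊔n 1 N₁) (ℕₚ.m≤m⊔n _ _)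

    N₁≤N₀ : N₁ ℕ.≤ N₀
    N₁≤N₀ = ℕₚ.≤-trans (ℕₚ.m≤n⊔m 1 N₁) (ℕₚ.m≤m⊔n _ _)

    L≤N₀ : L ℕ.≤ N₀
    L≤N₀ = ℕₚ.≤-trans (ℕₚ.m≤m⊔n L K) (ℕₚ.m≤n⊔m (1 ℕ.⊔ N₁) _)

    K≤N₀ : K ℕ.≤ N₀
    K≤N₀ = ℕₚ.≤-trans (ℕₚ.m≤n⊔m L K) (ℕₚ.m≤n⊔m (1 ℕ.⊔ N₁) _)

    0≤q : ∀ i → 0ℚ ℚ.≤ q i
    0≤q i = 0≤lnApprox (s i) i

    q≤Y : ∀ i → N₀ ℕ.≤ i → q i ℚ.≤ Y
    q≤Y i N₀≤i = begin
      q i             ≤⟨ q≤expSum (0≤q i) i (ℕₚ.≤-trans 1≤N₀ N₀≤i) ⟩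
      expSum (q i) i  ≤⟨ lnApprox-below (s i) i (1≤s i (ℕₚ.≤-trans N₁≤N₀ N₀≤i)) ⟩
      s i             ≤⟨ p≤∣p∣ (s i) ⟩
      ∣ s i ∣         ≤⟨ proj₂ (proj₂ (proj₂ (bounded s c))) i (ℕₚ.≤-trans L≤N₀ N₀≤i) ⟩
      Y               ∎

    ∣q∣≤ : ∀ i → N₀ ℕ.≤ i → ∣ q i ∣ ℚ.≤ Y + 1ℚ
    ∣q∣≤ i N₀≤i = ℚₚ.≤-trans (ℚₚ.≤-reflexive (ℚₚ.0≤p⇒∣p∣≡p (0≤q i))) (ℚₚ.≤-trans (q≤Y i N₀≤i) (p≤p+ Y (ℚₚ.<⇒≤ 0<1)))

    close : ∀ i → N₀ ℕ.≤ i → ∣ expSum (q i) i - s i ∣ ℚ.≤ (+ 1 / suc i) * D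
    close i N₀≤i = ⇒∣-∣≤
      (ℚₚ.≤-trans (lnApprox-below (s i) i (1≤s i (ℕₚ.≤-trans N₁≤N₀ N₀≤i))) (p≤p+ (s i) (0≤* (0≤/ i) (ℚₚ.<⇒≤ 0<D))))
      (begin
        s i                              ≤⟨ lnApprox-above (s i) i (ℕₚ.≤-trans 1≤N₀ N₀≤i) ⟩
        expSum (q i + r) i               ≤⟨ ∣-∣≤⇒ (expSum (q i + r) i) (expSum (q i) i)
                                              (lipschitz (q i + r) (q i) i q+r≤ (∣q∣≤ i N₀≤i) (ℕₚ.≤-trans K≤N₀ N₀≤i)) ⟩
        expSum (q i) i + ∣ (q i + r) - q i ∣ * D
          ≡⟨ cong (λ z → expSum (q i) i + z * D) (trans (cong ∣_∣ (solve 2 (λ q r → (q :+ r) :- q := r) refl (q i) r)) (ℚₚ.0≤p⇒∣p∣≡p (0≤/ i))) ⟩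
        expSum (q i) i + r * D           ∎)
      where
      r = + 1 / suc i
      q+r≤ : ∣ q i + r ∣ ℚ.≤ Y + 1ℚ
      q+r≤ = ℚₚ.≤-trans (ℚₚ.≤-reflexive (ℚₚ.0≤p⇒∣p∣≡p (0≤+ (0≤q i) (0≤/ i))))
        (ℚₚ.+-mono-≤ (q≤Y i N₀≤i) (/-mono 1 (suc i) 1 1 (s≤s z≤n)))

    ln-cauchy : IsCauchy q
    ln-cauchy = cauchy-scale (D + 1ℚ + D + 1ℚ + 1ℚ) q
      (ℚₚ.+-mono-< (ℚₚ.+-mono-< (ℚₚ.+-mono-< (ℚₚ.+-mono-< 0<D 0<1) 0<D) 0<1) 0<1) λ ε 0<ε →
      let N , small = /-small 0<ε
          N′ , p = c ε 0<ε
          M , _ , tail = uniform ε 0<ε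
          X = (N ℕ.⊔ N′) ℕ.⊔ (M ℕ.⊔ N₀)
          N≤ = ℕₚ.≤-trans (ℕₚ.m≤m⊔n N N′) (ℕₚ.m≤m⊔n _ (M ℕ.⊔ N₀))
          N′≤ = ℕₚ.≤-trans (ℕₚ.m≤n⊔m N N′) (ℕₚ.m≤m⊔n _ (M ℕ.⊔ N₀))
          M≤ = ℕₚ.≤-trans (ℕₚ.m≤m⊔n M N₀) (ℕₚ.m≤n⊔m (N ℕ.⊔ N′) _)
          N₀≤ = ℕₚ.≤-trans (ℕₚ.m≤n⊔m M N₀) (ℕₚ.m≤n⊔m (N ℕ.⊔ N′) _)
          close′ : ∀ i → X ℕ.≤ i → ∣ expSum (q i) i - s i ∣ ℚ.≤ ε * D
          close′ i X≤i = ℚₚ.≤-trans (close i (ℕₚ.≤-trans N₀≤ X≤i)) (*-monoʳ (ℚₚ.<⇒≤ 0<D) (small i (ℕₚ.≤-trans N≤ X≤i)))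
      in X , λ i j X≤i X≤j →
        let P = expSum (q i) i
            Q = expSum (q j) i
            R = expSum (q j) j
            T = expSum (q j) M
        in begin
        ∣ q i - q j ∣
          ≤⟨ expSum-expanding (q i) (q j) (0≤q i) (0≤q j) i (ℕₚ.≤-trans 1≤N₀ (ℕₚ.≤-trans N₀≤ X≤i)) ⟩
        ∣ P - Q ∣
          ≤⟨ ℚₚ.≤-trans (∣-∣-via P T Q) (ℚₚ.+-monoˡ-≤ ∣ T - Q ∣
             (ℚₚ.≤-trans (∣-∣-via P R T) (ℚₚ.+-monoˡ-≤ ∣ R - T ∣
             (ℚₚ.≤-trans (∣-∣-via P (s j) R) (ℚₚ.+-monoˡ-≤ ∣ s j - R ∣ (∣-∣-via P (s i) (s j))))))) ⟩
        ∣ P - s i ∣ + ∣ s i - s j ∣ + ∣ s j - R ∣ + ∣ R - T ∣ + ∣ T - Q ∣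
          ≤⟨ ℚₚ.+-mono-≤ (ℚₚ.+-mono-≤ (ℚₚ.+-mono-≤ (ℚₚ.+-mono-≤
               (close′ i X≤i)
               (p i j (ℕₚ.≤-trans N′≤ X≤i) (ℕₚ.≤-trans N′≤ X≤j)))
               (ℚₚ.≤-trans (ℚₚ.≤-reflexive (∣-∣-comm (s j) R)) (close′ j X≤j)))
               (tail (q j) (∣q∣≤ j (ℕₚ.≤-trans N₀≤ X≤j)) j (ℕₚ.≤-trans M≤ X≤j)))
               (ℚₚ.≤-trans (ℚₚ.≤-reflexive (∣-∣-comm T Q))
                 (tail (q j) (∣q∣≤ j (ℕₚ.≤-trans N₀≤ X≤j)) i (ℕₚ.≤-trans M≤ X≤i))) ⟩
        ε * D + ε + ε * D + ε + ε
          ≡⟨ solve 2 (λ e D → e :* D :+ e :+ e :* D :+ e :+ e := (D :+ con 1ℚ :+ D :+ con 1ℚ :+ con 1ℚ) :* e) refl ε D ⟩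
        (D + 1ℚ + D + 1ℚ + 1ℚ) * ε ∎

    exp-ln-close : ∀ ε → 0ℚ ℚ.< ε → ∃[ N ] ∀ i → N ℕ.≤ i → ∣ expSum (q i) i - s i ∣ ℚ.≤ ε
    exp-ln-close ε 0<ε =
      let r , 0<r , Dr≡1 = 0<⇒∃/ 0<D
          N , small = /-small (0<* 0<ε 0<r)
      in N ℕ.⊔ N₀ , λ i ≤i → begin
        ∣ expSum (q i) i - s i ∣  ≤⟨ close i (ℕₚ.m⊔n≤o⇒n≤o N N₀ ≤i) ⟩
        (+ 1 / suc i) * D         ≤⟨ *-monoʳ (ℚₚ.<⇒≤ 0<D) (small i (ℕₚ.m⊔n≤o⇒m≤o N N₀ ≤i)) ⟩
        ε * r * D                 ≡⟨ solve 3 (λ e r D → e :* r :* D := e :* (D :* r)) refl ε r D ⟩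
        ε * (D * r)               ≡⟨ cong (ε *_) Dr≡1 ⟩
        ε * 1ℚ                    ≡⟨ ℚₚ.*-identityʳ ε ⟩
        ε                         ∎

fromℚ : ℚ → ℝ
fromℚ q = mkℝ (λ _ → q) (const-cauchy q)

0ℝ 1ℝ : ℝ
0ℝ = fromℚ 0ℚ
1ℝ = fromℚ 1ℚ

infixl 6 _+_ _-_
infixl 7 _*_
infix  8 -_

_+_ : ℝ → ℝ → ℝ
x + y = mkℝ (λ i → seq x i ℚ.+ seq y i) (+-cauchy (seq x) (seq y) (cauchy x) (cauchy y))

-_ : ℝ → ℝ
- x = mkℝ (λ i → ℚ.- seq x i) (neg-cauchy (seq x) (cauchy x))

_-_ : ℝ → ℝ → ℝ
x - y = x + - y

_*_ : ℝ → ℝ → ℝ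
x * y = mkℝ (λ i → seq x i ℚ.* seq y i) (*-cauchy (seq x) (seq y) (cauchy x) (cauchy y))

max : ℝ → ℝ → ℝ
max x y = mkℝ (λ i → seq x i ℚ.⊔ seq y i) (⊔-cauchy (seq x) (seq y) (cauchy x) (cauchy y))

inv : (x : ℝ) → 0ℝ < x → ℝ
inv x (δ , 0<δ , low) = mkℝ (λ i → recip (seq x i)) (inv-cauchy (seq x) δ 0<δ low (cauchy x))

√ : ℕ → ℝ
√ n = mkℝ (√-approx n) (√-cauchy n)

-- The i-th approximation is the diagonal value Σ_{k≤i} (xᵢ)ᵏ / k!.
exp : ℝ → ℝ
exp x = mkℝ (λ i → expSum (seq x i) i) (exp-cauchy (seq x) (cauchy x))

1≤-eventually : ∀ y → ((δ , 0<δ , N , h) : 1ℝ < y) → ∀ i → N ℕ.≤ i → 1ℚ ℚ.≤ seq y i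
1≤-eventually y (δ , 0<δ , N , h) i N≤i = ℚₚ.≤-trans (p≤p+ 1ℚ (ℚₚ.<⇒≤ 0<δ)) (h i N≤i)

-- Only defined on (1,∞), where lnApprox searches nonnegative arguments; exp-ln
-- shows that it inverts exp.
ln : (y : ℝ) → 1ℝ < y → ℝ
ln y 1<y@(_ , _ , N , _) = mkℝ (λ i → lnApprox (seq y i) i) (Ln.ln-cauchy (seq y) (cauchy y) N (1≤-eventually y 1<y))

exp-ln : ∀ y (1<y : 1ℝ < y) → exp (ln y 1<y) ≃ y
exp-ln y 1<y@(_ , _ , N , _) =
  (λ ε 0<ε → let M , h = close ε 0<ε in M , λ i M≤i → ∣-∣≤⇒ (E i) (seq y i) (h i M≤i)) ,
  (λ ε 0<ε → let M , h = close ε 0<ε in M , λ i M≤i → ∣-∣≤⇒ (seq y i) (E i)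
    (ℚₚ.≤-trans (ℚₚ.≤-reflexive (∣-∣-comm (seq y i) (E i))) (h i M≤i)))
  where
  E = seq (exp (ln y 1<y))
  close = Ln.exp-ln-close (seq y) (cauchy y) N (1≤-eventually y 1<y)

2≤√5 : ∀ k → ι 2 ℚ.≤ √-approx 5 k
2≤√5 k = /-mono 2 1 r (suc k) (ℕₚ.≤-trans 2k≤r (ℕₚ.≤-reflexive (sym (ℕₚ.*-identityʳ r))))
  where
  open ℕ-Solver.+-*-Solver
  r = isqrt (5 ℕ.* (suc k ℕ.* suc k))
  2k≤r : 2 ℕ.* suc k ℕ.≤ r
  2k≤r = ℕₚ.≤-pred (sq-cancel-< (ℕₚ.≤-<-trans
    (ℕₚ.≤-trans (ℕₚ.≤-reflexive (solve 1 (λ x → (con 2 :* x) :* (con 2 :* x) := con 4 :* (x :* x)) refl (suc k)))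
      (ℕₚ.*-monoˡ-≤ (suc k ℕ.* suc k) (ℕₚ.n≤1+n 4)))
    (isqrt-upper (5 ℕ.* (suc k ℕ.* suc k)))))

√5≤5/2 : ∀ k → √-approx 5 k ℚ.≤ + 5 ℚ./ 2
√5≤5/2 k = /-mono r (suc k) 5 2 (ℕₚ.<⇒≤ (sq-cancel-< (ℕₚ.≤-<-trans
  (ℕₚ.≤-trans (ℕₚ.≤-reflexive (solve 1 (λ r → (r :* con 2) :* (r :* con 2) := con 4 :* (r :* r)) refl r))
    (ℕₚ.*-monoʳ-≤ 4 (isqrt-lower (5 ℕ.* (suc k ℕ.* suc k)))))
  (ℕₚ.<-≤-trans
    (ℕₚ.≤-<-trans (ℕₚ.≤-reflexive (sym (ℕₚ.*-assoc 4 5 (suc k ℕ.* suc k))))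
      (ℕₚ.*-monoˡ-< (suc k ℕ.* suc k) (ℕₚ.m≤m+n 21 4)))
    (ℕₚ.≤-reflexive (solve 1 (λ x → con 25 :* (x :* x) := (con 5 :* x) :* (con 5 :* x)) refl (suc k)))))))
  where
  open ℕ-Solver.+-*-Solver
  r = isqrt (5 ℕ.* (suc k ℕ.* suc k))

√5>0 : 0ℝ < √ 5
√5>0 = ι 2 , ℚₚ.positive⁻¹ (ι 2) , 0 , λ k _ → ℚₚ.≤-trans (ℚₚ.≤-reflexive (ℚₚ.+-identityˡ (ι 2))) (2≤√5 k)

a b : ℝ
a = (fromℚ (ι 3) - √ 5) * fromℚ ½
b = (fromℚ (ι 3) + √ 5) * fromℚ ½

¼≤[3-s]/2 : ∀ s → s ℚ.≤ + 5 ℚ./ 2 → + 1 ℚ./ 4 ℚ.≤ (ι 3 ℚ.- s) ℚ.* ½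
¼≤[3-s]/2 s h = *-monoʳ {ι 3 ℚ.- + 5 ℚ./ 2} {ι 3 ℚ.- s} (ℚₚ.<⇒≤ 0<½) (ℚₚ.+-monoʳ-≤ (ι 3) (ℚₚ.neg-antimono-≤ h))

3/2[3-s]/2≤[3+s]/2 : ∀ s → ι 2 ℚ.≤ s → (1ℚ ℚ.+ ½) ℚ.* ((ι 3 ℚ.- s) ℚ.* ½) ℚ.≤ (ι 3 ℚ.+ s) ℚ.* ½
3/2[3-s]/2≤[3+s]/2 s h = begin
  (1ℚ ℚ.+ ½) ℚ.* ((ι 3 ℚ.- s) ℚ.* ½)
    ≡⟨ solve 1 (λ s → (con 1ℚ :+ con ½) :* ((con (ι 3) :- s) :* con ½) :=
                      (con (ι 3) :+ s) :* con ½ :+ (con (+ 3 ℚ./ 4) :- con (+ 5 ℚ./ 4) :* s)) refl s ⟩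
  (ι 3 ℚ.+ s) ℚ.* ½ ℚ.+ (+ 3 ℚ./ 4 ℚ.- + 5 ℚ./ 4 ℚ.* s)
    ≤⟨ ℚₚ.+-monoʳ-≤ ((ι 3 ℚ.+ s) ℚ.* ½) (ℚₚ.≤-trans
         (ℚₚ.+-monoʳ-≤ (+ 3 ℚ./ 4) (ℚₚ.neg-antimono-≤ (*-monoˡ {r = + 5 ℚ./ 4} (ℚₚ.nonNegative⁻¹ (+ 5 ℚ./ 4)) h)))
         (ℚₚ.nonPositive⁻¹ (+ 3 ℚ./ 4 ℚ.- + 5 ℚ./ 4 ℚ.* ι 2))) ⟩
  (ι 3 ℚ.+ s) ℚ.* ½ ℚ.+ 0ℚ
    ≡⟨ ℚₚ.+-identityʳ _ ⟩
  (ι 3 ℚ.+ s) ℚ.* ½ ∎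
  where
  open ℚₚ.≤-Reasoning
  open ℚ-Solver.+-*-Solver

a>0 : 0ℝ < a
a>0 = + 1 ℚ./ 4 , ℚₚ.positive⁻¹ (+ 1 ℚ./ 4) , 0 , λ k _ → ¼≤[3-s]/2 (√-approx 5 k) (√5≤5/2 k)

b/a : ℝ
b/a = b * inv a a>0

b/a>1 : 1ℝ < b/a
b/a>1 = ½ , 0<½ , 0 , λ k _ →
  let x = (ι 3 ℚ.- √-approx 5 k) ℚ.* ½
      y = (ι 3 ℚ.+ √-approx 5 k) ℚ.* ½
      0<x : 0ℚ ℚ.< x
      0<x = ℚₚ.<-≤-trans (ℚₚ.positive⁻¹ (+ 1 ℚ./ 4)) (¼≤[3-s]/2 (√-approx 5 k) (√5≤5/2 k))
  in begin
  1ℚ ℚ.+ ½                          ≡⟨ ℚₚ.*-identityʳ (1ℚ ℚ.+ ½) ⟨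
  (1ℚ ℚ.+ ½) ℚ.* 1ℚ                 ≡⟨ cong ((1ℚ ℚ.+ ½) ℚ.*_) (recip-inverse 0<x) ⟨
  (1ℚ ℚ.+ ½) ℚ.* (x ℚ.* recip x)    ≡⟨ ℚₚ.*-assoc (1ℚ ℚ.+ ½) x (recip x) ⟨
  (1ℚ ℚ.+ ½) ℚ.* x ℚ.* recip x      ≤⟨ *-monoʳ (recip-nonNeg 0<x) (3/2[3-s]/2≤[3+s]/2 (√-approx 5 k) (2≤√5 k)) ⟩
  y ℚ.* recip x                     ∎
  where open ℚₚ.≤-Reasoning

infixl 7 _/√5
_/√5 : ℝ → ℝ
x /√5 = x * inv (√ 5) √5>0

x* : ℝ
x* = ln b/a b/a>1 /√5

competitiveRatio : ℝ
competitiveRatio = (exp (- (a * x*)) - exp (- (b * x*))) /√5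

Utilities : ℕ → ℕ → Set
Utilities n m = Fin n → Subset m → ℝ

NonNegative : ∀ {m} → (Subset m → ℝ) → Set
NonNegative f = ∀ A → 0ℝ ≤ f A

Submodular : ∀ {m} → (Subset m → ℝ) → Set
Submodular f = ∀ A B → f (A ∪ B) + f (A ∩ B) ≤ f A + f B

Allocation : ℕ → ℕ → Set
Allocation n m = Fin n → Subset m

PairwiseDisjoint : ∀ {n m} → Allocation n m → Set
PairwiseDisjoint S = ∀ j k → j ≢ k → Empty (S j ∩ S k)

pairwiseDisjoint? : ∀ {n m} (S : Allocation n m) → Dec (PairwiseDisjoint S)
pairwiseDisjoint? S = all? λ j → all? λ k → ¬? (j ≟ k) →-dec ¬? (nonempty? (S j ∩ S k))

welfare : ∀ {n m} → Utilities n m → Allocation n m → ℝ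
welfare f S = Vector.foldr _+_ 0ℝ (λ j → f j (S j))

vectors : ∀ {A : Set} → List A → ∀ n → List (Vec A n)
vectors xs zero    = [] ∷ []
vectors xs (suc n) = concatMap (λ x → map (x ∷_) (vectors xs n)) xs

allSubsets : ∀ m → List (Subset m)
allSubsets = vectors (inside ∷ outside ∷ [])

disjointAllocations : ∀ n m → List (Allocation n m)
disjointAllocations n m = filter pairwiseDisjoint? (map lookup (vectors (allSubsets m) n))

-- The base value of the fold is attained by the empty allocation, which is
-- itself pairwise disjoint.
optimalWelfare : ∀ {n m} → Utilities n m → ℝ
optimalWelfare {n} {m} f =
  foldr max (welfare f (λ _ → Subset.⊥)) (map (welfare f) (disjointAllocations n m))

-- A deterministic online algorithm maps the items that arrived earlier (most
-- recent first) and the arriving item to a bidder, or to nothing to discard the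
-- item.  Its own earlier decisions are determined by the earlier items.
OnlineAlgorithm : ℕ → ℕ → Set
OnlineAlgorithm n m = List (Fin m) → Fin m → Maybe (Fin n)

assign : ∀ {n m} → Maybe (Fin n) → Fin m → Allocation n m → Allocation n m
assign nothing  i S = S
assign (just j) i S = updateAt S j (_∪ ⁅ i ⁆)

-- The allocation once the listed items (most recent first) have arrived.
allocation : ∀ {n m} → OnlineAlgorithm n m → List (Fin m) → Allocation n m
allocation alg []      = λ _ → Subset.⊥
allocation alg (i ∷ h) = assign (alg h i) i (allocation alg h)

marginal : ∀ {m} → (Subset m → ℝ) → Subset m → Fin m → ℝ
marginal f A i = f (A ∪ ⁅ i ⁆) - f A

-- The maximum marginal is nonnegative iff some marginal is, so the item is
-- discarded only if none is.
GreedyChoice : ∀ {n m} → Utilities n m → Allocation n m → Fin m → Maybe (Fin n) → Set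
GreedyChoice f S i (just j) =
  (∀ k → marginal (f k) (S k) i ≤ marginal (f j) (S j) i) × 0ℝ ≤ marginal (f j) (S j) i
GreedyChoice f S i nothing  = ∀ j → ¬ (0ℝ ≤ marginal (f j) (S j) i)

-- Ties may be broken arbitrarily, but only on the basis of the past.
IsGreedy : ∀ {n m} → Utilities n m → OnlineAlgorithm n m → Set
IsGreedy f alg = ∀ h i → Unique (i ∷ h) → GreedyChoice f (allocation alg h) i (alg h i)

picks : ∀ {A : Set} {n} → Vec A (suc n) → List (A × Vec A n)
picks {n = zero}  (x ∷ [])  = (x , []) ∷ []
picks {n = suc n} (x ∷ xs) = (x , xs) ∷ map (λ (y , ys) → y , x ∷ ys) (picks xs)

permutations : ∀ {A : Set} {n} → Vec A n → List (Vec A n)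
permutations {n = zero}  []  = [] ∷ []
permutations {n = suc n} xs = concatMap (λ (y , ys) → map (y ∷_) (permutations ys)) (picks xs)

-- The expectation of g over a uniformly random order of the m items, an order
-- being listed from the first arrival to the last.
𝔼-order : ∀ {m} → (Vec (Fin m) m → ℝ) → ℝ
𝔼-order {m} g =
  fromℚ ((+ 1 ℚ./ m !) {{m ℕₚ.!≢0}}) * foldr _+_ 0ℝ (map g (permutations (allFin m)))

expectedWelfare : ∀ {n m} → Utilities n m → OnlineAlgorithm n m → ℝ
expectedWelfare f alg = 𝔼-order λ σ → welfare f (allocation alg (reverse (toList σ)))

{-# OPTIONS --safe #-}

-- Let F be the value of the current allocation S, and H the value of S joined with those items of a
-- reference allocation O that have not arrived yet, where items of O that do not pay have been dropped.
-- When r items remain, the next arrival raises F in expectation by at least (H − F)/r, since greedy does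
-- at least as well as assigning the item as O does.  By submodularity H loses at most (H − F)/r through
-- the item that O no longer contributes, and at most H/r through the item that is added.  So (F, H) follows
-- Euler's method with step 1/r for F′ = H − F, H′ = F − 2H, and from F = 0 the exact solution is
-- F(x) = H(0) (e^{-ax} − e^{-bx})/√5.  The value F(x) reached from (F, H) is linear in (F, H), concave in x
-- as long as F ≤ H and x is at most the peak x*, and nonincreasing in x if H ≤ F; hence the long Euler
-- steps 1/r do no worse than the exact flow.  This comparison is carried out with Euler's method of a small
-- rational step δ in place of the exact flow, δ⁻¹ being a multiple of m! so that 1/r is a whole number of
-- steps, and exponentials only enter in the limit δ → 0.  The bound thus holds at the peak of the discrete
-- solution, hence at every time x ≥ 0, and nothing about x* is used except x* ≥ 0.

module Submission where

open import Defs hiding (_+_; _*_; _-_; -_; _≤_; _<_; a; b)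
import Algebra.Solver.IdempotentCommutativeMonoid as ∪-Solver
open import Data.Empty using (⊥-elim)
open import Data.Fin.Base using (Fin; zero; suc)
open import Data.Fin.Properties using (_≟_; any?; suc-injective)
open import Data.Fin.Subset using (_∈_; _∪_; _∩_; ⁅_⁆) renaming (⊥ to ∅)
open import Data.Fin.Subset.Properties using (_∈?_; ⊆-antisym; Empty-unique; ∉⊥; x∈⁅x⁆; x∈⁅y⁆⇒x≡y; x∈p∪q⁺; x∈p∪q⁻; x∈p∩q⁺; x∈p∩q⁻; ∪-identityˡ; ∪-identityʳ; ∪-distribˡ-∩; ∪-idempotentCommutativeMonoid)
open import Data.Integer.Base using (+_)
open import Data.List.Base as List using (List; []; _∷_; map; foldr; concatMap; _++_; _ʳ++_; length; reverse)
open import Data.List.Membership.Propositional using () renaming (_∈_ to _∈ₗ_)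
import Data.List.Properties as Listₚ
open import Data.List.Relation.Binary.Permutation.Propositional using (_↭_; refl; prep; swap; trans; ↭⇒↭ₛ)
open import Data.List.Relation.Binary.Permutation.Propositional.Properties using (All-resp-↭)
import Data.List.Relation.Binary.Permutation.Setoid.Properties as ↭ₛ
open import Data.List.Relation.Unary.All as All using (All; []; _∷_)
import Data.List.Relation.Unary.All.Properties as Allₚ
open import Data.List.Relation.Unary.AllPairs using ([]; _∷_)
open import Data.List.Relation.Unary.Any using (here; there)
open import Data.List.Relation.Unary.Unique.Propositional using (Unique)
import Data.List.Relation.Unary.Unique.Propositional.Properties as Uniqueₚ
open import Data.Maybe.Base using (Maybe; just; nothing)
import Data.Maybe.Properties as Maybeₚ
open import Data.Nat.Base as ℕ using (ℕ; zero; suc; z≤n; s≤s)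
open import Data.Nat.Divisibility using (divides; ∣-trans; m∣m*n; m≤n⇒m!∣n!)
import Data.Nat.Properties as ℕₚ
open import Data.Product.Base using (∃-syntax; _×_; _,_; proj₁; proj₂; map₂)
open import Data.Rational.Base as ℚ using (ℚ; 0ℚ; 1ℚ; ½)
import Data.Rational.Properties as ℚₚ
import Data.Rational.Solver as ℚ-Solver
import Data.Rational.Unnormalised.Base as ℚᵘ
import Data.Rational.Unnormalised.Properties as ℚᵘₚ
open import Data.Sum.Base using (_⊎_; inj₁; inj₂; [_,_]′)
open import Data.Vec.Base as Vec using (Vec; []; _∷_; lookup; toList)
open import Data.Vec.Functional as Vector using ()
open import Data.Vec.Functional.Properties using (updateAt-updates; updateAt-minimal)
open import Data.Vec.Membership.Propositional.Properties using (∈-allFin⁺; ∈-toList⁺)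
open import Function.Base using (id; _∘_)
open import Relation.Binary.PropositionalEquality as ≡ using (_≡_; _≢_; _≗_; refl; sym; cong; cong₂; subst)
import Relation.Binary.Reasoning.Base.Single
open import Relation.Nullary using (¬_; yes; no; contradiction)

-- The constants come from the matrix of the system: its eigenvalues are -a and -b, where a and b
-- are the roots of c² - 3c + 1. Rational steps keep `φ` and `ψ` rational, so an inequality between
-- reals can be obtained from a polynomial identity that holds at each index of the approximating
-- sequences and whose remainder is a sum of products of nonnegative factors. The estimates for the
-- expected next F and next H may be combined because they enter through the form φ F + ψ H, whose
-- coefficients are nonnegative. Monotonicity in H also makes dropping an item free: H rises without
-- an item that does not pay. The losses from removing and from adding an item are bounded
-- separately and added by submodularity; when greedy makes the very assignment that O intends, the
-- two overlap, and the sum is justified by the fact that this assignment does not lower H.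
-- Concavity, and the monotonicity for H ≤ F, both rest on φ ≥ 2ψ, which says that ψ is still
-- rising; hence the flow is followed only up to its peak.

0≤- : ∀ {p q} → p ℚ.≤ q → 0ℚ ℚ.≤ q ℚ.- p
0≤- {p} p≤q = ℚₚ.≤-trans (ℚₚ.≤-reflexive (sym (ℚₚ.+-inverseʳ p))) (ℚₚ.+-monoˡ-≤ (ℚ.- p) p≤q)

≤-by : ∀ {p q} w → 0ℚ ℚ.≤ w → q ≡ p ℚ.+ w → p ℚ.≤ q
≤-by {p} w 0≤w eq = ℚₚ.≤-trans (p≤p+ p 0≤w) (ℚₚ.≤-reflexive (sym eq))

-- The discrete flow and its peak

module Euler (δ : ℚ) where

  -- (φ n, ψ n) = (1, 0)(I + δA)ⁿ with A = [[-1, 1], [1, -2]]: Euler's method with step δ for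
  -- the system F′ = H − F, H′ = F − 2H, read as a linear form in the initial values of F and H.
  φ ψ : ℕ → ℚ
  φ zero    = 1ℚ
  φ (suc n) = φ n ℚ.+ δ ℚ.* (ψ n ℚ.- φ n)
  ψ zero    = 0ℚ
  ψ (suc n) = ψ n ℚ.+ δ ℚ.* (φ n ℚ.- (ψ n ℚ.+ ψ n))

  -- The slope of `ψ`, as `ψ (suc n)` is `ψ n` plus `δ` times `D n`. The same sign condition makes
  -- the flow concave (`Δ-falls`), so `Rising` serves both purposes.
  D : ℕ → ℚ
  D n = φ n ℚ.- (ψ n ℚ.+ ψ n)

  Rising : ℕ → Set
  Rising n = ∀ j → j ℕ.< n → 0ℚ ℚ.≤ D j

  rising-≤ : ∀ {k n} → k ℕ.≤ n → Rising n → Rising k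
  rising-≤ k≤n up j j<k = up j (ℕₚ.<-≤-trans j<k k≤n)

  module Bounds (0≤δ : 0ℚ ℚ.≤ δ) (3δ≤1 : ι 3 ℚ.* δ ℚ.≤ 1ℚ) where
    open ℚ-Solver.+-*-Solver

    0≤φ : ∀ n → 0ℚ ℚ.≤ φ n
    0≤ψ : ∀ n → 0ℚ ℚ.≤ ψ n

    0≤φ zero    = ℚₚ.<⇒≤ 0<1
    0≤φ (suc n) = ≤-by ((1ℚ ℚ.- ι 3 ℚ.* δ) ℚ.* φ n ℚ.+ δ ℚ.* (ψ n ℚ.+ φ n ℚ.+ φ n))
      (0≤+ (0≤* (0≤- 3δ≤1) (0≤φ n)) (0≤* 0≤δ (0≤+ (0≤+ (0≤ψ n) (0≤φ n)) (0≤φ n))))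
      (solve 3 (λ d f p → f :+ d :* (p :- f) :=
        con 0ℚ :+ ((con 1ℚ :- con (ι 3) :* d) :* f :+ d :* (p :+ f :+ f))) refl δ (φ n) (ψ n))
    0≤ψ zero    = ℚₚ.≤-refl
    0≤ψ (suc n) = ≤-by ((1ℚ ℚ.- ι 3 ℚ.* δ) ℚ.* ψ n ℚ.+ δ ℚ.* (ψ n ℚ.+ φ n))
      (0≤+ (0≤* (0≤- 3δ≤1) (0≤ψ n)) (0≤* 0≤δ (0≤+ (0≤ψ n) (0≤φ n))))
      (solve 3 (λ d f p → p :+ d :* (f :- (p :+ p)) :=
        con 0ℚ :+ ((con 1ℚ :- con (ι 3) :* d) :* p :+ d :* (p :+ f))) refl δ (φ n) (ψ n))

    -- D (n+1) = (1 - 3δ) D n - δ ψ n: a slope that is not positive stays so, and `ψ` has a single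
    -- peak. The factor 3 in `3δ≤1` is the one of this recurrence.
    D-step : ∀ n → D n ℚ.≤ 0ℚ → D (suc n) ℚ.≤ 0ℚ
    D-step n D≤0 = ≤-by ((1ℚ ℚ.- ι 3 ℚ.* δ) ℚ.* (0ℚ ℚ.- D n) ℚ.+ δ ℚ.* ψ n)
      (0≤+ (0≤* (0≤- 3δ≤1) (0≤- D≤0)) (0≤* 0≤δ (0≤ψ n)))
      (solve 3 (λ d f p → con 0ℚ :=
        f :+ d :* (p :- f) :- (p :+ d :* (f :- (p :+ p)) :+ (p :+ d :* (f :- (p :+ p)))) :+
        ((con 1ℚ :- con (ι 3) :* d) :* (con 0ℚ :- (f :- (p :+ p))) :+ d :* p)) refl δ (φ n) (ψ n))

    ψ-falls : ∀ n → D n ℚ.≤ 0ℚ → ψ (suc n) ℚ.≤ ψ n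
    ψ-falls n D≤0 = ≤-by (δ ℚ.* (0ℚ ℚ.- D n)) (0≤* 0≤δ (0≤- D≤0))
      (solve 3 (λ d p D → p := p :+ d :* D :+ d :* (con 0ℚ :- D)) refl δ (ψ n) (D n))

    -- The induction has to know on which side of the peak it is: the last component says that `ψ`
    -- either has risen all the way or has already turned, after which `D-step` keeps it falling.
    ψ-peak : ∀ n → ∃[ k ] Rising k × ψ n ℚ.≤ ψ k × (k ≡ n ⊎ D n ℚ.≤ 0ℚ)
    ψ-peak zero = 0 , (λ _ ()) , ℚₚ.≤-refl , inj₁ refl
    ψ-peak (suc n) with ψ-peak n
    ... | k , up , ψn≤ψk , inj₂ D≤0 = k , up , ℚₚ.≤-trans (ψ-falls n D≤0) ψn≤ψk , inj₂ (D-step n D≤0)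
    ... | k , up , ψn≤ψk , inj₁ refl with ℚₚ.≤-total 0ℚ (D n)
    ...   | inj₁ 0≤D = suc n , rising , ℚₚ.≤-refl , inj₁ refl
      where
      rising : Rising (suc n)
      rising j j<1+n with ℕₚ.m≤n⇒m<n∨m≡n (ℕₚ.≤-pred j<1+n)
      ... | inj₁ j<n  = up j j<n
      ... | inj₂ refl = 0≤D
    ...   | inj₂ D≤0 = n , up , ψ-falls n D≤0 , inj₂ (D-step n D≤0)

-- Euler's method and the exponential series

module _ where
  open import Data.Rational.Base using (_+_; _*_; _-_; -_; ∣_∣; _/_; _≤_; _<_)
  open ℚₚ.≤-Reasoning
  open ℚ-Solver.+-*-Solver

  pow : ℚ → ℕ → ℚ
  pow q zero    = 1ℚ
  pow q (suc k) = q * pow q k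

  expTerm-* : ∀ q k → expTerm q k * q ≡ ι (suc k) * expTerm q (suc k)
  expTerm-* q k = begin-equality
    expTerm q k * q                                 ≡⟨ ℚₚ.*-identityˡ _ ⟨
    1ℚ * (expTerm q k * q)                          ≡⟨ cong (_* (expTerm q k * q)) (ι-suc*/ k) ⟨
    ι (suc k) * (+ 1 / suc k) * (expTerm q k * q)   ≡⟨ solve 4 (λ n r t q → n :* r :* (t :* q) := n :* (t :* (q :* r))) refl (ι (suc k)) (+ 1 / suc k) (expTerm q k) q ⟩
    ι (suc k) * (expTerm q k * (q * (+ 1 / suc k))) ∎

  -- The part of degree k + 1 of the first-order Taylor remainder of exp at y, the derivative of the
  -- term of degree k + 1 being the term of degree k.
  remainder : ℚ → ℚ → ℕ → ℚ
  remainder y u k = expTerm (y + u) (suc k) - expTerm y (suc k) - u * expTerm y k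

  remainder-zero : ∀ y u → remainder y u 0 ≡ 0ℚ
  remainder-zero y u = solve 2 (λ y u →
    con 1ℚ :* ((y :+ u) :* con (+ 1 / 1)) :- con 1ℚ :* (y :* con (+ 1 / 1)) :- u :* con 1ℚ := con 0ℚ) refl y u

  -- Multiplication by y + u turns one remainder into the next up to u² times a term, because
  -- `expTerm y k * y` is k + 1 times the following term. The factor u² is thus carried along
  -- without a binomial expansion.
  remainder-suc : ∀ y u k → remainder y u (suc k) ≡ (u * u * expTerm y k + remainder y u k * (y + u)) * (+ 1 / suc (suc k))
  remainder-suc y u k = begin-equality
    P * ((y + u) * r) - T₁ * (y * r) - u * T₁
      ≡⟨ solve 6 (λ y u P T T₁ r → P :* ((y :+ u) :* r) :- T₁ :* (y :* r) :- u :* T₁ :=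
           (u :* u :* T :+ (P :- T₁ :- u :* T) :* (y :+ u)) :* r :+ u :* ((T₁ :+ T :* y) :* r :- T₁)) refl y u P T T₁ r ⟩
    (u * u * T + (P - T₁ - u * T) * (y + u)) * r + u * ((T₁ + T * y) * r - T₁)
      ≡⟨ cong (λ z → (u * u * T + (P - T₁ - u * T) * (y + u)) * r + u * (z - T₁)) cancel ⟩
    (u * u * T + (P - T₁ - u * T) * (y + u)) * r + u * (T₁ - T₁)
      ≡⟨ solve 3 (λ z u T → z :+ u :* (T :- T) := z) refl ((u * u * T + (P - T₁ - u * T) * (y + u)) * r) u T₁ ⟩
    (u * u * T + (P - T₁ - u * T) * (y + u)) * r ∎
    where
    r = + 1 / suc (suc k)
    P = expTerm (y + u) (suc k)
    T = expTerm y k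
    T₁ = expTerm y (suc k)
    cancel : (T₁ + T * y) * r ≡ T₁
    cancel = begin-equality
      (T₁ + T * y) * r                 ≡⟨ cong (λ z → (T₁ + z) * r) (expTerm-* y k) ⟩
      (T₁ + ι (suc k) * T₁) * r        ≡⟨ solve 3 (λ T n r → (T :+ n :* T) :* r := T :* ((con 1ℚ :+ n) :* r)) refl T₁ (ι (suc k)) r ⟩
      T₁ * ((1ℚ + ι (suc k)) * r)      ≡⟨ cong (λ n → T₁ * (n * r)) (ι-suc (suc k)) ⟨
      T₁ * (ι (suc (suc k)) * r)       ≡⟨ cong (T₁ *_) (ι-suc*/ (suc k)) ⟩
      T₁ * 1ℚ                          ≡⟨ ℚₚ.*-identityʳ T₁ ⟩
      T₁                               ∎

  module _ (B : ℚ) (0<B : 0ℚ < B) where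

    0≤B = ℚₚ.<⇒≤ 0<B

    open ExpOn (B + B) (ℚₚ.+-mono-< 0<B 0<B)

    B≤B+B : B ≤ B + B
    B≤B+B = p≤p+ B 0≤B

    -- `C` is 2B + 1. Doubling `B` pays for the larger denominator, since k + 2 ≤ 2 (k + 1), and the
    -- summand 1 settles the base case.
    expTerm-shift : ∀ k → expTerm B k ≤ expTerm C (suc k)
    expTerm-shift zero = ≤-by (B + B) (0≤+ 0≤B 0≤B)
      (solve 1 (λ B → con 1ℚ :* ((B :+ B :+ con 1ℚ) :* con (+ 1 / 1)) := con 1ℚ :+ (B :+ B)) refl B)
    expTerm-shift (suc k) = *-mono (expTerm-nonNeg 0≤B k) (0≤* 0≤C (0≤/ (suc k))) (expTerm-shift k) (begin
      B * (+ 1 / suc k)               ≤⟨ *-monoˡ 0≤B (/-mono 1 (suc k) 2 (suc (suc k)) 2+k≤2+2k) ⟩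
      B * (+ 2 / suc (suc k))         ≡⟨ cong (B *_) (/-split 2 (suc k)) ⟩
      B * (ι 2 * r)                   ≤⟨ ≤-by r (0≤/ (suc k)) (solve 2 (λ B r → (B :+ B :+ con 1ℚ) :* r := B :* (con (ι 2) :* r) :+ r) refl B r) ⟩
      C * r                           ∎)
      where
      r = + 1 / suc (suc k)
      2+k≤2+2k : 1 ℕ.* suc (suc k) ℕ.≤ 2 ℕ.* suc k
      2+k≤2+2k = ℕₚ.≤-trans (ℕₚ.≤-reflexive (ℕₚ.*-identityˡ (suc (suc k))))
        (ℕₚ.≤-trans (s≤s (ℕₚ.m≤n+m (suc k) k)) (ℕₚ.≤-reflexive (cong (λ n → suc k ℕ.+ n) (sym (ℕₚ.+-identityʳ (suc k))))))

    module _ (y u : ℚ) (hy : ∣ y ∣ ≤ B) (hyu : ∣ y + u ∣ ≤ B) where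

      0≤u² : 0ℚ ≤ ∣ u ∣ * ∣ u ∣
      0≤u² = 0≤* (ℚₚ.0≤∣p∣ u) (ℚₚ.0≤∣p∣ u)

      remainder-bound : ∀ k → ∣ remainder y u k ∣ ≤ ∣ u ∣ * ∣ u ∣ * expTerm C (suc k)
      remainder-bound zero = ℚₚ.≤-trans (ℚₚ.≤-reflexive (cong ∣_∣ (remainder-zero y u)))
        (0≤* 0≤u² (expTerm-nonNeg 0≤C 1))
      remainder-bound (suc k) = begin
        ∣ remainder y u (suc k) ∣
          ≡⟨ cong ∣_∣ (remainder-suc y u k) ⟩
        ∣ (u * u * T + R * (y + u)) * r ∣
          ≡⟨ ∣*/∣ (u * u * T + R * (y + u)) (suc k) ⟩
        ∣ u * u * T + R * (y + u) ∣ * r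
          ≤⟨ *-monoʳ (0≤/ (suc k)) (ℚₚ.∣p+q∣≤∣p∣+∣q∣ (u * u * T) (R * (y + u))) ⟩
        (∣ u * u * T ∣ + ∣ R * (y + u) ∣) * r
          ≡⟨ cong (_* r) (cong₂ _+_ (≡.trans (ℚₚ.∣p*q∣≡∣p∣*∣q∣ (u * u) T) (cong (_* ∣ T ∣) (ℚₚ.∣p*q∣≡∣p∣*∣q∣ u u))) (ℚₚ.∣p*q∣≡∣p∣*∣q∣ R (y + u))) ⟩
        (v * ∣ T ∣ + ∣ R ∣ * ∣ y + u ∣) * r
          ≤⟨ *-monoʳ (0≤/ (suc k)) (ℚₚ.+-mono-≤ (*-monoˡ 0≤u² (ℚₚ.≤-trans (expTerm-bound hy k) (expTerm-shift k)))
               (*-mono (ℚₚ.0≤∣p∣ R) 0≤B (remainder-bound k) hyu)) ⟩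
        (v * w + v * w * B) * r
          ≤⟨ ≤-by (v * w * B * r) (0≤* (0≤* (0≤* 0≤u² 0≤w) 0≤B) (0≤/ (suc k)))
               (solve 4 (λ v w B r → v :* (w :* ((B :+ B :+ con 1ℚ) :* r)) := (v :* w :+ v :* w :* B) :* r :+ v :* w :* B :* r) refl v w B r) ⟩
        v * (w * (C * r)) ∎
        where
        r = + 1 / suc (suc k)
        T = expTerm y k
        R = remainder y u k
        w = expTerm C (suc k)
        v = ∣ u ∣ * ∣ u ∣
        0≤w = expTerm-nonNeg 0≤C (suc k)

      expSum-taylor : ∀ k → ∣ expSum (y + u) (suc k) - expSum y (suc k) - u * expSum y k ∣ ≤ ∣ u ∣ * ∣ u ∣ * expSum C (suc k)
      expSum-taylor zero = begin
        ∣ (1ℚ + P) - (1ℚ + T₁) - u * 1ℚ ∣   ≡⟨ cong ∣_∣ (solve 3 (λ P T u → (con 1ℚ :+ P) :- (con 1ℚ :+ T) :- u :* con 1ℚ := P :- T :- u :* con 1ℚ) refl P T₁ u) ⟩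
        ∣ remainder y u 0 ∣                 ≤⟨ remainder-bound 0 ⟩
        v * expTerm C 1                     ≤⟨ ≤-by v 0≤u² (solve 2 (λ v t → v :* (con 1ℚ :+ t) := v :* t :+ v) refl v (expTerm C 1)) ⟩
        v * (1ℚ + expTerm C 1)              ∎
        where
        v = ∣ u ∣ * ∣ u ∣
        P = expTerm (y + u) 1
        T₁ = expTerm y 1
      expSum-taylor (suc k) = begin
        ∣ (S + P) - (S₁ + T₁) - u * (S₀ + T) ∣
          ≡⟨ cong ∣_∣ (solve 7 (λ S P S₁ T₁ S₀ T u → (S :+ P) :- (S₁ :+ T₁) :- u :* (S₀ :+ T) := (S :- S₁ :- u :* S₀) :+ (P :- T₁ :- u :* T)) refl S P S₁ T₁ S₀ T u) ⟩
        ∣ (S - S₁ - u * S₀) + remainder y u (suc k) ∣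
          ≤⟨ ℚₚ.≤-trans (ℚₚ.∣p+q∣≤∣p∣+∣q∣ (S - S₁ - u * S₀) (remainder y u (suc k))) (ℚₚ.+-mono-≤ (expSum-taylor k) (remainder-bound (suc k))) ⟩
        v * expSum C (suc k) + v * expTerm C (suc (suc k))
          ≡⟨ ℚₚ.*-distribˡ-+ v _ _ ⟨
        v * (expSum C (suc k) + expTerm C (suc (suc k))) ∎
        where
        v = ∣ u ∣ * ∣ u ∣
        S = expSum (y + u) (suc k)
        P = expTerm (y + u) (suc (suc k))
        S₁ = expSum y (suc k)
        T₁ = expTerm y (suc (suc k))
        S₀ = expSum y k
        T = expTerm y (suc k)

      -- One Euler step for the equation y′ = y. Besides the Taylor remainder there is a truncation
      -- error: the derivative of the partial sum lacks its top term, which costs |u| τ.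
      expSum-euler : ∀ k {τ} → K ℕ.≤ suc k → ∣ expTerm y (suc k) ∣ ≤ τ →
        ∣ expSum (y + u) (suc k) - (1ℚ + u) * expSum y (suc k) ∣ ≤ ∣ u ∣ * ∣ u ∣ * D + ∣ u ∣ * τ
      expSum-euler k {τ} K≤ small = begin
        ∣ S - (1ℚ + u) * (S₀ + T) ∣
          ≡⟨ cong ∣_∣ (solve 4 (λ S S₀ T u → S :- (con 1ℚ :+ u) :* (S₀ :+ T) := (S :- (S₀ :+ T) :- u :* S₀) :+ (:- u) :* T) refl S S₀ T u) ⟩
        ∣ (S - (S₀ + T) - u * S₀) + (- u) * T ∣
          ≤⟨ ℚₚ.∣p+q∣≤∣p∣+∣q∣ (S - (S₀ + T) - u * S₀) ((- u) * T) ⟩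
        ∣ S - (S₀ + T) - u * S₀ ∣ + ∣ (- u) * T ∣
          ≤⟨ ℚₚ.+-mono-≤ (ℚₚ.≤-trans (expSum-taylor k) (*-monoˡ 0≤u² (ExpTail.sum-bound 0≤C K (proj₂ (archimedean (C + C))) (suc k) K≤)))
               (ℚₚ.≤-trans (ℚₚ.≤-reflexive (≡.trans (ℚₚ.∣p*q∣≡∣p∣*∣q∣ (- u) T) (cong (_* ∣ T ∣) (ℚₚ.∣-p∣≡∣p∣ u))))
                           (*-monoˡ (ℚₚ.0≤∣p∣ u) small)) ⟩
        ∣ u ∣ * ∣ u ∣ * D + ∣ u ∣ * τ ∎
        where
        S = expSum (y + u) (suc k)
        S₀ = expSum y k
        T = expTerm y (suc k)

    module _ (u : ℚ) (k : ℕ) (τ : ℚ) (K≤ : K ℕ.≤ suc k) (small : ∀ q → ∣ q ∣ ≤ B → ∣ expTerm q (suc k) ∣ ≤ τ)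
             (0≤1+u : 0ℚ ≤ 1ℚ + u) (1+u≤1 : 1ℚ + u ≤ 1ℚ) where

      euler-error : ℚ
      euler-error = ∣ u ∣ * ∣ u ∣ * D + ∣ u ∣ * τ

      -- The factor 1 + u lies in [0, 1], so earlier errors are not amplified and the errors of the
      -- single steps merely add up.
      expSum-pow : ∀ t → (∀ j → j ℕ.≤ t → ∣ ι j * u ∣ ≤ B) → ∣ expSum (ι t * u) (suc k) - pow (1ℚ + u) t ∣ ≤ ι t * euler-error
      expSum-pow zero _ = ℚₚ.≤-reflexive (≡.trans
        (cong (λ q → ∣ expSum q (suc k) - 1ℚ ∣) (ℚₚ.*-zeroˡ u))
        (≡.trans (cong (λ e → ∣ e - 1ℚ ∣) (expSum-zero (suc k))) (sym (ℚₚ.*-zeroˡ euler-error))))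
      expSum-pow (suc t) within = begin
        ∣ expSum (ι (suc t) * u) (suc k) - p * pow p t ∣
          ≡⟨ cong (λ q → ∣ expSum q (suc k) - p * pow p t ∣) next ⟩
        ∣ E′ - p * pow p t ∣
          ≤⟨ ∣-∣-via E′ (p * E) (p * pow p t) ⟩
        ∣ E′ - p * E ∣ + ∣ p * E - p * pow p t ∣
          ≤⟨ ℚₚ.+-mono-≤ (expSum-euler (ι t * u) u (within t (ℕₚ.n≤1+n t)) (subst (λ q → ∣ q ∣ ≤ B) next (within (suc t) ℕₚ.≤-refl)) k K≤
                            (small (ι t * u) (within t (ℕₚ.n≤1+n t))))
               (begin
                 ∣ p * E - p * pow p t ∣     ≡⟨ cong ∣_∣ (solve 3 (λ p E q → p :* E :- p :* q := p :* (E :- q)) refl p E (pow p t)) ⟩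
                 ∣ p * (E - pow p t) ∣       ≡⟨ ℚₚ.∣p*q∣≡∣p∣*∣q∣ p (E - pow p t) ⟩
                 ∣ p ∣ * ∣ E - pow p t ∣     ≤⟨ *-mono (ℚₚ.0≤∣p∣ p) 0≤tη (ℚₚ.≤-trans (ℚₚ.≤-reflexive (ℚₚ.0≤p⇒∣p∣≡p 0≤1+u)) 1+u≤1) ih ⟩
                 1ℚ * (ι t * η)              ≡⟨ ℚₚ.*-identityˡ _ ⟩
                 ι t * η                     ∎) ⟩
        η + ι t * η
          ≡⟨ solve 2 (λ n e → e :+ n :* e := (con 1ℚ :+ n) :* e) refl (ι t) η ⟩
        (1ℚ + ι t) * η
          ≡⟨ cong (_* η) (ι-suc t) ⟨
        ι (suc t) * η ∎
        where
        p = 1ℚ + u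
        η = euler-error
        E = expSum (ι t * u) (suc k)
        E′ = expSum (ι t * u + u) (suc k)
        next : ι (suc t) * u ≡ ι t * u + u
        next = ≡.trans (cong (_* u) (ι-suc t)) (solve 2 (λ n u → (con 1ℚ :+ n) :* u := n :* u :+ u) refl (ι t) u)
        ih : ∣ E - pow p t ∣ ≤ ι t * η
        ih = expSum-pow t λ j j≤t → within j (ℕₚ.≤-trans j≤t (ℕₚ.n≤1+n t))
        0≤tη = ℚₚ.≤-trans (ℚₚ.0≤∣p∣ (E - pow p t)) ih

    term-vanishes : ∀ δ → 0ℚ < δ → ∃[ N ] ∀ k → N ℕ.≤ k → ∀ q → ∣ q ∣ ≤ B → ∣ expTerm q (suc k) ∣ ≤ δ
    term-vanishes δ 0<δ =
      let N , _ , tail = uniform (δ * ½) (0<* 0<δ 0<½)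
      in N , λ k N≤k q hq → let S = expSum q k
                                T = expTerm q (suc k)
                                L = expSum q N
                                hq′ = ℚₚ.≤-trans hq B≤B+B
                            in begin
        ∣ T ∣                            ≡⟨ cong ∣_∣ (solve 2 (λ S T → T := (S :+ T) :- S) refl S T) ⟩
        ∣ (S + T) - S ∣                  ≤⟨ ∣-∣-via (S + T) L S ⟩
        ∣ (S + T) - L ∣ + ∣ L - S ∣      ≤⟨ ℚₚ.+-mono-≤ (tail q hq′ (suc k) (ℕₚ.≤-trans N≤k (ℕₚ.n≤1+n k)))
                                              (ℚₚ.≤-trans (ℚₚ.≤-reflexive (∣-∣-comm L S)) (tail q hq′ k N≤k)) ⟩
        δ * ½ + δ * ½                    ≡⟨ solve 1 (λ d → d :* con ½ :+ d :* con ½ := d) refl δ ⟩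
        δ                                ∎

    module _ (X : ℚ) (0≤X : 0ℚ ≤ X) (3X≤B : ι 3 * X ≤ B) where

      -- Here |u| ≤ 3δ. Moving x to the grid point t δ, at distance at most 2δ, gives 6D; each of
      -- the t Euler steps contributes δ² (9D + 3), and t δ ≤ X.
      exp-error : ℚ
      exp-error = ι 6 * D + X * (ι 9 * D + ι 3)

      exp-pow : ∀ δ a x t k → 0ℚ ≤ δ → ι 3 * δ ≤ 1ℚ → 0ℚ ≤ a → a ≤ ι 3 → ∣ x ∣ ≤ X → ι t * δ ≤ X →
        ∣ x - ι t * δ ∣ ≤ δ + δ → K ℕ.≤ suc k → (∀ q → ∣ q ∣ ≤ B → ∣ expTerm q (suc k) ∣ ≤ δ) →
        ∣ expSum (- (a * x)) (suc k) - pow (1ℚ + - (a * δ)) t ∣ ≤ δ * exp-error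
      exp-pow δ a x t k 0≤δ 3δ≤1 0≤a a≤3 x≤X tδ≤X near K≤ small = begin
        ∣ expSum (- (a * x)) (suc k) - pow (1ℚ + u) t ∣
          ≤⟨ ∣-∣-via (expSum (- (a * x)) (suc k)) (expSum (ι t * u) (suc k)) (pow (1ℚ + u) t) ⟩
        ∣ expSum (- (a * x)) (suc k) - expSum (ι t * u) (suc k) ∣ + ∣ expSum (ι t * u) (suc k) - pow (1ℚ + u) t ∣
          ≤⟨ ℚₚ.+-mono-≤
               (ℚₚ.≤-trans (lipschitz (- (a * x)) (ι t * u) (suc k) (ℚₚ.≤-trans ax≤B B≤B+B) (ℚₚ.≤-trans (within t ℕₚ.≤-refl) B≤B+B) K≤)
                           (*-monoʳ (ℚₚ.<⇒≤ 0<D) moved))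
               (ℚₚ.≤-trans (expSum-pow u k δ K≤ small 0≤1+u 1+u≤1 t within) (*-monoˡ (ι-mono {0} {t} z≤n)
                 (ℚₚ.+-mono-≤ (*-monoʳ (ℚₚ.<⇒≤ 0<D) (*-mono (ℚₚ.0≤∣p∣ u) 0≤3δ u≤3δ u≤3δ)) (*-monoʳ 0≤δ u≤3δ)))) ⟩
        ι 3 * (δ + δ) * D + ι t * (ι 3 * δ * (ι 3 * δ) * D + ι 3 * δ * δ)
          ≡⟨ solve 3 (λ t d D → con (ι 3) :* (d :+ d) :* D :+ t :* (con (ι 3) :* d :* (con (ι 3) :* d) :* D :+ con (ι 3) :* d :* d) :=
               d :* (con (ι 6) :* D :+ t :* d :* (con (ι 9) :* D :+ con (ι 3)))) refl (ι t) δ D ⟩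
        δ * (ι 6 * D + ι t * δ * (ι 9 * D + ι 3))
          ≤⟨ *-monoˡ 0≤δ (ℚₚ.+-monoʳ-≤ (ι 6 * D) (*-monoʳ 0≤9D+3 tδ≤X)) ⟩
        δ * (ι 6 * D + X * (ι 9 * D + ι 3)) ∎
        where
        u = - (a * δ)
        0≤3 : 0ℚ ≤ ι 3
        0≤3 = ι-mono {0} {3} z≤n
        0≤3δ = 0≤* 0≤3 0≤δ
        0≤9D+3 : 0ℚ ≤ ι 9 * D + ι 3
        0≤9D+3 = 0≤+ (0≤* (ι-mono {0} {9} z≤n) (ℚₚ.<⇒≤ 0<D)) 0≤3
        ∣a∣≤3 : ∣ a ∣ ≤ ι 3
        ∣a∣≤3 = ℚₚ.≤-trans (ℚₚ.≤-reflexive (ℚₚ.0≤p⇒∣p∣≡p 0≤a)) a≤3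
        aδ≤3δ : a * δ ≤ ι 3 * δ
        aδ≤3δ = *-monoʳ 0≤δ a≤3
        u≤3δ : ∣ u ∣ ≤ ι 3 * δ
        u≤3δ = ℚₚ.≤-trans (ℚₚ.≤-reflexive (≡.trans (ℚₚ.∣-p∣≡∣p∣ (a * δ)) (ℚₚ.0≤p⇒∣p∣≡p (0≤* 0≤a 0≤δ)))) aδ≤3δ
        0≤1+u : 0ℚ ≤ 1ℚ + u
        0≤1+u = 0≤- (ℚₚ.≤-trans aδ≤3δ 3δ≤1)
        1+u≤1 : 1ℚ + u ≤ 1ℚ
        1+u≤1 = ≤-by (a * δ) (0≤* 0≤a 0≤δ) (solve 1 (λ z → con 1ℚ := con 1ℚ :+ (:- z) :+ z) refl (a * δ))
        ax≤B : ∣ - (a * x) ∣ ≤ B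
        ax≤B = begin
          ∣ - (a * x) ∣    ≡⟨ ≡.trans (ℚₚ.∣-p∣≡∣p∣ (a * x)) (ℚₚ.∣p*q∣≡∣p∣*∣q∣ a x) ⟩
          ∣ a ∣ * ∣ x ∣    ≤⟨ *-mono (ℚₚ.0≤∣p∣ a) 0≤X ∣a∣≤3 x≤X ⟩
          ι 3 * X          ≤⟨ 3X≤B ⟩
          B                ∎
        within : ∀ j → j ℕ.≤ t → ∣ ι j * u ∣ ≤ B
        within j j≤t = begin
          ∣ ι j * u ∣        ≡⟨ ℚₚ.∣p*q∣≡∣p∣*∣q∣ (ι j) u ⟩
          ∣ ι j ∣ * ∣ u ∣    ≤⟨ *-mono (ℚₚ.0≤∣p∣ (ι j)) 0≤3δ (ℚₚ.≤-trans (ℚₚ.≤-reflexive (ℚₚ.0≤p⇒∣p∣≡p (ι-mono {0} {j} z≤n))) (ι-mono j≤t)) u≤3δ ⟩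
          ι t * (ι 3 * δ)    ≡⟨ solve 2 (λ t d → t :* (con (ι 3) :* d) := con (ι 3) :* (t :* d)) refl (ι t) δ ⟩
          ι 3 * (ι t * δ)    ≤⟨ *-monoˡ 0≤3 tδ≤X ⟩
          ι 3 * X            ≤⟨ 3X≤B ⟩
          B                  ∎
        moved : ∣ - (a * x) - ι t * u ∣ ≤ ι 3 * (δ + δ)
        moved = begin
          ∣ - (a * x) - ι t * u ∣          ≡⟨ cong ∣_∣ (solve 4 (λ a x t d → (:- (a :* x)) :- t :* (:- (a :* d)) := (:- a) :* (x :- t :* d)) refl a x (ι t) δ) ⟩
          ∣ (- a) * (x - ι t * δ) ∣        ≡⟨ ≡.trans (ℚₚ.∣p*q∣≡∣p∣*∣q∣ (- a) (x - ι t * δ)) (cong (_* ∣ x - ι t * δ ∣) (ℚₚ.∣-p∣≡∣p∣ a)) ⟩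
          ∣ a ∣ * ∣ x - ι t * δ ∣          ≤⟨ *-mono (ℚₚ.0≤∣p∣ a) (0≤+ 0≤δ 0≤δ) ∣a∣≤3 near ⟩
          ι 3 * (δ + δ)                    ∎

  -- The characteristic polynomial of the flow matrix at -c. For a and b formed with an
  -- approximation s of √5 it equals (s² - 5)/4 instead of 0, so `pow-eigen` carries it as an error.
  residual : ℚ → ℚ
  residual c = c * c - ι 3 * c + 1ℚ

  module _ (δ : ℚ) (0≤δ : 0ℚ ≤ δ) (3δ≤1 : ι 3 * δ ≤ 1ℚ) where
    open Euler δ
    open Bounds 0≤δ 3δ≤1

    φ+ψ≤1 : ∀ t → φ t + ψ t ≤ 1ℚ
    φ+ψ≤1 zero    = ℚₚ.≤-refl
    φ+ψ≤1 (suc t) = ℚₚ.≤-trans (≤-by (δ * ψ t) (0≤* 0≤δ (0≤ψ t))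
      (solve 3 (λ d f p → f :+ p := (f :+ d :* (p :- f)) :+ (p :+ d :* (f :- (p :+ p))) :+ d :* p) refl δ (φ t) (ψ t))) (φ+ψ≤1 t)

    ψ≤1 : ∀ t → ψ t ≤ 1ℚ
    ψ≤1 t = ℚₚ.≤-trans (≤-by (φ t) (0≤φ t) (ℚₚ.+-comm (φ t) (ψ t))) (φ+ψ≤1 t)

    -- A = [[-1, 1], [1, -2]] has the eigenvector (1, 1 - c) for the eigenvalue -c when residual c = 0.
    pow-eigen : ∀ c t → 0ℚ ≤ 1ℚ + - (c * δ) → 1ℚ + - (c * δ) ≤ 1ℚ →
      ∣ pow (1ℚ + - (c * δ)) t - (φ t + (1ℚ - c) * ψ t) ∣ ≤ ι t * (δ * ∣ residual c ∣)
    pow-eigen c zero _ _ = ℚₚ.≤-reflexive (≡.trans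
      (cong ∣_∣ (solve 1 (λ c → con 1ℚ :- (con 1ℚ :+ (con 1ℚ :- c) :* con 0ℚ) := con 0ℚ) refl c))
      (sym (ℚₚ.*-zeroˡ (δ * ∣ residual c ∣))))
    pow-eigen c (suc t) 0≤p p≤1 = begin
      ∣ p * P - (φ (suc t) + (1ℚ - c) * ψ (suc t)) ∣
        ≡⟨ cong ∣_∣ (solve 5 (λ c d f s P →
             (con 1ℚ :+ :- (c :* d)) :* P :- (f :+ d :* (s :- f) :+ (con 1ℚ :- c) :* (s :+ d :* (f :- (s :+ s)))) :=
             (con 1ℚ :+ :- (c :* d)) :* (P :- (f :+ (con 1ℚ :- c) :* s)) :+ s :* (d :* (c :* c :- con (ι 3) :* c :+ con 1ℚ)))
             refl c δ (φ t) (ψ t) P) ⟩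
      ∣ p * e + ψ t * (δ * ρ) ∣
        ≤⟨ ℚₚ.∣p+q∣≤∣p∣+∣q∣ (p * e) (ψ t * (δ * ρ)) ⟩
      ∣ p * e ∣ + ∣ ψ t * (δ * ρ) ∣
        ≡⟨ cong₂ _+_ (ℚₚ.∣p*q∣≡∣p∣*∣q∣ p e) (≡.trans (ℚₚ.∣p*q∣≡∣p∣*∣q∣ (ψ t) (δ * ρ)) (cong (∣ ψ t ∣ *_) (ℚₚ.∣p*q∣≡∣p∣*∣q∣ δ ρ))) ⟩
      ∣ p ∣ * ∣ e ∣ + ∣ ψ t ∣ * (∣ δ ∣ * ∣ ρ ∣)
        ≡⟨ cong₂ (λ x y → x * ∣ e ∣ + y * (∣ δ ∣ * ∣ ρ ∣)) (ℚₚ.0≤p⇒∣p∣≡p 0≤p) (ℚₚ.0≤p⇒∣p∣≡p (0≤ψ t)) ⟩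
      p * ∣ e ∣ + ψ t * (∣ δ ∣ * ∣ ρ ∣)
        ≡⟨ cong (λ d → p * ∣ e ∣ + ψ t * (d * ∣ ρ ∣)) (ℚₚ.0≤p⇒∣p∣≡p 0≤δ) ⟩
      p * ∣ e ∣ + ψ t * η
        ≤⟨ ℚₚ.+-mono-≤ (*-mono 0≤p (0≤* (ι-mono {0} {t} z≤n) 0≤η) p≤1 (pow-eigen c t 0≤p p≤1)) (*-monoʳ 0≤η (ψ≤1 t)) ⟩
      1ℚ * (ι t * η) + 1ℚ * η
        ≡⟨ solve 2 (λ n e → con 1ℚ :* (n :* e) :+ con 1ℚ :* e := (con 1ℚ :+ n) :* e) refl (ι t) η ⟩
      (1ℚ + ι t) * η
        ≡⟨ cong (_* η) (ι-suc t) ⟨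
      ι (suc t) * η ∎
      where
      p = 1ℚ + - (c * δ)
      P = pow p t
      e = P - (φ t + (1ℚ - c) * ψ t)
      ρ = residual c
      η = δ * ∣ ρ ∣
      0≤η : 0ℚ ≤ η
      0≤η = 0≤* 0≤δ (ℚₚ.0≤∣p∣ ρ)

  ι-+ : ∀ m n → ι (m ℕ.+ n) ≡ ι m + ι n
  ι-+ zero    n = sym (ℚₚ.+-identityˡ (ι n))
  ι-+ (suc m) n = ≡.trans (ι-suc (m ℕ.+ n)) (≡.trans (cong (λ z → 1ℚ + z) (ι-+ m n))
    (≡.trans (sym (ℚₚ.+-assoc 1ℚ (ι m) (ι n))) (cong (_+ ι n) (sym (ι-suc m)))))

  ι-* : ∀ m n → ι (m ℕ.* n) ≡ ι m * ι n
  ι-* zero    n = sym (ℚₚ.*-zeroˡ (ι n))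
  ι-* (suc m) n = ≡.trans (ι-+ n (m ℕ.* n)) (≡.trans (cong (λ z → ι n + z) (ι-* m n))
    (≡.trans (solve 2 (λ m n → n :+ m :* n := (con 1ℚ :+ m) :* n) refl (ι m) (ι n)) (cong (_* ι n) (sym (ι-suc m)))))

  √5-square : ∀ k → ∣ √-approx 5 k * √-approx 5 k - ι 5 ∣ ≤ ι 6 * (+ 1 / suc k)
  √5-square k = ⇒∣-∣≤
    (ℚₚ.≤-trans lower (p≤p+ (ι 5) (0≤* (ι-mono {0} {6} z≤n) (0≤/ k))))
    (begin
      ι 5                              ≤⟨ upper ⟩
      (s + h) * (s + h)                ≡⟨ solve 2 (λ s h → (s :+ h) :* (s :+ h) := s :* s :+ (s :+ s :+ h) :* h) refl s h ⟩
      -- The constant 6 is 5/2 + 5/2 + 1.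
      s * s + (s + s + h) * h          ≤⟨ ℚₚ.+-monoʳ-≤ (s * s) (*-monoʳ (0≤/ k) (ℚₚ.+-mono-≤ (ℚₚ.+-mono-≤ (√5≤5/2 k) (√5≤5/2 k)) h≤1)) ⟩
      s * s + ι 6 * h                  ∎)
    where
    s = √-approx 5 k
    h = + 1 / suc k
    n = 5 ℕ.* (suc k ℕ.* suc k)
    r = isqrt n
    h≤1 : h ≤ 1ℚ
    h≤1 = /-mono 1 (suc k) 1 1 (s≤s z≤n)
    n≡5 : ι n * (h * h) ≡ ι 5
    n≡5 = begin-equality
      ι n * (h * h)                              ≡⟨ cong (_* (h * h)) (≡.trans (ι-* 5 (suc k ℕ.* suc k)) (cong (ι 5 *_) (ι-* (suc k) (suc k)))) ⟩
      ι 5 * (ι (suc k) * ι (suc k)) * (h * h)    ≡⟨ solve 3 (λ f K h → f :* (K :* K) :* (h :* h) := f :* ((K :* h) :* (K :* h))) refl (ι 5) (ι (suc k)) h ⟩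
      ι 5 * ((ι (suc k) * h) * (ι (suc k) * h))  ≡⟨ cong (λ z → ι 5 * (z * z)) (ι-suc*/ k) ⟩
      ι 5 * (1ℚ * 1ℚ)                            ≡⟨⟩
      ι 5                                        ∎
    lower : s * s ≤ ι 5
    lower = begin
      s * s                      ≡⟨ cong₂ _*_ (/-split r k) (/-split r k) ⟩
      (ι r * h) * (ι r * h)      ≡⟨ solve 2 (λ r h → (r :* h) :* (r :* h) := (r :* r) :* (h :* h)) refl (ι r) h ⟩
      (ι r * ι r) * (h * h)      ≡⟨ cong (_* (h * h)) (ι-* r r) ⟨
      ι (r ℕ.* r) * (h * h)      ≤⟨ *-monoʳ (0≤* (0≤/ k) (0≤/ k)) (ι-mono (isqrt-lower n)) ⟩
      ι n * (h * h)              ≡⟨ n≡5 ⟩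
      ι 5                        ∎
    upper : ι 5 ≤ (s + h) * (s + h)
    upper = begin
      ι 5                                  ≡⟨ n≡5 ⟨
      ι n * (h * h)                        ≤⟨ *-monoʳ (0≤* (0≤/ k) (0≤/ k)) (ι-mono (ℕₚ.<⇒≤ (isqrt-upper n))) ⟩
      ι (suc r ℕ.* suc r) * (h * h)        ≡⟨ cong (_* (h * h)) (≡.trans (ι-* (suc r) (suc r)) (cong₂ _*_ (ι-suc r) (ι-suc r))) ⟩
      (1ℚ + ι r) * (1ℚ + ι r) * (h * h)    ≡⟨ solve 2 (λ r h → (con 1ℚ :+ r) :* (con 1ℚ :+ r) :* (h :* h) := (r :* h :+ h) :* (r :* h :+ h)) refl (ι r) h ⟩
      (ι r * h + h) * (ι r * h + h)        ≡⟨ cong (λ z → (z + h) * (z + h)) (/-split r k) ⟨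
      (s + h) * (s + h)                    ∎

  floor : ∀ {δ} → 0ℚ ≤ δ → ∀ n q → 0ℚ ≤ q → q ≤ ι n * δ → ∃[ t ] ι t * δ ≤ q × q ≤ ι t * δ + δ
  floor {δ} 0≤δ zero    q 0≤q q≤ = 0 , ℚₚ.≤-trans (ℚₚ.≤-reflexive (ℚₚ.*-zeroˡ δ)) 0≤q , ℚₚ.≤-trans q≤ (p≤p+ (ι 0 * δ) 0≤δ)
  floor {δ} 0≤δ (suc n) q 0≤q q≤ with q ℚₚ.≤? ι n * δ
  ... | yes q≤n = floor 0≤δ n q 0≤q q≤n
  ... | no  q≰n = n , ℚₚ.<⇒≤ (ℚₚ.≰⇒> q≰n) , ℚₚ.≤-trans q≤ (ℚₚ.≤-reflexive
        (≡.trans (cong (_* δ) (ι-suc n)) (solve 2 (λ n d → (con 1ℚ :+ n) :* d := n :* d :+ d) refl (ι n) δ)))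

  floor/ : ∀ M q → 0ℚ ≤ q → ∃[ t ] ι t * (+ 1 / suc M) ≤ q × q ≤ ι t * (+ 1 / suc M) + + 1 / suc M
  floor/ M q 0≤q = let n , q≤n = archimedean q in floor (0≤/ M) (n ℕ.* suc M) q 0≤q (begin
    q                                 ≤⟨ q≤n ⟩
    ι n                               ≤⟨ /-mono n 1 (n ℕ.* suc M) (suc M) (ℕₚ.≤-reflexive (sym (ℕₚ.*-identityʳ (n ℕ.* suc M)))) ⟩
    + (n ℕ.* suc M) / suc M           ≡⟨ /-split (n ℕ.* suc M) M ⟩
    ι (n ℕ.* suc M) * (+ 1 / suc M)   ∎)

  recip≤1 : ∀ {q} → 1ℚ ≤ q → recip q ≤ 1ℚ
  recip≤1 {q} 1≤q = recip-anti 0<1 1≤q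

  -- The i-th approximation of (exp (- (a * x)) - exp (- (b * x))) /√5.
  ratioAt : ℝ → ℕ → ℚ
  ratioAt x i = (expSum (- ((ι 3 - √-approx 5 i) * ½ * seq x i)) i - expSum (- ((ι 3 + √-approx 5 i) * ½ * seq x i)) i)
                * recip (√-approx 5 i)

  ∣p∣/4≤∣p∣ : ∀ p → ∣ p ∣ * (+ 1 / 4) ≤ ∣ p ∣
  ∣p∣/4≤∣p∣ p = ℚₚ.≤-trans (*-monoˡ (ℚₚ.0≤∣p∣ p) (/-mono 1 4 1 1 (s≤s z≤n))) (ℚₚ.≤-reflexive (ℚₚ.*-identityʳ _))

  3/≤1 : ∀ M → 2 ℕ.≤ M → ι 3 * (+ 1 / suc M) ≤ 1ℚ
  3/≤1 M 2≤M = ℚₚ.≤-trans (ℚₚ.≤-reflexive (sym (/-split 3 M)))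
    (/-mono 3 (suc M) 1 1 (ℕₚ.≤-trans (s≤s 2≤M) (ℕₚ.≤-reflexive (sym (ℕₚ.*-identityˡ (suc M))))))

  -- The competitive ratio bounded by the discrete flow

  module RatioBound (X : ℚ) (0<X : 0ℚ < X) (M : ℕ) (2≤M : 2 ℕ.≤ M) where

    δ = + 1 / suc M
    B = ι 3 * X

    0<B : 0ℚ < B
    0<B = 0<* (ℚₚ.positive⁻¹ (ι 3)) 0<X

    0≤δ : 0ℚ ≤ δ
    0≤δ = 0≤/ M

    3δ≤1 : ι 3 * δ ≤ 1ℚ
    3δ≤1 = 3/≤1 M 2≤M

    open Euler δ using (φ; ψ)

    err : ℚ
    err = exp-error B 0<B X (ℚₚ.<⇒≤ 0<X) ℚₚ.≤-refl

    module _ (t k : ℕ) (x : ℚ) (∣x∣≤X : ∣ x ∣ ≤ X) (tδ≤X : ι t * δ ≤ X) (near : ∣ x - ι t * δ ∣ ≤ δ + δ)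
      (K≤ : ExpOn.K (B + B) (ℚₚ.+-mono-< 0<B 0<B) ℕ.≤ suc k) (small : ∀ q → ∣ q ∣ ≤ B → ∣ expTerm q (suc k) ∣ ≤ δ)
      (s : ℚ) (2≤s : ι 2 ≤ s) (s≤5/2 : s ≤ + 5 / 2) (s²≈5 : ∣ s * s - ι 5 ∣ ≤ δ) where

      exp-eigen : ∀ c → 0ℚ ≤ c → c ≤ ι 3 → ∣ residual c ∣ ≤ δ →
        ∣ expSum (- (c * x)) (suc k) - (φ t + (1ℚ - c) * ψ t) ∣ ≤ δ * (err + X)
      exp-eigen c 0≤c c≤3 ρ≤δ = begin
        ∣ E - v ∣                        ≤⟨ ∣-∣-via E P v ⟩
        ∣ E - P ∣ + ∣ P - v ∣            ≤⟨ ℚₚ.+-mono-≤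
                                              (exp-pow B 0<B X (ℚₚ.<⇒≤ 0<X) ℚₚ.≤-refl δ c x t k 0≤δ 3δ≤1 0≤c c≤3 ∣x∣≤X tδ≤X near K≤ small)
                                              (ℚₚ.≤-trans (pow-eigen δ 0≤δ 3δ≤1 c t 0≤p p≤1) (begin
                                                ι t * (δ * ∣ ρ ∣)   ≡⟨ ℚₚ.*-assoc (ι t) δ ∣ ρ ∣ ⟨
                                                ι t * δ * ∣ ρ ∣     ≤⟨ *-mono (0≤* (ι-mono {0} {t} z≤n) 0≤δ) 0≤δ tδ≤X ρ≤δ ⟩
                                                X * δ               ≡⟨ ℚₚ.*-comm X δ ⟩
                                                δ * X               ∎)) ⟩
        δ * err + δ * X                  ≡⟨ ℚₚ.*-distribˡ-+ δ err X ⟨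
        δ * (err + X)                    ∎
        where
        E = expSum (- (c * x)) (suc k)
        P = pow (1ℚ + - (c * δ)) t
        v = φ t + (1ℚ - c) * ψ t
        ρ = residual c
        0≤p : 0ℚ ≤ 1ℚ + - (c * δ)
        0≤p = 0≤- (ℚₚ.≤-trans (*-monoʳ 0≤δ c≤3) 3δ≤1)
        p≤1 : 1ℚ + - (c * δ) ≤ 1ℚ
        p≤1 = ≤-by (c * δ) (0≤* 0≤c 0≤δ) (solve 1 (λ z → con 1ℚ := con 1ℚ :+ (:- z) :+ z) refl (c * δ))

      a b : ℚ
      a = (ι 3 - s) * ½
      b = (ι 3 + s) * ½

      ρ-small : ∀ ρ → ρ ≡ (s * s - ι 5) * (+ 1 / 4) → ∣ ρ ∣ ≤ δ
      ρ-small ρ eq = begin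
        ∣ ρ ∣                              ≡⟨ cong ∣_∣ eq ⟩
        ∣ (s * s - ι 5) * (+ 1 / 4) ∣      ≡⟨ ℚₚ.∣p*q∣≡∣p∣*∣q∣ (s * s - ι 5) (+ 1 / 4) ⟩
        ∣ s * s - ι 5 ∣ * (+ 1 / 4)        ≤⟨ ∣p∣/4≤∣p∣ (s * s - ι 5) ⟩
        ∣ s * s - ι 5 ∣                    ≤⟨ s²≈5 ⟩
        δ                                  ∎

      ρa : residual a ≡ (s * s - ι 5) * (+ 1 / 4)
      ρa = solve 1 (λ s → let a = (con (ι 3) :- s) :* con ½ in a :* a :- con (ι 3) :* a :+ con 1ℚ := (s :* s :- con (ι 5)) :* con (+ 1 / 4)) refl s

      ρb : residual b ≡ (s * s - ι 5) * (+ 1 / 4)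
      ρb = solve 1 (λ s → let b = (con (ι 3) :+ s) :* con ½ in b :* b :- con (ι 3) :* b :+ con 1ℚ := (s :* s :- con (ι 5)) :* con (+ 1 / 4)) refl s

      0≤s : 0ℚ ≤ s
      0≤s = ℚₚ.≤-trans (ι-mono {0} {2} z≤n) 2≤s

      a≤3 : a ≤ ι 3
      a≤3 = ≤-by ((ι 3 + s) * ½) (0≤* (0≤+ (ι-mono {0} {3} z≤n) 0≤s) (ℚₚ.<⇒≤ 0<½))
        (solve 1 (λ s → con (ι 3) := (con (ι 3) :- s) :* con ½ :+ (con (ι 3) :+ s) :* con ½) refl s)

      b≤3 : b ≤ ι 3
      b≤3 = ≤-by a (ℚₚ.≤-trans (/-mono 0 1 1 4 z≤n) (¼≤[3-s]/2 s s≤5/2))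
        (solve 1 (λ s → con (ι 3) := (con (ι 3) :+ s) :* con ½ :+ (con (ι 3) :- s) :* con ½) refl s)

      -- `φ t` cancels, and the coefficient of `ψ t` is (1 - a) - (1 - b) = b - a = s, which the
      -- division by √5 removes.
      difference : expSum (- (a * x)) (suc k) - expSum (- (b * x)) (suc k) ≤ s * ψ t + δ * (err + X + (err + X))
      difference = begin
        Ea - Eb
          ≤⟨ ℚₚ.+-mono-≤ (∣-∣≤⇒ Ea va (exp-eigen a (ℚₚ.≤-trans (/-mono 0 1 1 4 z≤n) (¼≤[3-s]/2 s s≤5/2)) a≤3 (ρ-small _ ρa)))
               (ℚₚ.≤-trans (ℚₚ.neg-antimono-≤ (≤⇒-≤ (∣-∣≤⇒ vb Eb (ℚₚ.≤-trans (ℚₚ.≤-reflexive (∣-∣-comm vb Eb))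
                 (exp-eigen b (0≤* (0≤+ (ι-mono {0} {3} z≤n) 0≤s) (ℚₚ.<⇒≤ 0<½)) b≤3 (ρ-small _ ρb)))))) ℚₚ.≤-refl) ⟩
        (va + e) - (vb - e)
          ≡⟨ solve 4 (λ s f p e → (f :+ (con 1ℚ :- (con (ι 3) :- s) :* con ½) :* p :+ e) :- (f :+ (con 1ℚ :- (con (ι 3) :+ s) :* con ½) :* p :- e) :=
               s :* p :+ (e :+ e)) refl s (φ t) (ψ t) e ⟩
        s * ψ t + (e + e)
          ≡⟨ cong (λ z → s * ψ t + z) (ℚₚ.*-distribˡ-+ δ (err + X) (err + X)) ⟨
        s * ψ t + δ * (err + X + (err + X)) ∎
        where
        Ea = expSum (- (a * x)) (suc k)
        Eb = expSum (- (b * x)) (suc k)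
        va = φ t + (1ℚ - a) * ψ t
        vb = φ t + (1ℚ - b) * ψ t
        e = δ * (err + X)
        ≤⇒-≤ : ∀ {p q} → p ≤ q + e → p - e ≤ q
        ≤⇒-≤ {p} {q} h = ℚₚ.≤-trans (ℚₚ.+-monoˡ-≤ (- e) h) (ℚₚ.≤-reflexive (solve 2 (λ q e → q :+ e :- e := q) refl q e))

      quotient-bound : ∀ {ε} → 0ℚ ≤ err → δ * (err + X + (err + X)) ≤ ε →
        (expSum (- (a * x)) (suc k) - expSum (- (b * x)) (suc k)) * recip s ≤ ψ t + ε
      quotient-bound {ε} 0≤err small-error = begin
        (expSum (- (a * x)) (suc k) - expSum (- (b * x)) (suc k)) * w    ≤⟨ *-monoʳ 0≤w difference ⟩
        (s * ψ t + d) * w                ≡⟨ solve 4 (λ s p d w → (s :* p :+ d) :* w := p :* (s :* w) :+ d :* w) refl s (ψ t) d w ⟩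
        ψ t * (s * w) + d * w            ≤⟨ ℚₚ.+-mono-≤ (ℚₚ.≤-reflexive (≡.trans (cong (ψ t *_) (recip-inverse 0<s)) (ℚₚ.*-identityʳ (ψ t))))
                                              (ℚₚ.≤-trans (*-monoˡ 0≤d (recip≤1 (ℚₚ.≤-trans (ι-mono {1} {2} (s≤s z≤n)) 2≤s)))
                                                (ℚₚ.≤-trans (ℚₚ.≤-reflexive (ℚₚ.*-identityʳ d)) small-error)) ⟩
        ψ t + ε                          ∎
        where
        w = recip s
        d = δ * (err + X + (err + X))
        0<s : 0ℚ < s
        0<s = ℚₚ.<-≤-trans (ℚₚ.positive⁻¹ (ι 2)) 2≤s
        0≤w = recip-nonNeg 0<s
        0≤e+X : 0ℚ ≤ err + X
        0≤e+X = 0≤+ 0≤err (ℚₚ.<⇒≤ 0<X)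
        0≤d : 0ℚ ≤ d
        0≤d = 0≤* 0≤δ (0≤+ 0≤e+X 0≤e+X)

  exp-error-nonNeg : ∀ B 0<B X 0≤X 3X≤B → 0ℚ ≤ exp-error B 0<B X 0≤X 3X≤B
  exp-error-nonNeg B 0<B X 0≤X _ = 0≤+ (0≤* (ι-mono {0} {6} z≤n) 0≤D)
    (0≤* 0≤X (0≤+ (0≤* (ι-mono {0} {9} z≤n) 0≤D) (ι-mono {0} {3} z≤n)))
    where
    0≤D = ℚₚ.<⇒≤ (ExpOn.0<D (B + B) (ℚₚ.+-mono-< 0<B 0<B))

  module RatioLimit (x : ℝ) (0≤x : ∀ i → 0ℚ ≤ seq x i) where

    X : ℚ
    X = proj₁ (bounded (seq x) (cauchy x))

    0<X : 0ℚ < X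
    0<X = proj₁ (proj₂ (bounded (seq x) (cauchy x)))

    L : ℕ
    L = proj₁ (proj₂ (proj₂ (bounded (seq x) (cauchy x))))

    ∣x∣≤X : ∀ i → L ℕ.≤ i → ∣ seq x i ∣ ≤ X
    ∣x∣≤X = proj₂ (proj₂ (proj₂ (bounded (seq x) (cauchy x))))

    Close : ℕ → ℚ → Set
    Close M ε = ∃[ t ] ∃[ N ] ∀ i → N ℕ.≤ i → ratioAt x i ≤ Euler.ψ (+ 1 / suc M) t + ε

    close : ∀ M ε (2≤M : 2 ℕ.≤ M) → let open RatioBound X 0<X M 2≤M in δ * (err + X + (err + X)) ≤ ε → Close M ε
    close M ε 2≤M small-error =
      let N₁ , near = cauchy x δ 0<δ
          j = N₁ ℕ.⊔ L
          N₁≤j = ℕₚ.m≤m⊔n N₁ L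
          L≤j = ℕₚ.m≤n⊔m N₁ L
          -- The number of steps must not vary with the approximation, so it is read off at the
          -- single index `j`. Later values of x are within δ of `seq x j`, which is within δ of t
          -- δ; hence the distance 2δ required above.
          t , tδ≤x , x≤tδ+δ = floor/ M (seq x j) (0≤x j)
          tδ≤X = ℚₚ.≤-trans tδ≤x (ℚₚ.≤-trans (p≤∣p∣ (seq x j)) (∣x∣≤X j L≤j))
          N₂ , vanish = term-vanishes B 0<B δ 0<δ
          N₃ , fine = /-small (0<* 0<δ (ℚₚ.positive⁻¹ (+ 1 / 6)))
          K = ExpOn.K (B + B) (ℚₚ.+-mono-< 0<B 0<B)
      in t , suc (j ℕ.⊔ N₂ ℕ.⊔ (N₃ ℕ.⊔ K)) , λ where
        (suc k) (s≤s ≤k) →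
          let ≤k₁ = ℕₚ.m⊔n≤o⇒m≤o (j ℕ.⊔ N₂) (N₃ ℕ.⊔ K) ≤k
              ≤k₂ = ℕₚ.m⊔n≤o⇒n≤o (j ℕ.⊔ N₂) (N₃ ℕ.⊔ K) ≤k
              j≤i = ℕₚ.≤-trans (ℕₚ.m⊔n≤o⇒m≤o j N₂ ≤k₁) (ℕₚ.n≤1+n k)
              N₃≤i = ℕₚ.≤-trans (ℕₚ.m⊔n≤o⇒m≤o N₃ K ≤k₂) (ℕₚ.n≤1+n k)
          in quotient-bound t k (seq x (suc k)) (∣x∣≤X (suc k) (ℕₚ.≤-trans L≤j j≤i)) tδ≤X
               (ℚₚ.≤-trans (∣-∣-via (seq x (suc k)) (seq x j) (ι t * δ)) (ℚₚ.+-mono-≤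
                 (near (suc k) j (ℕₚ.≤-trans N₁≤j j≤i) N₁≤j)
                 (⇒∣-∣≤ x≤tδ+δ (ℚₚ.≤-trans tδ≤x (p≤p+ (seq x j) 0≤δ)))))
               (ℕₚ.≤-trans (ℕₚ.m⊔n≤o⇒n≤o N₃ K ≤k₂) (ℕₚ.n≤1+n k))
               (vanish k (ℕₚ.m⊔n≤o⇒n≤o j N₂ ≤k₁))
               (√-approx 5 (suc k)) (2≤√5 (suc k)) (√5≤5/2 (suc k))
               (ℚₚ.≤-trans (√5-square (suc k)) (ℚₚ.≤-trans (*-monoˡ (ι-mono {0} {6} z≤n) (fine (suc k) N₃≤i))
                 (ℚₚ.≤-reflexive (solve 1 (λ d → con (ι 6) :* (d :* con (+ 1 / 6)) := d) refl δ))))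
               (exp-error-nonNeg B 0<B X (ℚₚ.<⇒≤ 0<X) ℚₚ.≤-refl) small-error
      where
      open RatioBound X 0<X M 2≤M
      0<δ : 0ℚ < δ
      0<δ = ℚₚ.positive⁻¹ δ {{ℚₚ.normalize-pos 1 (suc M)}}

    limit : ∀ ε → 0ℚ < ε → ∃[ N ] ∀ M → N ℕ.≤ M → Close M ε
    limit ε 0<ε =
      let r , 0<r , Zr≡1 = 0<⇒∃/ 0<Z
          N , small = /-small (0<* 0<ε 0<r)
      in N ℕ.⊔ 2 , λ M ≤M → close M ε (ℕₚ.m⊔n≤o⇒n≤o N 2 ≤M) (begin
        (+ 1 / suc M) * Z   ≤⟨ *-monoʳ (ℚₚ.<⇒≤ 0<Z) (small M (ℕₚ.m⊔n≤o⇒m≤o N 2 ≤M)) ⟩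
        ε * r * Z           ≡⟨ solve 3 (λ e r Z → e :* r :* Z := e :* (Z :* r)) refl ε r Z ⟩
        ε * (Z * r)         ≡⟨ cong (ε *_) Zr≡1 ⟩
        ε * 1ℚ              ≡⟨ ℚₚ.*-identityʳ ε ⟩
        ε                   ∎)
      where
      -- `err` depends on `X` alone and not on the step, so one threshold `N` serves every `M`; the
      -- 2 is an arbitrary instance.
      open RatioBound X 0<X 2 ℕₚ.≤-refl using (err; B; 0<B)
      Z : ℚ
      Z = err + X + (err + X)
      0<err+X : 0ℚ < err + X
      0<err+X = ℚₚ.+-mono-≤-< (exp-error-nonNeg B 0<B X (ℚₚ.<⇒≤ 0<X) ℚₚ.≤-refl) 0<X
      0<Z : 0ℚ < Z
      0<Z = ℚₚ.+-mono-< 0<err+X 0<err+X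

-- Order and arithmetic on ℝ

open import Defs using (_+_; _*_; _-_; -_; _≤_; _<_)

-- Where the operations on ℝ unfold, Agda ends up comparing Cauchy proofs; these copies do not unfold.
infixl 6 _⊕_ _⊖_
infixl 7 _⊗_

opaque
  _⊕_ _⊖_ _⊗_ : ℝ → ℝ → ℝ
  x ⊕ y = x + y
  x ⊖ y = x - y
  x ⊗ y = x * y

infix 4 _≼_

-- _≤_ unfolds to a Π-type, from which Agda cannot infer its arguments.
record _≼_ (x y : ℝ) : Set where
  constructor pack
  field unpack : x ≤ y

open _≼_

module _ where
  open ℚ-Solver.+-*-Solver
  open ℚₚ.≤-Reasoning

  ≼-scale : ∀ {x y} C → 0ℚ ℚ.< C →
            (∀ ε → 0ℚ ℚ.< ε → ∃[ N ] ∀ i → N ℕ.≤ i → seq x i ℚ.≤ seq y i ℚ.+ C ℚ.* ε) → x ≼ y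
  ≼-scale {x} {y} C 0<C h = pack λ ε 0<ε →
    let r , 0<r , Cr≡1 = 0<⇒∃/ 0<C
        N , p = h (r ℚ.* ε) (0<* 0<r 0<ε)
    in N , λ i N≤i → begin
      seq x i                              ≤⟨ p i N≤i ⟩
      seq y i ℚ.+ C ℚ.* (r ℚ.* ε)          ≡⟨ cong (seq y i ℚ.+_) (ℚₚ.*-assoc C r ε) ⟨
      seq y i ℚ.+ C ℚ.* r ℚ.* ε            ≡⟨ cong (λ z → seq y i ℚ.+ z ℚ.* ε) Cr≡1 ⟩
      seq y i ℚ.+ 1ℚ ℚ.* ε                 ≡⟨ cong (seq y i ℚ.+_) (ℚₚ.*-identityˡ ε) ⟩
      seq y i ℚ.+ ε                        ∎

  ≼-termwise : ∀ {x y} → (∀ i → seq x i ℚ.≤ seq y i) → x ≼ y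
  ≼-termwise {x} {y} h = pack λ ε 0<ε → 0 , λ i _ → ℚₚ.≤-trans (h i) (p≤p+ (seq y i) (ℚₚ.<⇒≤ 0<ε))

  ≼-reflexive : ∀ {x y} → (∀ i → seq x i ≡ seq y i) → x ≼ y
  ≼-reflexive h = ≼-termwise λ i → ℚₚ.≤-reflexive (h i)

  ≼-refl : ∀ {x} → x ≼ x
  ≼-refl = ≼-reflexive λ _ → refl

  ≡⇒≼ : ∀ {x y} → x ≡ y → x ≼ y
  ≡⇒≼ refl = ≼-refl

  ≼-trans : ∀ {x y z} → x ≼ y → y ≼ z → x ≼ z
  ≼-trans {x} {y} {z} (pack p) (pack q) = ≼-scale (1ℚ ℚ.+ 1ℚ) (ℚₚ.+-mono-< 0<1 0<1) λ ε 0<ε →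
    let N , h = p ε 0<ε
        M , k = q ε 0<ε
    in N ℕ.⊔ M , λ i ≤i → begin
      seq x i                      ≤⟨ h i (ℕₚ.m⊔n≤o⇒m≤o N M ≤i) ⟩
      seq y i ℚ.+ ε                ≤⟨ ℚₚ.+-monoˡ-≤ ε (k i (ℕₚ.m⊔n≤o⇒n≤o N M ≤i)) ⟩
      seq z i ℚ.+ ε ℚ.+ ε          ≡⟨ solve 2 (λ z e → z :+ e :+ e := z :+ (con 1ℚ :+ con 1ℚ) :* e) refl (seq z i) ε ⟩
      seq z i ℚ.+ (1ℚ ℚ.+ 1ℚ) ℚ.* ε ∎

  module ≼-Reasoning = Relation.Binary.Reasoning.Base.Single _≼_ ≼-refl ≼-trans

  opaque
    unfolding _⊕_ _⊖_ _⊗_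

    +-mono-≼ : ∀ {x y u v} → x ≼ y → u ≼ v → x ⊕ u ≼ y ⊕ v
    +-mono-≼ {x} {y} {u} {v} (pack p) (pack q) = ≼-scale (1ℚ ℚ.+ 1ℚ) (ℚₚ.+-mono-< 0<1 0<1) λ ε 0<ε →
      let N , h = p ε 0<ε
          M , k = q ε 0<ε
      in N ℕ.⊔ M , λ i ≤i → begin
        seq x i ℚ.+ seq u i
          ≤⟨ ℚₚ.+-mono-≤ (h i (ℕₚ.m⊔n≤o⇒m≤o N M ≤i)) (k i (ℕₚ.m⊔n≤o⇒n≤o N M ≤i)) ⟩
        (seq y i ℚ.+ ε) ℚ.+ (seq v i ℚ.+ ε)
          ≡⟨ solve 3 (λ y v e → (y :+ e) :+ (v :+ e) := (y :+ v) :+ (con 1ℚ :+ con 1ℚ) :* e) refl (seq y i) (seq v i) ε ⟩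
        (seq y i ℚ.+ seq v i) ℚ.+ (1ℚ ℚ.+ 1ℚ) ℚ.* ε ∎

    0≼* : ∀ {x y} → 0ℝ ≼ x → 0ℝ ≼ y → 0ℝ ≼ x ⊗ y
    0≼* {x} {y} (pack p) (pack q) =
      let B , 0<B , K , ∣x∣≤B = bounded (seq x) (cauchy x)
          D , 0<D , L , ∣y∣≤D = bounded (seq y) (cauchy y)
      in ≼-scale (B ℚ.+ D ℚ.+ 1ℚ) (ℚₚ.+-mono-< (ℚₚ.+-mono-< 0<B 0<D) 0<1) λ ε 0<ε →
      let J , small = /-small 0<ε
          -- A slack below both `ε` and 1, so that (X + η)(Y + η) exceeds X Y by at most a constant
          -- times `ε`.
          η = + 1 ℚ./ suc J
          0<η = ℚₚ.positive⁻¹ η {{ℚₚ.normalize-pos 1 (suc J)}}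
          N , h = p η 0<η
          M , k = q η 0<η
      in (N ℕ.⊔ M) ℕ.⊔ (K ℕ.⊔ L) , λ i ≤i →
        let NM≤ = ℕₚ.m⊔n≤o⇒m≤o (N ℕ.⊔ M) (K ℕ.⊔ L) ≤i
            KL≤ = ℕₚ.m⊔n≤o⇒n≤o (N ℕ.⊔ M) (K ℕ.⊔ L) ≤i
            X = seq x i
            Y = seq y i
            X≤B = ℚₚ.≤-trans (p≤∣p∣ X) (∣x∣≤B i (ℕₚ.m⊔n≤o⇒m≤o K L KL≤))
            Y≤D = ℚₚ.≤-trans (p≤∣p∣ Y) (∣y∣≤D i (ℕₚ.m⊔n≤o⇒n≤o K L KL≤))
            η≤1 = /-mono 1 (suc J) 1 1 (ℕ.s≤s ℕ.z≤n)
        in begin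
        0ℚ                                          ≤⟨ 0≤* (h i (ℕₚ.m⊔n≤o⇒m≤o N M NM≤)) (k i (ℕₚ.m⊔n≤o⇒n≤o N M NM≤)) ⟩
        (X ℚ.+ η) ℚ.* (Y ℚ.+ η)                     ≡⟨ solve 3 (λ X Y e → (X :+ e) :* (Y :+ e) := X :* Y :+ (X :+ Y :+ e) :* e) refl X Y η ⟩
        X ℚ.* Y ℚ.+ (X ℚ.+ Y ℚ.+ η) ℚ.* η           ≤⟨ ℚₚ.+-monoʳ-≤ (X ℚ.* Y) (ℚₚ.≤-trans
                                                         (*-monoʳ (ℚₚ.<⇒≤ 0<η) (ℚₚ.+-mono-≤ (ℚₚ.+-mono-≤ X≤B Y≤D) η≤1))
                                                         (*-monoˡ (ℚₚ.<⇒≤ (ℚₚ.+-mono-< (ℚₚ.+-mono-< 0<B 0<D) 0<1)) (small J ℕₚ.≤-refl))) ⟩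
        X ℚ.* Y ℚ.+ (B ℚ.+ D ℚ.+ 1ℚ) ℚ.* ε          ∎

  -- The constructive substitute for a comparison. With η = ε/5, one late pair of approximations is
  -- compared with threshold 3η. Moving to other late indices costs 2η, which leaves either an
  -- excess of at most 5η = ε or a gap of at least η.
  locate : ∀ x y ε → 0ℚ ℚ.< ε → (∃[ N ] ∀ i → N ℕ.≤ i → seq x i ℚ.≤ seq y i ℚ.+ ε) ⊎ y < x
  locate x y ε 0<ε with cauchy x (ε ℚ.* (+ 1 ℚ./ 5)) (0<* 0<ε (ℚₚ.positive⁻¹ (+ 1 ℚ./ 5)))
                      | cauchy y (ε ℚ.* (+ 1 ℚ./ 5)) (0<* 0<ε (ℚₚ.positive⁻¹ (+ 1 ℚ./ 5)))
  ... | N , p | M , q = decide (seq x K ℚₚ.≤? seq y K ℚ.+ (η ℚ.+ η ℚ.+ η))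
    where
    K = N ℕ.⊔ M
    η = ε ℚ.* (+ 1 ℚ./ 5)
    x-near : ∀ i j → K ℕ.≤ i → K ℕ.≤ j → seq x i ℚ.≤ seq x j ℚ.+ η
    x-near i j ≤i ≤j = ∣-∣≤⇒ (seq x i) (seq x j) (p i j (ℕₚ.m⊔n≤o⇒m≤o N M ≤i) (ℕₚ.m⊔n≤o⇒m≤o N M ≤j))
    y-near : ∀ i j → K ℕ.≤ i → K ℕ.≤ j → seq y i ℚ.≤ seq y j ℚ.+ η
    y-near i j ≤i ≤j = ∣-∣≤⇒ (seq y i) (seq y j) (q i j (ℕₚ.m⊔n≤o⇒n≤o N M ≤i) (ℕₚ.m⊔n≤o⇒n≤o N M ≤j))
    decide : _ → _
    decide (yes le) = inj₁ (K , λ i ≤i → begin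
      seq x i                                        ≤⟨ x-near i K ≤i ℕₚ.≤-refl ⟩
      seq x K ℚ.+ η                                  ≤⟨ ℚₚ.+-monoˡ-≤ η le ⟩
      seq y K ℚ.+ (η ℚ.+ η ℚ.+ η) ℚ.+ η              ≤⟨ ℚₚ.+-monoˡ-≤ η (ℚₚ.+-monoˡ-≤ (η ℚ.+ η ℚ.+ η) (y-near K i ℕₚ.≤-refl ≤i)) ⟩
      seq y i ℚ.+ η ℚ.+ (η ℚ.+ η ℚ.+ η) ℚ.+ η
        ≡⟨ solve 2 (λ y e → let η = e :* con (+ 1 ℚ./ 5) in y :+ η :+ (η :+ η :+ η) :+ η := y :+ e) refl (seq y i) ε ⟩
      seq y i ℚ.+ ε                                  ∎)
    decide (no ¬le) = inj₂ (η , 0<* 0<ε (ℚₚ.positive⁻¹ (+ 1 ℚ./ 5)) , K , λ i ≤i → begin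
      seq y i ℚ.+ η                                  ≤⟨ ℚₚ.+-monoˡ-≤ η (y-near i K ≤i ℕₚ.≤-refl) ⟩
      seq y K ℚ.+ η ℚ.+ η
        ≡⟨ solve 2 (λ y η → y :+ η :+ η := y :+ (η :+ η :+ η) :- η) refl (seq y K) η ⟩
      seq y K ℚ.+ (η ℚ.+ η ℚ.+ η) ℚ.- η              ≤⟨ ℚₚ.+-monoˡ-≤ (ℚ.- η) (ℚₚ.<⇒≤ (ℚₚ.≰⇒> ¬le)) ⟩
      seq x K ℚ.- η                                  ≤⟨ ℚₚ.+-monoˡ-≤ (ℚ.- η) (x-near K i ℕₚ.≤-refl ≤i) ⟩
      seq x i ℚ.+ η ℚ.- η                            ≡⟨ solve 2 (λ x η → x :+ η :- η := x) refl (seq x i) η ⟩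
      seq x i                                        ∎)

  <⇒≼ : ∀ {x y} → x < y → x ≼ y
  <⇒≼ {x} (δ , 0<δ , N , h) = pack λ ε 0<ε → N , λ i N≤i →
    ℚₚ.≤-trans (p≤p+ (seq x i) (ℚₚ.<⇒≤ 0<δ)) (ℚₚ.≤-trans (h i N≤i) (p≤p+ _ (ℚₚ.<⇒≤ 0<ε)))

  ≼⇒≮ : ∀ {x y} → x ≼ y → ¬ (y < x)
  ≼⇒≮ {x} {y} (pack p) (δ , 0<δ , N , h) =
    let 0<δ/2 = 0<* 0<δ 0<½
        M , k = p (δ ℚ.* ½) 0<δ/2
        i = N ℕ.⊔ M
    in ℚₚ.<-irrefl refl (begin-strict
      seq x i                             ≤⟨ k i (ℕₚ.m≤n⊔m N M) ⟩
      seq y i ℚ.+ δ ℚ.* ½                 ≡⟨ ℚₚ.+-identityʳ _ ⟨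
      seq y i ℚ.+ δ ℚ.* ½ ℚ.+ 0ℚ          <⟨ ℚₚ.+-monoʳ-< (seq y i ℚ.+ δ ℚ.* ½) 0<δ/2 ⟩
      seq y i ℚ.+ δ ℚ.* ½ ℚ.+ δ ℚ.* ½     ≡⟨ solve 2 (λ y d → y :+ d :* con ½ :+ d :* con ½ := y :+ d) refl (seq y i) δ ⟩
      seq y i ℚ.+ δ                       ≤⟨ h i (ℕₚ.m≤m⊔n N M) ⟩
      seq x i                             ∎)

≰⇒≽ : ∀ {x y} → ¬ (x ≼ y) → y ≼ x
≰⇒≽ {x} {y} ¬x≼y = pack approx
  where
  approx : y ≤ x
  approx ε 0<ε with locate y x ε 0<ε
  ... | inj₁ h   = h
  ... | inj₂ x<y = ⊥-elim (¬x≼y (<⇒≼ x<y))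

-- The order on ℝ is not decidable, but a proof of an inequality may still
-- distinguish cases by it because inequalities are stable under double negation.
≼-cases : ∀ x y {u v} → (x ≼ y → u ≼ v) → (y ≼ x → u ≼ v) → u ≼ v
≼-cases x y {u} {v} l r = pack approx
  where
  approx : u ≤ v
  approx ε 0<ε with locate u v ε 0<ε
  ... | inj₁ h   = h
  ... | inj₂ v<u = ⊥-elim (≼⇒≮ (r (≰⇒≽ λ x≼y → ≼⇒≮ (l x≼y) v<u)) v<u)

module _ where
  open ℚ-Solver.+-*-Solver

  opaque
    unfolding _⊕_ _⊖_ _⊗_

    +-monoʳ-≼ : ∀ x {u v} → u ≼ v → x ⊕ u ≼ x ⊕ v
    +-monoʳ-≼ x = +-mono-≼ (≼-refl {x})

    +-monoˡ-≼ : ∀ x {u v} → u ≼ v → u ⊕ x ≼ v ⊕ x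
    +-monoˡ-≼ x h = +-mono-≼ h (≼-refl {x})

    0≼+ : ∀ {x y} → 0ℝ ≼ x → 0ℝ ≼ y → 0ℝ ≼ x ⊕ y
    0≼+ p q = ≼-trans (≼-reflexive λ _ → refl) (+-mono-≼ p q)

    ≼⇒0≼- : ∀ {x y} → x ≼ y → 0ℝ ≼ y ⊖ x
    ≼⇒0≼- {x} {y} p = ≼-trans (≼-reflexive λ i → sym (ℚₚ.+-inverseʳ (seq x i))) (+-monoˡ-≼ (- x) p)

    ≼-by : ∀ {x y w} → 0ℝ ≼ w → (∀ i → seq y i ≡ seq x i ℚ.+ seq w i) → x ≼ y
    ≼-by {x} {y} {w} 0≼w eq = ≼-trans (≼-reflexive λ i → sym (ℚₚ.+-identityʳ (seq x i)))
      (≼-trans (+-monoʳ-≼ x 0≼w) (≼-reflexive λ i → sym (eq i)))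

    *-monoˡ-≼ : ∀ {c x y} → 0ℝ ≼ c → x ≼ y → c ⊗ x ≼ c ⊗ y
    *-monoˡ-≼ {c} {x} {y} 0≼c x≼y = ≼-by (0≼* 0≼c (≼⇒0≼- x≼y)) λ i →
      solve 3 (λ c x y → c :* y := c :* x :+ c :* (y :- x)) refl (seq c i) (seq x i) (seq y i)

    *-monoʳ-≼ : ∀ {c x y} → 0ℝ ≼ c → x ≼ y → x ⊗ c ≼ y ⊗ c
    *-monoʳ-≼ {c} {x} {y} 0≼c x≼y = ≼-by (0≼* 0≼c (≼⇒0≼- x≼y)) λ i →
      solve 3 (λ c x y → y :* c := x :* c :+ c :* (y :- x)) refl (seq c i) (seq x i) (seq y i)

fromℚ-mono : ∀ {p q} → p ℚ.≤ q → fromℚ p ≼ fromℚ q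
fromℚ-mono p≤q = ≼-termwise λ _ → p≤q

opaque
  unfolding _⊕_ _⊖_ _⊗_

  *-max-≼ : ∀ {c x y u} → c ⊗ x ≼ u → c ⊗ y ≼ u → c ⊗ max x y ≼ u
  *-max-≼ {c} {x} {y} {u} (pack p) (pack q) = pack λ ε 0<ε →
    let N , h = p ε 0<ε
        M , k = q ε 0<ε
    in N ℕ.⊔ M , λ i ≤i → choose i (ℚₚ.⊔-sel (seq x i) (seq y i))
         (h i (ℕₚ.m⊔n≤o⇒m≤o N M ≤i)) (k i (ℕₚ.m⊔n≤o⇒n≤o N M ≤i))
    where
    choose : ∀ i {z} → (seq x i ℚ.⊔ seq y i ≡ seq x i) ⊎ (seq x i ℚ.⊔ seq y i ≡ seq y i) →
             seq c i ℚ.* seq x i ℚ.≤ z → seq c i ℚ.* seq y i ℚ.≤ z → seq c i ℚ.* (seq x i ℚ.⊔ seq y i) ℚ.≤ z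
    choose i (inj₁ eq) l r = ℚₚ.≤-trans (ℚₚ.≤-reflexive (cong (seq c i ℚ.*_) eq)) l
    choose i (inj₂ eq) l r = ℚₚ.≤-trans (ℚₚ.≤-reflexive (cong (seq c i ℚ.*_) eq)) r

opaque
  unfolding _⊕_ _⊖_ _⊗_

  ≼-limit : ∀ {x y z} → (∀ ε → 0ℚ ℚ.< ε → x ≼ y ⊕ fromℚ ε ⊗ z) → x ≼ y
  ≼-limit {x} {y} {z} h =
    let B , 0<B , K , ∣z∣≤B = bounded (seq z) (cauchy z)
    in ≼-scale (B ℚ.+ 1ℚ) (ℚₚ.+-mono-< 0<B 0<1) λ ε 0<ε →
    let N , p = unpack (h ε 0<ε) ε 0<ε
    in N ℕ.⊔ K , λ i ≤i → begin
      seq x i                                    ≤⟨ p i (ℕₚ.m⊔n≤o⇒m≤o N K ≤i) ⟩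
      seq y i ℚ.+ ε ℚ.* seq z i ℚ.+ ε            ≤⟨ ℚₚ.+-monoˡ-≤ ε (ℚₚ.+-monoʳ-≤ (seq y i) (*-monoˡ (ℚₚ.<⇒≤ 0<ε)
                                                      (ℚₚ.≤-trans (p≤∣p∣ (seq z i)) (∣z∣≤B i (ℕₚ.m⊔n≤o⇒n≤o N K ≤i))))) ⟩
      seq y i ℚ.+ ε ℚ.* B ℚ.+ ε                  ≡⟨ solve 3 (λ y e B → y :+ e :* B :+ e := y :+ (B :+ con 1ℚ) :* e) refl (seq y i) ε B ⟩
      seq y i ℚ.+ (B ℚ.+ 1ℚ) ℚ.* ε               ∎
    where
    open ℚ-Solver.+-*-Solver
    open ℚₚ.≤-Reasoning

module _ where
  open ℚ-Solver.+-*-Solver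

  opaque
    unfolding _⊕_ _⊗_

    steps-zero : ∀ w d x → w ≼ w ⊕ fromℚ (ι 0 ℚ.* d) ⊗ x
    steps-zero w d x = ≼-reflexive λ i →
      solve 3 (λ w d x → w := w :+ con 0ℚ :* d :* x) refl (seq w i) d (seq x i)

    steps-suc : ∀ w q d x → w ⊕ fromℚ (ι q ℚ.* d) ⊗ x ⊕ fromℚ d ⊗ x ≼ w ⊕ fromℚ (ι (suc q) ℚ.* d) ⊗ x
    steps-suc w q d x = ≼-reflexive λ i → ≡.trans
      (solve 4 (λ w n d x → w :+ n :* d :* x :+ d :* x := w :+ (con 1ℚ :+ n) :* d :* x) refl (seq w i) (ι q) d (seq x i))
      (cong (λ n → seq w i ℚ.+ n ℚ.* d ℚ.* seq x i) (sym (ι-suc q)))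

-- Concavity along the discrete flow

module Potential (δ : ℚ) (0≤δ : 0ℚ ℚ.≤ δ) (3δ≤1 : ι 3 ℚ.* δ ℚ.≤ 1ℚ) where
  open Euler δ
  open Bounds 0≤δ 3δ≤1
  open ℚ-Solver.+-*-Solver

  module _ (F H : ℝ) where

    opaque
      -- `Δ n` is the form `W n` applied to the velocities H - F and F - 2H. Because a matrix
      -- commutes with its powers, it is both the increment of `W` per unit of time (`W-suc`) and
      -- the effect of an Euler step on the initial values (`W+Δ≼`). This lets concavity in time
      -- compare a long step with many short ones.
      W Δ : ℕ → ℝ
      W n = fromℚ (φ n) ⊗ F ⊕ fromℚ (ψ n) ⊗ H
      Δ n = fromℚ (φ n) ⊗ (H ⊖ F) ⊕ fromℚ (ψ n) ⊗ (F ⊖ (H ⊕ H))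

      ≼W : ∀ n → fromℚ (φ n) ⊗ F ⊕ fromℚ (ψ n) ⊗ H ≼ W n
      ≼W n = ≼-refl

      W-mono : ∀ n {H′} → H ≼ H′ → W n ≼ fromℚ (φ n) ⊗ F ⊕ fromℚ (ψ n) ⊗ H′
      W-mono n H≼H′ = +-monoʳ-≼ (fromℚ (φ n) ⊗ F) (*-monoˡ-≼ (fromℚ-mono (0≤ψ n)) H≼H′)

    opaque
      unfolding _⊕_ _⊖_ _⊗_ W Δ

      W+Δ≼ : ∀ n c → W n ⊕ fromℚ c ⊗ Δ n ≼
             fromℚ (φ n) ⊗ (F ⊕ fromℚ c ⊗ (H ⊖ F)) ⊕ fromℚ (ψ n) ⊗ (H ⊕ fromℚ c ⊗ (F ⊖ (H ⊕ H)))
      W+Δ≼ n c = ≼-reflexive λ i →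
        solve 5 (λ c f p F H → f :* F :+ p :* H :+ c :* (f :* (H :- F) :+ p :* (F :- (H :+ H))) :=
          f :* (F :+ c :* (H :- F)) :+ p :* (H :+ c :* (F :- (H :+ H)))) refl c (φ n) (ψ n) (seq F i) (seq H i)

      W-zero : W zero ≼ F
      W-zero = ≼-reflexive λ i →
        solve 2 (λ F H → con 1ℚ :* F :+ con 0ℚ :* H := F) refl (seq F i) (seq H i)

      ≼W-zero : F ≼ W zero
      ≼W-zero = ≼-reflexive λ i →
        solve 2 (λ F H → F := con 1ℚ :* F :+ con 0ℚ :* H) refl (seq F i) (seq H i)

      0≼Δ-zero : F ≼ H → 0ℝ ≼ Δ zero
      0≼Δ-zero F≼H = ≼-trans (≼⇒0≼- F≼H) (≼-reflexive λ i →
        solve 2 (λ F H → H :- F := con 1ℚ :* (H :- F) :+ con 0ℚ :* (F :- (H :+ H))) refl (seq F i) (seq H i))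

      W-suc : ∀ n → W (suc n) ≼ W n ⊕ fromℚ δ ⊗ Δ n
      W-suc n = ≼-reflexive λ i →
        solve 5 (λ d f p F H → (f :+ d :* (p :- f)) :* F :+ (p :+ d :* (f :- (p :+ p))) :* H :=
          f :* F :+ p :* H :+ d :* (f :* (H :- F) :+ p :* (F :- (H :+ H)))) refl δ (φ n) (ψ n) (seq F i) (seq H i)

      -- Here and in Δ-falls, φ = D + 2ψ is the decomposition that exhibits the sign.
      W-falls : H ≼ F → 0ℝ ≼ F → ∀ n → 0ℚ ℚ.≤ D n → W n ⊕ fromℚ δ ⊗ Δ n ≼ W n
      W-falls H≼F 0≼F n 0≤D = ≼-by
        (0≼* (fromℚ-mono 0≤δ) (0≼+ (0≼* (fromℚ-mono 0≤D) (≼⇒0≼- H≼F)) (0≼* (fromℚ-mono (0≤ψ n)) 0≼F)))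
        (λ i → solve 5 (λ d f p F H → f :* F :+ p :* H :=
          (f :* F :+ p :* H :+ d :* (f :* (H :- F) :+ p :* (F :- (H :+ H)))) :+
          d :* ((f :- (p :+ p)) :* (F :- H) :+ p :* F)) refl δ (φ n) (ψ n) (seq F i) (seq H i))

      Δ-falls : F ≼ H → 0ℝ ≼ F → ∀ n → 0ℚ ℚ.≤ D n → Δ (suc n) ≼ Δ n
      Δ-falls F≼H 0≼F n 0≤D = ≼-by
        (0≼* (fromℚ-mono 0≤δ) (0≼+
          (0≼* (fromℚ-mono 0≤D) (0≼+ (0≼+ (≼⇒0≼- F≼H) (≼⇒0≼- F≼H)) (≼-trans 0≼F F≼H)))
          (0≼* (fromℚ-mono (0≤ψ n)) (≼⇒0≼- F≼H))))
        λ i → solve 5 (λ d f p F H → f :* (H :- F) :+ p :* (F :- (H :+ H)) :=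
          (f :+ d :* (p :- f)) :* (H :- F) :+ (p :+ d :* (f :- (p :+ p))) :* (F :- (H :+ H)) :+
          d :* ((f :- (p :+ p)) :* ((H :- F) :+ (H :- F) :+ H) :+ p :* (H :- F))) refl δ (φ n) (ψ n) (seq F i) (seq H i)

    W-below : H ≼ F → 0ℝ ≼ F → ∀ n → Rising n → W n ≼ F
    W-below H≼F 0≼F zero    _  = W-zero
    W-below H≼F 0≼F (suc n) up = ≼-trans (W-suc n) (≼-trans (W-falls H≼F 0≼F n (up n ℕₚ.≤-refl))
      (W-below H≼F 0≼F n (rising-≤ (ℕₚ.n≤1+n n) up)))

    module _ (F≼H : F ≼ H) (0≼F : 0ℝ ≼ F) where

      Δ-falls+ : ∀ k q → Rising (q ℕ.+ k) → Δ (q ℕ.+ k) ≼ Δ k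
      Δ-falls+ k zero    _  = ≼-refl
      Δ-falls+ k (suc q) up = ≼-trans (Δ-falls F≼H 0≼F (q ℕ.+ k) (up (q ℕ.+ k) ℕₚ.≤-refl))
        (Δ-falls+ k q (rising-≤ (ℕₚ.n≤1+n _) up))

      W-concave : ∀ k q → Rising (q ℕ.+ k) → W (q ℕ.+ k) ≼ W k ⊕ fromℚ (ι q ℚ.* δ) ⊗ Δ k
      W-concave k zero    _  = steps-zero (W k) δ (Δ k)
      W-concave k (suc q) up = begin
        W (suc q ℕ.+ k)                                 ∼⟨ W-suc (q ℕ.+ k) ⟩
        W (q ℕ.+ k) ⊕ fromℚ δ ⊗ Δ (q ℕ.+ k)             ∼⟨ +-mono-≼ (W-concave k q up′) (*-monoˡ-≼ (fromℚ-mono 0≤δ) (Δ-falls+ k q up′)) ⟩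
        W k ⊕ fromℚ (ι q ℚ.* δ) ⊗ Δ k ⊕ fromℚ δ ⊗ Δ k   ∼⟨ steps-suc (W k) q δ (Δ k) ⟩
        W k ⊕ fromℚ (ι (suc q) ℚ.* δ) ⊗ Δ k             ∎
        where
        open ≼-Reasoning
        up′ = rising-≤ (ℕₚ.n≤1+n _) up

    -- One arrival advances time by q steps of size δ, so a lower bound on the values after it
    -- (with k steps of time left) yields one before it (with q + k steps left).
    W-advance : ∀ {E} q → 0ℝ ≼ F → F ≼ E →
      (∀ k → Rising k → fromℚ (φ k) ⊗ (F ⊕ fromℚ (ι q ℚ.* δ) ⊗ (H ⊖ F)) ⊕
                        fromℚ (ψ k) ⊗ (H ⊕ fromℚ (ι q ℚ.* δ) ⊗ (F ⊖ (H ⊕ H))) ≼ E) →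
      ∀ n → Rising n → W n ≼ E
    W-advance {E} q 0≼F F≼E later n up = ≼-cases H F
      (λ H≼F → ≼-trans (W-below H≼F 0≼F n up) F≼E) (λ F≼H → ahead F≼H (ℕₚ.≤-total q n))
      where
      module _ (F≼H : F ≼ H) where
        long : ∀ k → Rising (q ℕ.+ k) → W (q ℕ.+ k) ≼ E
        long k up = ≼-trans (W-concave F≼H 0≼F k q up)
          (≼-trans (W+Δ≼ k (ι q ℚ.* δ)) (later k (rising-≤ (ℕₚ.m≤n+m k q) up)))

        -- When fewer than `q` steps are left, the time is rounded up to a whole arrival with no
        -- steps after it: `Δ zero` is H - F, which is nonnegative here.
        extend : n ℕ.≤ q → W zero ⊕ fromℚ (ι n ℚ.* δ) ⊗ Δ zero ≼ W zero ⊕ fromℚ (ι q ℚ.* δ) ⊗ Δ zero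
        extend n≤q = +-monoʳ-≼ (W zero) (*-monoʳ-≼ (0≼Δ-zero F≼H) (fromℚ-mono (*-monoʳ 0≤δ (ι-mono n≤q))))

        short : n ℕ.≤ q → Rising (n ℕ.+ zero) → W (n ℕ.+ zero) ≼ E
        short n≤q up = ≼-trans (W-concave F≼H 0≼F zero n up)
          (≼-trans (extend n≤q) (≼-trans (W+Δ≼ zero (ι q ℚ.* δ)) (later zero (λ _ ()))))

        ahead : q ℕ.≤ n ⊎ n ℕ.≤ q → W n ≼ E
        ahead (inj₁ q≤n) = subst (λ n → Rising n → W n ≼ E) (ℕₚ.m+[n∸m]≡n q≤n) (long (n ℕ.∸ q)) up
        ahead (inj₂ n≤q) = subst (λ n → Rising n → W n ≼ E) (ℕₚ.+-identityʳ n) (short n≤q) up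

-- Sums

opaque
  ∑ : ∀ {A : Set} → List A → (A → ℝ) → ℝ
  ∑ []       G = 0ℝ
  ∑ (x ∷ xs) G = G x ⊕ ∑ xs G

  ∑-[] : ∀ {A : Set} (G : A → ℝ) → ∑ [] G ≡ 0ℝ
  ∑-[] G = refl

  ∑-∷ : ∀ {A : Set} x (xs : List A) (G : A → ℝ) → ∑ (x ∷ xs) G ≡ G x ⊕ ∑ xs G
  ∑-∷ x xs G = refl

∑-cong : ∀ {A : Set} {G K : A → ℝ} xs → G ≗ K → ∑ xs G ≡ ∑ xs K
∑-cong {G = G} {K} []       eq = ≡.trans (∑-[] G) (sym (∑-[] K))
∑-cong {G = G} {K} (x ∷ xs) eq = ≡.trans (∑-∷ x xs G) (≡.trans (cong₂ _⊕_ (eq x) (∑-cong xs eq)) (sym (∑-∷ x xs K)))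

∑-map : ∀ {A B : Set} (k : A → B) xs (G : B → ℝ) → ∑ (map k xs) G ≡ ∑ xs (G ∘ k)
∑-map k []       G = ≡.trans (∑-[] G) (sym (∑-[] (G ∘ k)))
∑-map k (x ∷ xs) G = ≡.trans (∑-∷ (k x) (map k xs) G)
  (≡.trans (cong (_⊕_ (G (k x))) (∑-map k xs G)) (sym (∑-∷ x xs (G ∘ k))))

module _ {A : Set} where
  open ≼-Reasoning
  open ℚ-Solver.+-*-Solver

  ∑-mono : ∀ {G K : A → ℝ} {xs} → All (λ x → G x ≼ K x) xs → ∑ xs G ≼ ∑ xs K
  ∑-mono {G} {K} {[]}     []       = ≡⇒≼ (≡.trans (∑-[] G) (sym (∑-[] K)))
  ∑-mono {G} {K} {x ∷ xs} (p ∷ ps) = begin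
    ∑ (x ∷ xs) G   ∼⟨ ≡⇒≼ (∑-∷ x xs G) ⟩
    G x ⊕ ∑ xs G   ∼⟨ +-mono-≼ p (∑-mono ps) ⟩
    K x ⊕ ∑ xs K   ∼⟨ ≡⇒≼ (sym (∑-∷ x xs K)) ⟩
    ∑ (x ∷ xs) K   ∎

  opaque
    unfolding _⊕_ _⊗_

    linear-[] : ∀ p q → fromℚ p ⊗ 0ℝ ⊕ fromℚ q ⊗ 0ℝ ≼ 0ℝ
    linear-[] p q = ≼-reflexive λ i → solve 2 (λ p q → p :* con 0ℚ :+ q :* con 0ℚ := con 0ℚ) refl p q

    linear-∷ : ∀ p q x u y v → fromℚ p ⊗ (x ⊕ u) ⊕ fromℚ q ⊗ (y ⊕ v) ≼
               (fromℚ p ⊗ x ⊕ fromℚ q ⊗ y) ⊕ (fromℚ p ⊗ u ⊕ fromℚ q ⊗ v)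
    linear-∷ p q x u y v = ≼-reflexive λ i →
      solve 6 (λ p q x u y v → p :* (x :+ u) :+ q :* (y :+ v) := (p :* x :+ q :* y) :+ (p :* u :+ q :* v))
        refl p q (seq x i) (seq u i) (seq y i) (seq v i)

  ∑-linear : ∀ p q (G K : A → ℝ) xs →
    fromℚ p ⊗ ∑ xs G ⊕ fromℚ q ⊗ ∑ xs K ≼ ∑ xs (λ x → fromℚ p ⊗ G x ⊕ fromℚ q ⊗ K x)
  ∑-linear p q G K [] = begin
    fromℚ p ⊗ ∑ [] G ⊕ fromℚ q ⊗ ∑ [] K
      ∼⟨ ≡⇒≼ (cong₂ (λ u v → fromℚ p ⊗ u ⊕ fromℚ q ⊗ v) (∑-[] G) (∑-[] K)) ⟩
    fromℚ p ⊗ 0ℝ ⊕ fromℚ q ⊗ 0ℝ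
      ∼⟨ linear-[] p q ⟩
    0ℝ
      ∼⟨ ≡⇒≼ (sym (∑-[] _)) ⟩
    ∑ [] (λ x → fromℚ p ⊗ G x ⊕ fromℚ q ⊗ K x) ∎
  ∑-linear p q G K (x ∷ xs) = begin
    fromℚ p ⊗ ∑ (x ∷ xs) G ⊕ fromℚ q ⊗ ∑ (x ∷ xs) K
      ∼⟨ ≡⇒≼ (cong₂ (λ u v → fromℚ p ⊗ u ⊕ fromℚ q ⊗ v) (∑-∷ x xs G) (∑-∷ x xs K)) ⟩
    fromℚ p ⊗ (G x ⊕ ∑ xs G) ⊕ fromℚ q ⊗ (K x ⊕ ∑ xs K)
      ∼⟨ linear-∷ p q (G x) (∑ xs G) (K x) (∑ xs K) ⟩
    (fromℚ p ⊗ G x ⊕ fromℚ q ⊗ K x) ⊕ (fromℚ p ⊗ ∑ xs G ⊕ fromℚ q ⊗ ∑ xs K)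
      ∼⟨ +-monoʳ-≼ (fromℚ p ⊗ G x ⊕ fromℚ q ⊗ K x) (∑-linear p q G K xs) ⟩
    (fromℚ p ⊗ G x ⊕ fromℚ q ⊗ K x) ⊕ ∑ xs (λ x → fromℚ p ⊗ G x ⊕ fromℚ q ⊗ K x)
      ∼⟨ ≡⇒≼ (sym (∑-∷ x xs (λ x → fromℚ p ⊗ G x ⊕ fromℚ q ⊗ K x))) ⟩
    ∑ (x ∷ xs) (λ x → fromℚ p ⊗ G x ⊕ fromℚ q ⊗ K x) ∎

-- Allocations

module _ {n m : ℕ} where

  infixr 6 _∪ᴬ_
  infixr 7 _∩ᴬ_

  _∪ᴬ_ _∩ᴬ_ : Allocation n m → Allocation n m → Allocation n m
  (A ∪ᴬ B) j = A j ∪ B j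
  (A ∩ᴬ B) j = A j ∩ B j

  ∅ᴬ : Allocation n m
  ∅ᴬ _ = ∅

  single : Maybe (Fin n) → Fin m → Allocation n m
  single o i = assign o i ∅ᴬ

  assign≗∪single : ∀ o i (S : Allocation n m) → assign o i S ≗ S ∪ᴬ single o i
  assign≗∪single nothing  i S j = sym (∪-identityʳ (S j))
  assign≗∪single (just k) i S j with j ≟ k
  ... | yes refl = ≡.trans (updateAt-updates j S)
        (cong (S j ∪_) (sym (≡.trans (updateAt-updates j ∅ᴬ) (∪-identityˡ ⁅ i ⁆))))
  ... | no j≢k = ≡.trans (updateAt-minimal j k S j≢k)
        (sym (≡.trans (cong (S j ∪_) (updateAt-minimal j k ∅ᴬ j≢k)) (∪-identityʳ (S j))))

  ∈single : ∀ o i j {z} → z ∈ single o i j → z ≡ i × o ≡ just j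
  ∈single nothing  i j z∈ = contradiction z∈ ∉⊥
  ∈single (just k) i j {z} z∈ with j ≟ k
  ... | no j≢k = contradiction (subst (z ∈_) (updateAt-minimal j k ∅ᴬ j≢k) z∈) ∉⊥
  ... | yes refl with x∈p∪q⁻ ∅ ⁅ i ⁆ (subst (z ∈_) (updateAt-updates j ∅ᴬ) z∈)
  ...   | inj₁ z∈∅ = contradiction z∈∅ ∉⊥
  ...   | inj₂ z∈i = x∈⁅y⁆⇒x≡y i z∈i , refl

  single-disjoint : ∀ o i o′ i′ → (i ≢ i′ ⊎ o ≢ o′) → single o i ∩ᴬ single o′ i′ ≗ ∅ᴬ
  single-disjoint o i o′ i′ apart j = Empty-unique λ (z , z∈) →
    let l , r = x∈p∩q⁻ (single o i j) (single o′ i′ j) z∈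
        z≡i , o≡j = ∈single o i j l
        z≡i′ , o′≡j = ∈single o′ i′ j r
    in separate apart (≡.trans (sym z≡i) z≡i′) (≡.trans o≡j (sym o′≡j))
    where
    separate : i ≢ i′ ⊎ o ≢ o′ → i ≡ i′ → o ≡ o′ → _
    separate (inj₁ i≢i′) eq _ = i≢i′ eq
    separate (inj₂ o≢o′) _ eq = o≢o′ eq

  -- The reference allocation restricted to the remaining items. Given as a map from items to
  -- bidders, it is disjoint by construction, and dropping an item changes it at one argument.
  targets : (Fin m → Maybe (Fin n)) → List (Fin m) → Allocation n m
  targets ρ []       = ∅ᴬ
  targets ρ (x ∷ xs) = single (ρ x) x ∪ᴬ targets ρ xs

  targets-disjoint : ∀ ρ o {y xs} → All (y ≢_) xs → targets ρ xs ∩ᴬ single o y ≗ ∅ᴬ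
  targets-disjoint ρ o {y} {[]}     []          j = Empty-unique λ (z , z∈) →
    ∉⊥ (proj₁ (x∈p∩q⁻ ∅ (single o y j) z∈))
  targets-disjoint ρ o {y} {x ∷ xs} (y≢x ∷ y∉xs) j = Empty-unique λ (z , z∈) →
    let l , r = x∈p∩q⁻ (single (ρ x) x j ∪ targets ρ xs j) (single o y j) z∈
    in [ (λ z∈ → separate y≢x (∈single (ρ x) x j z∈) (∈single o y j r)) , (λ z∈ → ∉⊥ (subst (z ∈_) (targets-disjoint ρ o y∉xs j) (x∈p∩q⁺ (z∈ , r)))) ]′ (x∈p∪q⁻ (single (ρ x) x j) (targets ρ xs j) l)
    where
    separate : ∀ {z} → y ≢ x → z ≡ x × ρ x ≡ just j → z ≡ y × o ≡ just j → _
    separate y≢x (z≡x , _) (z≡y , _) = y≢x (≡.trans (sym z≡y) z≡x)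

  targets-cong : ∀ {ρ ρ′ xs} → All (λ x → ρ x ≡ ρ′ x) xs → targets ρ xs ≡ targets ρ′ xs
  targets-cong []                          = refl
  targets-cong {xs = x ∷ xs} (eq ∷ eqs) = cong₂ (λ o T → single o x ∪ᴬ T) eq (targets-cong eqs)

  targets-↭ : ∀ ρ {xs ys} → xs ↭ ys → targets ρ xs ≗ targets ρ ys
  targets-↭ ρ refl                j = refl
  targets-↭ ρ (prep x xs↭ys)      j = cong (single (ρ x) x j ∪_) (targets-↭ ρ xs↭ys j)
  targets-↭ ρ {_ ∷ _ ∷ xs} {_ ∷ _ ∷ ys} (swap x y xs↭ys) j = ≡.trans
    (cong (λ T → single (ρ x) x j ∪ (single (ρ y) y j ∪ T)) (targets-↭ ρ xs↭ys j))
    (∪S.solve 3 (λ a b c → a ∪S.⊕ (b ∪S.⊕ c) ∪S.⊜ b ∪S.⊕ (a ∪S.⊕ c)) refl (single (ρ x) x j) (single (ρ y) y j) (targets ρ ys j))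
    where module ∪S = ∪-Solver (∪-idempotentCommutativeMonoid m)
  targets-↭ ρ (trans xs↭ys ys↭zs) j = ≡.trans (targets-↭ ρ xs↭ys j) (targets-↭ ρ ys↭zs j)

-- Submodular functions on allocations

picks-↭ : ∀ {A : Set} {k} (xs : Vec A (suc k)) → All (λ p → toList xs ↭ proj₁ p ∷ toList (proj₂ p)) (picks xs)
picks-↭ {k = zero}  (x ∷ []) = refl ∷ []
picks-↭ {k = suc k} (x ∷ xs) =
  refl ∷ Allₚ.map⁺ (All.map (λ {p} xs↭ → trans (prep x xs↭) (swap x (proj₁ p) refl)) (picks-↭ xs))

length-picks : ∀ {A : Set} {k} (xs : Vec A (suc k)) → length (picks xs) ≡ suc k
length-picks {k = zero}  (x ∷ []) = refl
length-picks {k = suc k} (x ∷ xs) = cong suc (≡.trans (Listₚ.length-map _ (picks xs)) (length-picks xs))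

module _ where
  open ℚ-Solver.+-*-Solver

  opaque
    unfolding _⊕_ _⊖_ _⊗_

    telescope-[] : ∀ x y → fromℚ (ι 0) ⊗ x ⊕ y ≼ y ⊕ 0ℝ
    telescope-[] x y = ≼-reflexive λ i →
      solve 2 (λ x y → con 0ℚ :* x :+ y := y :+ con 0ℚ) refl (seq x i) (seq y i)

    telescope-∷ : ∀ k {x t u e s} → t ⊕ x ≼ u ⊕ e → fromℚ (ι k) ⊗ x ⊕ u ≼ s → fromℚ (ι (suc k)) ⊗ x ⊕ t ≼ e ⊕ s
    telescope-∷ k {x} {t} {u} {e} {s} p q = ≼-by (0≼+ (≼⇒0≼- p) (≼⇒0≼- q)) λ i → ≡.trans
      (solve 6 (λ κ x t u e s → e :+ s := (con 1ℚ :+ κ) :* x :+ t :+ (((u :+ e) :- (t :+ x)) :+ (s :- (κ :* x :+ u))))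
        refl (ι k) (seq x i) (seq t i) (seq u i) (seq e i) (seq s i))
      (cong (λ r → r ℚ.* seq x i ℚ.+ seq t i ℚ.+ (((seq u i ℚ.+ seq e i) ℚ.- (seq t i ℚ.+ seq x i)) ℚ.+ (seq s i ℚ.- (ι k ℚ.* seq x i ℚ.+ seq u i))))
        (sym (ι-suc k)))

    ≼-⊕-comm : ∀ x y → x ⊕ y ≼ y ⊕ x
    ≼-⊕-comm x y = ≼-reflexive λ i → ℚₚ.+-comm (seq x i) (seq y i)

    const-[] : ∀ x → 0ℝ ≼ fromℚ (ι 0) ⊗ x
    const-[] x = ≼-reflexive λ i → sym (ℚₚ.*-zeroˡ (seq x i))

    const-[]′ : ∀ x → fromℚ (ι 0) ⊗ x ≼ 0ℝ
    const-[]′ x = ≼-reflexive λ i → ℚₚ.*-zeroˡ (seq x i)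

    const-∷ : ∀ k x → x ⊕ fromℚ (ι k) ⊗ x ≼ fromℚ (ι (suc k)) ⊗ x
    const-∷ k x = ≼-reflexive λ i → ≡.trans
      (solve 2 (λ κ x → x :+ κ :* x := (con 1ℚ :+ κ) :* x) refl (ι k) (seq x i)) (cong (ℚ._* seq x i) (sym (ι-suc k)))

    const-∷′ : ∀ k x → fromℚ (ι (suc k)) ⊗ x ≼ x ⊕ fromℚ (ι k) ⊗ x
    const-∷′ k x = ≼-reflexive λ i → ≡.trans (cong (ℚ._* seq x i) (ι-suc k))
      (solve 2 (λ κ x → (con 1ℚ :+ κ) :* x := x :+ κ :* x) refl (ι k) (seq x i))

    +-subtract : ∀ {x y z w} → x ⊕ y ≼ z ⊕ w →
                 fromℚ 1ℚ ⊗ x ⊕ fromℚ 1ℚ ⊗ (fromℚ 1ℚ ⊗ y ⊕ fromℚ (ℚ.- 1ℚ) ⊗ w) ≼ z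
    +-subtract {x} {y} {z} {w} p = ≼-by (≼⇒0≼- p) λ i →
      solve 4 (λ x y z w → z := con 1ℚ :* x :+ con 1ℚ :* (con 1ℚ :* y :+ con (ℚ.- 1ℚ) :* w) :+ ((z :+ w) :- (x :+ y)))
        refl (seq x i) (seq y i) (seq z i) (seq w i)

    +-assemble : ∀ k {x s t sz sc sx sh} → fromℚ (ι k) ⊗ x ⊕ s ≼ sz → fromℚ (ι k) ⊗ x ⊕ t ≼ sc → 0ℝ ≼ t →
      sx ≼ fromℚ (ι (suc k)) ⊗ x →
      fromℚ 1ℚ ⊗ sz ⊕ fromℚ 1ℚ ⊗ (fromℚ 1ℚ ⊗ sc ⊕ fromℚ (ℚ.- 1ℚ) ⊗ sx) ≼ sh →
      fromℚ (ι k) ⊗ x ⊕ s ≼ sh ⊕ x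
    +-assemble k {x} {s} {t} {sz} {sc} {sx} {sh} p q 0≼t c h =
      ≼-by (0≼+ (0≼+ (0≼+ (≼⇒0≼- p) (≼⇒0≼- q)) 0≼t) (0≼+ (≼⇒0≼- c) (≼⇒0≼- h))) λ i → ≡.trans
        (solve 8 (λ κ x s t sz sc sx sh → sh :+ x := κ :* x :+ s :+
            (((sz :- (κ :* x :+ s)) :+ (sc :- (κ :* x :+ t)) :+ t) :+
            (((con 1ℚ :+ κ) :* x :- sx) :+ (sh :- (con 1ℚ :* sz :+ con 1ℚ :* (con 1ℚ :* sc :+ con (ℚ.- 1ℚ) :* sx))))))
          refl (ι k) (seq x i) (seq s i) (seq t i) (seq sz i) (seq sc i) (seq sx i) (seq sh i))
        (cong (λ r → ι k ℚ.* seq x i ℚ.+ seq s i ℚ.+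
            (((seq sz i ℚ.- (ι k ℚ.* seq x i ℚ.+ seq s i)) ℚ.+ (seq sc i ℚ.- (ι k ℚ.* seq x i ℚ.+ seq t i)) ℚ.+ seq t i) ℚ.+
            ((r ℚ.* seq x i ℚ.- seq sx i) ℚ.+ (seq sh i ℚ.- (1ℚ ℚ.* seq sz i ℚ.+ 1ℚ ℚ.* (1ℚ ℚ.* seq sc i ℚ.+ (ℚ.- 1ℚ) ℚ.* seq sx i))))))
          (sym (ι-suc k)))

    average-advance : ∀ k c {p q F H sF sH} → 0ℚ ℚ.≤ c → 0ℚ ℚ.≤ p → 0ℚ ℚ.≤ q → ι (suc k) ℚ.* c ≡ 1ℚ →
      fromℚ (ι k) ⊗ F ⊕ H ≼ sF → fromℚ (ι k) ⊗ H ⊕ F ≼ sH ⊕ H →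
      fromℚ p ⊗ (F ⊕ fromℚ c ⊗ (H ⊖ F)) ⊕ fromℚ q ⊗ (H ⊕ fromℚ c ⊗ (F ⊖ (H ⊕ H))) ≼
      fromℚ c ⊗ (fromℚ p ⊗ sF ⊕ fromℚ q ⊗ sH)
    average-advance k c {p} {q} {F} {H} {sF} {sH} 0≤c 0≤p 0≤q rc≡1 hF hH =
      ≼-by (0≼* (fromℚ-mono 0≤c) (0≼+ (0≼* (fromℚ-mono 0≤p) (≼⇒0≼- hF)) (0≼* (fromℚ-mono 0≤q) (≼⇒0≼- hH)))) λ i → ≡.trans
        (solve 8 (λ κ c p q F H sF sH → c :* (p :* sF :+ q :* sH) :=
            -- The solver cannot use that (k + 1) c = 1, so the discrepancy appears as a multiple of
            -- (k + 1) c - 1, removed by `vanish`.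
            p :* (F :+ c :* (H :- F)) :+ q :* (H :+ c :* (F :- (H :+ H))) :+
            c :* (p :* (sF :- (κ :* F :+ H)) :+ q :* ((sH :+ H) :- (κ :* H :+ F))) :+
            ((con 1ℚ :+ κ) :* c :- con 1ℚ) :* (p :* F :+ q :* H))
          refl (ι k) c p q (seq F i) (seq H i) (seq sF i) (seq sH i))
        (vanish _ (p ℚ.* seq F i ℚ.+ q ℚ.* seq H i) (≡.trans (cong (ℚ._* c) (sym (ι-suc k))) rc≡1))
      where
      vanish : ∀ y {r} z → r ≡ 1ℚ → y ℚ.+ (r ℚ.- 1ℚ) ℚ.* z ≡ y
      vanish y z refl = ≡.trans (cong (y ℚ.+_) (ℚₚ.*-zeroˡ z)) (ℚₚ.+-identityʳ y)

module _ {A : Set} (x : ℝ) where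
  open ≼-Reasoning

  ∑-const : ∀ (xs : List A) → ∑ xs (λ _ → x) ≼ fromℚ (ι (length xs)) ⊗ x
  ∑-const []       = ≼-trans (≡⇒≼ (∑-[] _)) (const-[] x)
  ∑-const (y ∷ ys) = ≼-trans (≡⇒≼ (∑-∷ y ys _)) (≼-trans (+-monoʳ-≼ x (∑-const ys)) (const-∷ (length ys) x))

  ∑-const′ : ∀ (xs : List A) → fromℚ (ι (length xs)) ⊗ x ≼ ∑ xs (λ _ → x)
  ∑-const′ []       = ≼-trans (const-[]′ x) (≡⇒≼ (sym (∑-[] _)))
  ∑-const′ (y ∷ ys) = ≼-trans (const-∷′ (length ys) x) (≼-trans (+-monoʳ-≼ x (∑-const′ ys)) (≡⇒≼ (sym (∑-∷ y ys _))))

∑-picks-[] : ∀ {A : Set} (x : A) (G : A × Vec A 0 → ℝ) → ∑ (picks (x ∷ [])) G ≡ G (x , []) ⊕ 0ℝ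
∑-picks-[] x G = ≡.trans (∑-∷ (x , []) [] G) (cong (G (x , []) ⊕_) (∑-[] G))

∑-picks-∷ : ∀ {A : Set} {k} x (xs : Vec A (suc k)) (G : A × Vec A (suc k) → ℝ) →
            ∑ (picks (x ∷ xs)) G ≡ G (x , xs) ⊕ ∑ (picks xs) (λ p → G (proj₁ p , x ∷ proj₂ p))
∑-picks-∷ x xs G = ≡.trans (∑-∷ (x , xs) _ G) (cong (G (x , xs) ⊕_) (∑-map _ (picks xs) G))

-- Serves to assume that no target is worth dropping. The finitely many comparisons are undecidable,
-- but `≼-cases` grants them one by one, the goal being an inequality.
All-≼-cases : ∀ {A : Set} {u v} (L R : A → ℝ) {xs} → All (λ x → L x ≼ R x ⊎ (R x ≼ L x → u ≼ v)) xs →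
              (All (λ x → L x ≼ R x) xs → u ≼ v) → u ≼ v
All-≼-cases L R []                   k = k []
All-≼-cases L R (inj₁ L≼R ∷ cs)      k = All-≼-cases L R cs λ ps → k (L≼R ∷ ps)
All-≼-cases L R {x ∷ _} (inj₂ r ∷ cs) k = ≼-cases (L x) (R x) (λ L≼R → All-≼-cases L R cs λ ps → k (L≼R ∷ ps)) r

-- The bidders are merged into a single function: `g` stands for the total welfare, which is
-- submodular on the lattice of n-tuples of sets.
module Submod {n m : ℕ} (g : Allocation n m → ℝ)
  (g-cong : ∀ {A B} → A ≗ B → g A ≡ g B)
  (0≼g : ∀ A → 0ℝ ≼ g A)
  (g-submodular : ∀ A B → g (A ∪ᴬ B) ⊕ g (A ∩ᴬ B) ≼ g A ⊕ g B) where

  open ≼-Reasoning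
  private module ∪S = ∪-Solver (∪-idempotentCommutativeMonoid m)
  open ∪S using () renaming (_⊕_ to _⊍_; _⊜_ to _≐_; solve to ∪-solve)

  -- Submodularity at A ∪ B and A ∪ E, whose intersection is A since B and E do not meet.
  diminishing : ∀ A E B → B ∩ᴬ E ≗ ∅ᴬ → g (A ∪ᴬ E ∪ᴬ B) ⊕ g A ≼ g (A ∪ᴬ B) ⊕ g (A ∪ᴬ E)
  diminishing A E B disjoint = begin
    g (A ∪ᴬ E ∪ᴬ B) ⊕ g A
      ∼⟨ ≡⇒≼ (cong₂ _⊕_ (g-cong λ j → ∪-solve 3 (λ a e b → a ⊍ (e ⊍ b) ≐ (a ⊍ b) ⊍ (a ⊍ e)) refl (A j) (E j) (B j))
                        (g-cong λ j → ≡.trans (≡.trans (sym (∪-identityʳ (A j))) (cong (A j ∪_) (sym (disjoint j))))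
                                              (∪-distribˡ-∩ (A j) (B j) (E j)))) ⟩
    g ((A ∪ᴬ B) ∪ᴬ (A ∪ᴬ E)) ⊕ g ((A ∪ᴬ B) ∩ᴬ (A ∪ᴬ E))
      ∼⟨ g-submodular (A ∪ᴬ B) (A ∪ᴬ E) ⟩
    g (A ∪ᴬ B) ⊕ g (A ∪ᴬ E) ∎

  -- By `diminishing`, an item gains at least as much on `S` alone as on top of other items, and the
  -- latter gains telescope. Of the k + 1 copies of `g S` that the single gains subtract, one
  -- cancels against the joint gain.
  gains : ∀ S ρ {k} (xs : Vec (Fin m) (suc k)) → Unique (toList xs) →
          fromℚ (ι k) ⊗ g S ⊕ g (S ∪ᴬ targets ρ (toList xs)) ≼
          ∑ (picks xs) (λ p → g (S ∪ᴬ single (ρ (proj₁ p)) (proj₁ p)))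
  gains S ρ {zero} (x ∷ []) _ = begin
    fromℚ (ι 0) ⊗ g S ⊕ g (S ∪ᴬ single (ρ x) x ∪ᴬ ∅ᴬ)
      ∼⟨ ≡⇒≼ (cong (fromℚ (ι 0) ⊗ g S ⊕_) (g-cong λ j → cong (S j ∪_) (∪-identityʳ _))) ⟩
    fromℚ (ι 0) ⊗ g S ⊕ g (S ∪ᴬ single (ρ x) x)
      ∼⟨ telescope-[] (g S) (g (S ∪ᴬ single (ρ x) x)) ⟩
    g (S ∪ᴬ single (ρ x) x) ⊕ 0ℝ
      ∼⟨ ≡⇒≼ (sym (∑-picks-[] x _)) ⟩
    ∑ (picks (x ∷ [])) (λ p → g (S ∪ᴬ single (ρ (proj₁ p)) (proj₁ p))) ∎
  gains S ρ {suc k} (x ∷ xs) (x∉xs ∷ uniq) = begin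
    fromℚ (ι (suc k)) ⊗ g S ⊕ g (S ∪ᴬ single (ρ x) x ∪ᴬ targets ρ (toList xs))
      ∼⟨ telescope-∷ k (diminishing S (single (ρ x) x) (targets ρ (toList xs)) (targets-disjoint ρ (ρ x) x∉xs)) (gains S ρ xs uniq) ⟩
    g (S ∪ᴬ single (ρ x) x) ⊕ ∑ (picks xs) (λ p → g (S ∪ᴬ single (ρ (proj₁ p)) (proj₁ p)))
      ∼⟨ ≡⇒≼ (sym (∑-picks-∷ x xs _)) ⟩
    ∑ (picks (x ∷ xs)) (λ p → g (S ∪ᴬ single (ρ (proj₁ p)) (proj₁ p))) ∎

  -- Dual to `gains`: what is lost when an item leaves the full set is at most what it gains on a
  -- smaller one, and these gains telescope. The induction moves the head into the base `S`, so that
  -- the full set stays the same.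
  losses : ∀ S ρ {k} (xs : Vec (Fin m) (suc k)) → Unique (toList xs) →
           fromℚ (ι k) ⊗ g (S ∪ᴬ targets ρ (toList xs)) ⊕ g S ≼
           ∑ (picks xs) (λ p → g (S ∪ᴬ targets ρ (toList (proj₂ p))))
  losses S ρ {zero} (x ∷ []) _ = begin
    fromℚ (ι 0) ⊗ g (S ∪ᴬ single (ρ x) x ∪ᴬ ∅ᴬ) ⊕ g S
      ∼⟨ telescope-[] _ (g S) ⟩
    g S ⊕ 0ℝ
      ∼⟨ ≡⇒≼ (cong (_⊕ 0ℝ) (g-cong λ j → sym (∪-identityʳ (S j)))) ⟩
    g (S ∪ᴬ ∅ᴬ) ⊕ 0ℝ
      ∼⟨ ≡⇒≼ (sym (∑-picks-[] x _)) ⟩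
    ∑ (picks (x ∷ [])) (λ p → g (S ∪ᴬ targets ρ (toList (proj₂ p)))) ∎
  losses S ρ {suc k} (x ∷ xs) (x∉xs ∷ uniq) = begin
    fromℚ (ι (suc k)) ⊗ g X ⊕ g S
      ∼⟨ telescope-∷ k (begin
           g S ⊕ g X                      ∼⟨ ≼-⊕-comm (g S) (g X) ⟩
           g X ⊕ g S                      ∼⟨ diminishing S E T (targets-disjoint ρ (ρ x) x∉xs) ⟩
           g (S ∪ᴬ T) ⊕ g (S ∪ᴬ E)        ∼⟨ ≼-⊕-comm (g (S ∪ᴬ T)) (g (S ∪ᴬ E)) ⟩
           g (S ∪ᴬ E) ⊕ g (S ∪ᴬ T)        ∎)
         (begin
           fromℚ (ι k) ⊗ g X ⊕ g (S ∪ᴬ E)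
             ∼⟨ ≡⇒≼ (cong (λ x → fromℚ (ι k) ⊗ x ⊕ g (S ∪ᴬ E)) (g-cong λ j → assoc (S j) (E j) (T j))) ⟩
           fromℚ (ι k) ⊗ g ((S ∪ᴬ E) ∪ᴬ T) ⊕ g (S ∪ᴬ E)
             ∼⟨ losses (S ∪ᴬ E) ρ xs uniq ⟩
           ∑ (picks xs) (λ p → g ((S ∪ᴬ E) ∪ᴬ targets ρ (toList (proj₂ p))))
             ∼⟨ ∑-mono (All.universal (λ p → ≡⇒≼ (g-cong λ j → sym (assoc (S j) (E j) _))) (picks xs)) ⟩
           ∑ (picks xs) (λ p → g (S ∪ᴬ E ∪ᴬ targets ρ (toList (proj₂ p)))) ∎) ⟩
    g (S ∪ᴬ T) ⊕ ∑ (picks xs) (λ p → g (S ∪ᴬ E ∪ᴬ targets ρ (toList (proj₂ p))))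
      ∼⟨ ≡⇒≼ (sym (∑-picks-∷ x xs _)) ⟩
    ∑ (picks (x ∷ xs)) (λ p → g (S ∪ᴬ targets ρ (toList (proj₂ p)))) ∎
    where
    E = single (ρ x) x
    T = targets ρ (toList xs)
    X = S ∪ᴬ E ∪ᴬ T
    assoc : ∀ a b c → a ∪ (b ∪ c) ≡ (a ∪ b) ∪ c
    assoc = ∪-solve 3 (λ a b c → a ⊍ (b ⊍ c) ≐ (a ⊍ b) ⊍ c) refl

  -- Two different bidders give disjoint additions, to which `diminishing` applies. If the bidders
  -- agree, the additions coincide and all rests on the hypothesis that the item pays.
  exchange : ∀ Z o o′ y → g Z ≼ g (Z ∪ᴬ single o y) →
             g Z ⊕ g ((Z ∪ᴬ single o y) ∪ᴬ single o′ y) ≼ g (Z ∪ᴬ single o′ y) ⊕ g (Z ∪ᴬ single o y)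
  exchange Z o o′ y Z≼ with Maybeₚ.≡-dec _≟_ o o′
  ... | yes refl = begin
    g Z ⊕ g ((Z ∪ᴬ single o y) ∪ᴬ single o y)
      ∼⟨ ≡⇒≼ (cong (g Z ⊕_) (g-cong λ j → ∪-solve 2 (λ z e → (z ⊍ e) ⊍ e ≐ z ⊍ e) refl (Z j) (single o y j))) ⟩
    g Z ⊕ g (Z ∪ᴬ single o y)
      ∼⟨ +-monoˡ-≼ (g (Z ∪ᴬ single o y)) Z≼ ⟩
    g (Z ∪ᴬ single o y) ⊕ g (Z ∪ᴬ single o y) ∎
  ... | no o≢o′ = begin
    g Z ⊕ g ((Z ∪ᴬ single o y) ∪ᴬ single o′ y)
      ∼⟨ ≡⇒≼ (cong (g Z ⊕_) (g-cong λ j → ∪-solve 3 (λ z e c → (z ⊍ e) ⊍ c ≐ z ⊍ (e ⊍ c)) refl (Z j) (single o y j) (single o′ y j))) ⟩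
    g Z ⊕ g (Z ∪ᴬ single o y ∪ᴬ single o′ y)
      ∼⟨ ≼-⊕-comm (g Z) _ ⟩
    g (Z ∪ᴬ single o y ∪ᴬ single o′ y) ⊕ g Z
      ∼⟨ diminishing Z (single o y) (single o′ y) (single-disjoint o′ y o y (inj₂ (o≢o′ ∘ sym))) ⟩
    g (Z ∪ᴬ single o′ y) ⊕ g (Z ∪ᴬ single o y) ∎

  -- A step that assigns every arriving item by c destroys at most the whole value of X
  -- through the items it adds, and at most g X − g S through the targets it uses up.
  drift : ∀ S ρ c {k} (xs : Vec (Fin m) (suc k)) → Unique (toList xs) →
    All (λ p → g (S ∪ᴬ targets ρ (toList (proj₂ p))) ≼ g (S ∪ᴬ targets ρ (toList xs))) (picks xs) →
    fromℚ (ι k) ⊗ g (S ∪ᴬ targets ρ (toList xs)) ⊕ g S ≼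
    ∑ (picks xs) (λ p → g ((S ∪ᴬ targets ρ (toList (proj₂ p))) ∪ᴬ single (c (proj₁ p)) (proj₁ p))) ⊕ g (S ∪ᴬ targets ρ (toList xs))
  drift S ρ c {k} xs uniq maximal =
    -- The value of X joined with all choices at once is bounded below by 0, as `g` need not be
    -- monotone. This costs one full `g X`; together with the `g X` lost through `losses` it gives
    -- the coefficient 2 in H′ = F - 2H.
    +-assemble k (losses S ρ xs uniq) (gains X c xs uniq) (0≼g _)
      (≼-trans (∑-const (g X) (picks xs)) (≡⇒≼ (cong (λ r → fromℚ (ι r) ⊗ g X) (length-picks xs))))
      (begin
        fromℚ 1ℚ ⊗ ∑ ps (λ p → g (Z p)) ⊕ fromℚ 1ℚ ⊗ (fromℚ 1ℚ ⊗ ∑ ps (λ p → g (X ∪ᴬ C p)) ⊕ fromℚ (ℚ.- 1ℚ) ⊗ ∑ ps (λ _ → g X))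
          ∼⟨ +-monoʳ-≼ _ (*-monoˡ-≼ (fromℚ-mono (ℚₚ.<⇒≤ 0<1)) (∑-linear 1ℚ (ℚ.- 1ℚ) (λ p → g (X ∪ᴬ C p)) (λ _ → g X) ps)) ⟩
        fromℚ 1ℚ ⊗ ∑ ps (λ p → g (Z p)) ⊕ fromℚ 1ℚ ⊗ ∑ ps (λ p → fromℚ 1ℚ ⊗ g (X ∪ᴬ C p) ⊕ fromℚ (ℚ.- 1ℚ) ⊗ g X)
          ∼⟨ ∑-linear 1ℚ 1ℚ _ _ ps ⟩
        ∑ ps (λ p → fromℚ 1ℚ ⊗ g (Z p) ⊕ fromℚ 1ℚ ⊗ (fromℚ 1ℚ ⊗ g (X ∪ᴬ C p) ⊕ fromℚ (ℚ.- 1ℚ) ⊗ g X))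
          ∼⟨ ∑-mono (All.zipWith (λ (xs↭ , Z≼X) → swapped xs↭ Z≼X) (picks-↭ xs , maximal)) ⟩
        ∑ ps (λ p → g (Z p ∪ᴬ C p)) ∎)
    where
    ps = picks xs
    X = S ∪ᴬ targets ρ (toList xs)
    Z C : Fin m × Vec (Fin m) k → Allocation n m
    Z p = S ∪ᴬ targets ρ (toList (proj₂ p))
    C p = single (c (proj₁ p)) (proj₁ p)
    swapped : ∀ {p} → toList xs ↭ proj₁ p ∷ toList (proj₂ p) → g (Z p) ≼ g X →
              fromℚ 1ℚ ⊗ g (Z p) ⊕ fromℚ 1ℚ ⊗ (fromℚ 1ℚ ⊗ g (X ∪ᴬ C p) ⊕ fromℚ (ℚ.- 1ℚ) ⊗ g X) ≼ g (Z p ∪ᴬ C p)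
    swapped {p} xs↭ Z≼X = +-subtract (begin
      g (Z p) ⊕ g (X ∪ᴬ C p)
        ∼⟨ ≡⇒≼ (cong (g (Z p) ⊕_) (g-cong λ j → cong (_∪ C p j) (X≗ j))) ⟩
      g (Z p) ⊕ g ((Z p ∪ᴬ single (ρ y) y) ∪ᴬ C p)
        ∼⟨ exchange (Z p) (ρ y) (c y) y (≼-trans Z≼X (≡⇒≼ (g-cong X≗))) ⟩
      g (Z p ∪ᴬ C p) ⊕ g (Z p ∪ᴬ single (ρ y) y)
        ∼⟨ ≡⇒≼ (cong (g (Z p ∪ᴬ C p) ⊕_) (g-cong λ j → sym (X≗ j))) ⟩
      g (Z p ∪ᴬ C p) ⊕ g X ∎)
      where
      y = proj₁ p
      X≗ : X ≗ Z p ∪ᴬ single (ρ y) y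
      X≗ j = ≡.trans (cong (S j ∪_) (targets-↭ ρ xs↭ j))
        (∪-solve 3 (λ s e t → s ⊍ (e ⊍ t) ≐ (s ⊍ t) ⊍ e) refl (S j) (single (ρ y) y j) (targets ρ (toList (proj₂ p)) j))

-- The greedy process

-- Greedy choices are guaranteed only after histories without repetition, so the recursion over
-- arrival orders has to preserve this.
record Fresh {A : Set} (h xs : List A) : Set where
  field
    h-unique  : Unique h
    xs-unique : Unique xs
    apart     : All (λ y → All (y ≢_) h) xs

fresh-pick : ∀ {A : Set} {h xs ys : List A} {y} → Fresh h xs → xs ↭ y ∷ ys →
             Unique (y ∷ h) × All (y ≢_) ys × Fresh (y ∷ h) ys
fresh-pick {A} fresh xs↭
  with ↭ₛ.Unique-resp-↭ (≡.setoid A) (↭⇒↭ₛ xs↭) (Fresh.xs-unique fresh) | All-resp-↭ xs↭ (Fresh.apart fresh)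
... | y∉ys ∷ ys-unique | y∉h ∷ ys∉h = y∉h ∷ Fresh.h-unique fresh , y∉ys , record
  { h-unique  = y∉h ∷ Fresh.h-unique fresh
  ; xs-unique = ys-unique
  ; apart     = All.zipWith (λ (y≢z , z∉h) → (y≢z ∘ sym) ∷ z∉h) (y∉ys , ys∉h) }

cost : ∀ {A : Set} → Maybe A → ℕ
cost nothing  = 0
cost (just _) = 1

module _ {n m : ℕ} where

  size : (Fin m → Maybe (Fin n)) → List (Fin m) → ℕ
  size ρ []       = 0
  size ρ (x ∷ xs) = cost (ρ x) ℕ.+ size ρ xs

  size-cong : ∀ {ρ ρ′ xs} → All (λ x → ρ x ≡ ρ′ x) xs → size ρ xs ≡ size ρ′ xs
  size-cong []         = refl
  size-cong (eq ∷ eqs) = cong₂ (λ o s → cost o ℕ.+ s) eq (size-cong eqs)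

  size-↭ : ∀ ρ {xs ys} → xs ↭ ys → size ρ xs ≡ size ρ ys
  size-↭ ρ refl          = refl
  size-↭ ρ (prep x p)    = cong (cost (ρ x) ℕ.+_) (size-↭ ρ p)
  size-↭ ρ {_ ∷ _ ∷ xs} {_ ∷ _ ∷ ys} (swap x y p) = ≡.trans (sym (ℕₚ.+-assoc (cost (ρ x)) (cost (ρ y)) (size ρ xs)))
    (≡.trans (cong₂ ℕ._+_ (ℕₚ.+-comm (cost (ρ x)) (cost (ρ y))) (size-↭ ρ p)) (ℕₚ.+-assoc (cost (ρ y)) (cost (ρ x)) (size ρ ys)))
  size-↭ ρ (trans p q)   = ≡.trans (size-↭ ρ p) (size-↭ ρ q)

  drop-target : Fin m → (Fin m → Maybe (Fin n)) → Fin m → Maybe (Fin n)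
  drop-target y ρ z with y ≟ z
  ... | yes _ = nothing
  ... | no  _ = ρ z

  drop-target-here : ∀ y ρ → drop-target y ρ y ≡ nothing
  drop-target-here y ρ with y ≟ y
  ... | yes _  = refl
  ... | no y≢y = contradiction refl y≢y

  drop-target-there : ∀ y ρ {z} → y ≢ z → drop-target y ρ z ≡ ρ z
  drop-target-there y ρ {z} y≢z with y ≟ z
  ... | yes y≡z = contradiction y≡z y≢z
  ... | no  _   = refl

opaque
  unfolding _⊗_

  undo-average : ∀ k c x → ι (suc k) ℚ.* c ≡ 1ℚ → x ≼ fromℚ c ⊗ (fromℚ (ι (suc k)) ⊗ x)
  undo-average k c x rc≡1 = ≼-reflexive λ i → ≡.trans (sym (ℚₚ.*-identityˡ (seq x i)))
    (≡.trans (cong (ℚ._* seq x i) (sym (≡.trans (ℚₚ.*-comm c (ι (suc k))) rc≡1))) (ℚₚ.*-assoc c (ι (suc k)) (seq x i)))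

opaque
  unfolding _⊕_ _⊗_

  ≼-⊕-identityʳ : ∀ x → x ≼ x ⊕ 0ℝ
  ≼-⊕-identityʳ x = ≼-reflexive λ i → sym (ℚₚ.+-identityʳ (seq x i))

  ≼-⊕-identityˡ : ∀ x → 0ℝ ⊕ x ≼ x
  ≼-⊕-identityˡ x = ≼-reflexive λ i → ℚₚ.+-identityˡ (seq x i)

  ≼-⊕-assoc : ∀ x y z → (x ⊕ y) ⊕ z ≼ x ⊕ (y ⊕ z)
  ≼-⊕-assoc x y z = ≼-reflexive λ i → ℚₚ.+-assoc (seq x i) (seq y i) (seq z i)

  ≼-⊗-identity : ∀ x → x ≼ fromℚ 1ℚ ⊗ x
  ≼-⊗-identity x = ≼-reflexive λ i → sym (ℚₚ.*-identityˡ (seq x i))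

  ≼-⊗-assoc : ∀ p q x → fromℚ p ⊗ (fromℚ q ⊗ x) ≼ fromℚ (p ℚ.* q) ⊗ x
  ≼-⊗-assoc p q x = ≼-reflexive λ i → sym (ℚₚ.*-assoc p q (seq x i))

  ≼-⊗-zero : ∀ p → 0ℝ ≼ fromℚ p ⊗ 0ℝ
  ≼-⊗-zero p = ≼-reflexive λ i → sym (ℚₚ.*-zeroʳ p)

  ≼-⊗-distrib : ∀ p x y → fromℚ p ⊗ x ⊕ fromℚ p ⊗ y ≼ fromℚ p ⊗ (x ⊕ y)
  ≼-⊗-distrib p x y = ≼-reflexive λ i → sym (ℚₚ.*-distribˡ-+ p (seq x i) (seq y i))

module _ {A : Set} where
  open ≼-Reasoning

  ∑-scale : ∀ p (G : A → ℝ) xs → ∑ xs (λ x → fromℚ p ⊗ G x) ≼ fromℚ p ⊗ ∑ xs G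
  ∑-scale p G [] = begin
    ∑ [] (λ x → fromℚ p ⊗ G x)  ∼⟨ ≡⇒≼ (∑-[] _) ⟩
    0ℝ                          ∼⟨ ≼-⊗-zero p ⟩
    fromℚ p ⊗ 0ℝ                ∼⟨ ≡⇒≼ (cong (fromℚ p ⊗_) (sym (∑-[] G))) ⟩
    fromℚ p ⊗ ∑ [] G            ∎
  ∑-scale p G (x ∷ xs) = begin
    ∑ (x ∷ xs) (λ x → fromℚ p ⊗ G x)                ∼⟨ ≡⇒≼ (∑-∷ x xs _) ⟩
    fromℚ p ⊗ G x ⊕ ∑ xs (λ x → fromℚ p ⊗ G x)      ∼⟨ +-monoʳ-≼ _ (∑-scale p G xs) ⟩
    fromℚ p ⊗ G x ⊕ fromℚ p ⊗ ∑ xs G                ∼⟨ ≼-⊗-distrib p (G x) (∑ xs G) ⟩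
    fromℚ p ⊗ (G x ⊕ ∑ xs G)                        ∼⟨ ≡⇒≼ (cong (fromℚ p ⊗_) (sym (∑-∷ x xs G))) ⟩
    fromℚ p ⊗ ∑ (x ∷ xs) G                          ∎

  ∑-++ : ∀ (G : A → ℝ) xs ys → ∑ xs G ⊕ ∑ ys G ≼ ∑ (xs ++ ys) G
  ∑-++ G [] ys = ≼-trans (≡⇒≼ (cong (_⊕ ∑ ys G) (∑-[] G))) (≼-⊕-identityˡ (∑ ys G))
  ∑-++ G (x ∷ xs) ys = begin
    ∑ (x ∷ xs) G ⊕ ∑ ys G     ∼⟨ ≡⇒≼ (cong (_⊕ ∑ ys G) (∑-∷ x xs G)) ⟩
    (G x ⊕ ∑ xs G) ⊕ ∑ ys G   ∼⟨ ≼-⊕-assoc (G x) (∑ xs G) (∑ ys G) ⟩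
    G x ⊕ (∑ xs G ⊕ ∑ ys G)   ∼⟨ +-monoʳ-≼ (G x) (∑-++ G xs ys) ⟩
    G x ⊕ ∑ (xs ++ ys) G      ∼⟨ ≡⇒≼ (sym (∑-∷ x (xs ++ ys) G)) ⟩
    ∑ (x ∷ xs ++ ys) G        ∎

  ∑-concatMap : ∀ {B : Set} (k : B → List A) (G : A → ℝ) zs → ∑ zs (λ z → ∑ (k z) G) ≼ ∑ (concatMap k zs) G
  ∑-concatMap k G []       = ≡⇒≼ (≡.trans (∑-[] _) (sym (∑-[] G)))
  ∑-concatMap k G (z ∷ zs) = begin
    ∑ (z ∷ zs) (λ z → ∑ (k z) G)               ∼⟨ ≡⇒≼ (∑-∷ z zs _) ⟩
    ∑ (k z) G ⊕ ∑ zs (λ z → ∑ (k z) G)         ∼⟨ +-monoʳ-≼ (∑ (k z) G) (∑-concatMap k G zs) ⟩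
    ∑ (k z) G ⊕ ∑ (concatMap k zs) G           ∼⟨ ∑-++ G (k z) (concatMap k zs) ⟩
    ∑ (concatMap k (z ∷ zs)) G                 ∎

1/-* : ∀ k n → .{{_ : ℕ.NonZero n}} .{{_ : ℕ.NonZero (suc k ℕ.* n)}} →
       (+ 1 ℚ./ suc k) ℚ.* (+ 1 ℚ./ n) ≡ + 1 ℚ./ (suc k ℕ.* n)
1/-* k n@(suc l) = ℚₚ.toℚᵘ-injective (ℚᵘₚ.≃-trans (ℚₚ.toℚᵘ-homo-* (+ 1 ℚ./ suc k) (+ 1 ℚ./ suc l))
  (ℚᵘₚ.≃-trans (ℚᵘₚ.*-cong (ℚₚ.toℚᵘ-fromℚᵘ (ℚᵘ.mkℚᵘ (+ 1) k)) (ℚₚ.toℚᵘ-fromℚᵘ (ℚᵘ.mkℚᵘ (+ 1) l)))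
  (ℚᵘₚ.≃-trans (ℚᵘ.*≡* refl) (ℚᵘₚ.≃-sym (ℚₚ.toℚᵘ-fromℚᵘ (ℚᵘ.mkℚᵘ (+ 1) (ℕ.pred (suc k ℕ.* suc l))))))))

-- Induction over the arrivals

module Analysis {n m : ℕ} (g : Allocation n m → ℝ)
  (g-cong : ∀ {A B} → A ≗ B → g A ≡ g B)
  (0≼g : ∀ A → 0ℝ ≼ g A)
  (g-submodular : ∀ A B → g (A ∪ᴬ B) ⊕ g (A ∩ᴬ B) ≼ g A ⊕ g B)
  (alloc : List (Fin m) → Allocation n m)
  (choice : List (Fin m) → Fin m → Maybe (Fin n))
  (alloc-∷ : ∀ y h → alloc (y ∷ h) ≗ alloc h ∪ᴬ single (choice h y) y)
  (greedy : ∀ h y → Unique (y ∷ h) → ∀ o → g (alloc h ∪ᴬ single o y) ≼ g (alloc (y ∷ h)))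
  where

  open Submod g g-cong 0≼g g-submodular
  open ≼-Reasoning

  opaque
    -- The conditional expectation of the final value once `h` has arrived, unfolded by the next
    -- arrival as the induction needs it; `average≼` compares it with the mean over all orders.
    average : ∀ {r} → List (Fin m) → Vec (Fin m) r → ℝ
    average {zero}  h xs = g (alloc h)
    average {suc k} h xs = fromℚ (+ 1 ℚ./ suc k) ⊗ ∑ (picks xs) (λ p → average (proj₁ p ∷ h) (proj₂ p))

    average-[] : ∀ h → average h [] ≡ g (alloc h)
    average-[] h = refl

    average-∷ : ∀ {k} h (xs : Vec (Fin m) (suc k)) →
      average h xs ≡ fromℚ (+ 1 ℚ./ suc k) ⊗ ∑ (picks xs) (λ p → average (proj₁ p ∷ h) (proj₂ p))
    average-∷ h xs = refl

  outcome : ∀ {r} → List (Fin m) → Vec (Fin m) r → ℝ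
  outcome h σ = g (alloc (toList σ ʳ++ h))

  average≼ : ∀ {r} h (xs : Vec (Fin m) r) →
    average h xs ≼ fromℚ ((+ 1 ℚ./ r ℕ.!) {{r ℕₚ.!≢0}}) ⊗ ∑ (permutations xs) (outcome h)
  average≼ {zero} h [] = begin
    average h []                                ∼⟨ ≡⇒≼ (average-[] h) ⟩
    g (alloc h)                                 ∼⟨ ≼-⊗-identity (g (alloc h)) ⟩
    fromℚ 1ℚ ⊗ g (alloc h)                      ∼⟨ *-monoˡ-≼ (fromℚ-mono (ℚₚ.<⇒≤ 0<1)) (≼-⊕-identityʳ (g (alloc h))) ⟩
    fromℚ 1ℚ ⊗ (g (alloc h) ⊕ 0ℝ)               ∼⟨ ≡⇒≼ (cong (λ s → fromℚ 1ℚ ⊗ (g (alloc h) ⊕ s)) (sym (∑-[] (outcome h)))) ⟩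
    fromℚ 1ℚ ⊗ (outcome h [] ⊕ ∑ [] (outcome h)) ∼⟨ ≡⇒≼ (cong (fromℚ 1ℚ ⊗_) (sym (∑-∷ [] [] (outcome h)))) ⟩
    fromℚ 1ℚ ⊗ ∑ ([] ∷ []) (outcome h)          ∎
  average≼ {suc k} h xs = begin
    average h xs
      ∼⟨ ≡⇒≼ (average-∷ h xs) ⟩
    fromℚ c ⊗ ∑ (picks xs) (λ p → average (proj₁ p ∷ h) (proj₂ p))
      ∼⟨ *-monoˡ-≼ (fromℚ-mono (0≤/ k)) (≼-trans
           (∑-mono (All.universal (λ p → average≼ (proj₁ p ∷ h) (proj₂ p)) (picks xs)))
           (∑-scale d (λ p → ∑ (permutations (proj₂ p)) (outcome (proj₁ p ∷ h))) (picks xs))) ⟩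
    fromℚ c ⊗ (fromℚ d ⊗ ∑ (picks xs) (λ p → ∑ (permutations (proj₂ p)) (outcome (proj₁ p ∷ h))))
      ∼⟨ ≼-⊗-assoc c d _ ⟩
    fromℚ (c ℚ.* d) ⊗ ∑ (picks xs) (λ p → ∑ (permutations (proj₂ p)) (outcome (proj₁ p ∷ h)))
      ∼⟨ *-monoˡ-≼ 0≼cd (≼-trans
           (∑-mono (All.universal (λ p → ≡⇒≼ (sym (∑-map (proj₁ p ∷_) (permutations (proj₂ p)) (outcome h)))) (picks xs)))
           (∑-concatMap _ (outcome h) (picks xs))) ⟩
    fromℚ (c ℚ.* d) ⊗ ∑ (permutations xs) (outcome h)
      ∼⟨ ≡⇒≼ (cong (λ q → fromℚ q ⊗ ∑ (permutations xs) (outcome h)) (1/-* k (k ℕ.!) {{k ℕₚ.!≢0}} {{suc k ℕₚ.!≢0}})) ⟩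
    fromℚ ((+ 1 ℚ./ suc k ℕ.!) {{suc k ℕₚ.!≢0}}) ⊗ ∑ (permutations xs) (outcome h) ∎
    where
    c = + 1 ℚ./ suc k
    d = (+ 1 ℚ./ k ℕ.!) {{k ℕₚ.!≢0}}
    0≼cd : 0ℝ ≼ fromℚ (c ℚ.* d)
    0≼cd = fromℚ-mono (0≤* (0≤/ k) (/-mono 0 1 1 (k ℕ.!) {{_}} {{k ℕₚ.!≢0}} z≤n))

  current : List (Fin m) → ℝ
  current h = g (alloc h)

  potential : List (Fin m) → (Fin m → Maybe (Fin n)) → List (Fin m) → ℝ
  potential h ρ xs = g (alloc h ∪ᴬ targets ρ xs)

  current-mono : ∀ h y → Unique (y ∷ h) → current h ≼ current (y ∷ h)
  current-mono h y uniq = ≼-trans (≡⇒≼ (g-cong λ j → sym (∪-identityʳ (alloc h j)))) (greedy h y uniq nothing)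

  module _ (δ : ℚ) (0≤δ : 0ℚ ℚ.≤ δ) (3δ≤1 : ι 3 ℚ.* δ ℚ.≤ 1ℚ) where

    open Euler δ
    open Bounds 0≤δ 3δ≤1
    open Potential δ 0≤δ 3δ≤1

    Bound : ∀ {r} → List (Fin m) → Vec (Fin m) r → (Fin m → Maybe (Fin n)) → ℕ → Set
    Bound h xs ρ t = W (current h) (potential h ρ (toList xs)) t ≼ average h xs

    StepsFit : ℕ → Set
    StepsFit r = ∀ k → k ℕ.< r → ∃[ q ] ι q ℚ.* δ ≡ + 1 ℚ./ suc k

    module Step {k} (h : List (Fin m)) (xs : Vec (Fin m) (suc k)) (fresh : Fresh h (toList xs))
      (q : ℕ) (qδ≡ : ι q ℚ.* δ ≡ + 1 ℚ./ suc k)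
      (ih : ∀ y (ys : Vec (Fin m) k) → Fresh (y ∷ h) (toList ys) → ∀ ρ t → Rising t → Bound (y ∷ h) ys ρ t) where

      c = + 1 ℚ./ suc k

      next : Fin m × Vec (Fin m) k → ℝ
      next p = average (proj₁ p ∷ h) (proj₂ p)

      ih-picks : ∀ ρ t → Rising t →
        All (λ p → W (current (proj₁ p ∷ h)) (potential (proj₁ p ∷ h) ρ (toList (proj₂ p))) t ≼ next p) (picks xs)
      ih-picks ρ t up = All.map (λ {p} xs↭ → ih (proj₁ p) (proj₂ p) (proj₂ (proj₂ (fresh-pick fresh xs↭))) ρ t up) (picks-↭ xs)

      0≼c : 0ℝ ≼ fromℚ c
      0≼c = fromℚ-mono (0≤/ k)

      current≼ : current h ≼ average h xs
      current≼ = begin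
        current h
          ∼⟨ undo-average k c (current h) (ι-suc*/ k) ⟩
        fromℚ c ⊗ (fromℚ (ι (suc k)) ⊗ current h)
          ∼⟨ ≡⇒≼ (cong (λ r → fromℚ c ⊗ (fromℚ (ι r) ⊗ current h)) (sym (length-picks xs))) ⟩
        fromℚ c ⊗ (fromℚ (ι (length (picks xs))) ⊗ current h)
          ∼⟨ *-monoˡ-≼ 0≼c (≼-trans (∑-const′ (current h) (picks xs)) (∑-mono (All.zipWith
               (λ {p} (xs↭ , W≼) → ≼-trans (current-mono h (proj₁ p) (proj₁ (fresh-pick fresh xs↭)))
                                   (≼-trans (≼W-zero _ _) W≼))
               -- With no time left `W` is just F, so any targets will do, here none.
               (picks-↭ xs , ih-picks (λ _ → nothing) zero (λ _ ()))))) ⟩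
        fromℚ c ⊗ ∑ (picks xs) next
          ∼⟨ ≡⇒≼ (sym (average-∷ h xs)) ⟩
        average h xs ∎

      -- One arrival: `gains` and the greedy rule estimate the next F, `drift` the next H, and the
      -- nonnegative form `W t` combines them. `W-advance` then trades the step 1/(k+1) for `q`
      -- steps of the flow.
      maximal-bound : ∀ ρ →
        All (λ p → potential h ρ (toList (proj₂ p)) ≼ potential h ρ (toList xs)) (picks xs) →
        ∀ t → Rising t → Bound h xs ρ t
      maximal-bound ρ maximal = W-advance F H q (0≼g _) current≼ λ t up → begin
        fromℚ (φ t) ⊗ (F ⊕ fromℚ (ι q ℚ.* δ) ⊗ (H ⊖ F)) ⊕ fromℚ (ψ t) ⊗ (H ⊕ fromℚ (ι q ℚ.* δ) ⊗ (F ⊖ (H ⊕ H)))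
          ∼⟨ ≡⇒≼ (cong (λ c → fromℚ (φ t) ⊗ (F ⊕ fromℚ c ⊗ (H ⊖ F)) ⊕ fromℚ (ψ t) ⊗ (H ⊕ fromℚ c ⊗ (F ⊖ (H ⊕ H)))) qδ≡) ⟩
        fromℚ (φ t) ⊗ (F ⊕ fromℚ c ⊗ (H ⊖ F)) ⊕ fromℚ (ψ t) ⊗ (H ⊕ fromℚ c ⊗ (F ⊖ (H ⊕ H)))
          ∼⟨ average-advance k c (0≤/ k) (0≤φ t) (0≤ψ t) (ι-suc*/ k) F-grows H-drifts ⟩
        fromℚ c ⊗ (fromℚ (φ t) ⊗ ∑ (picks xs) F′ ⊕ fromℚ (ψ t) ⊗ ∑ (picks xs) H′)
          ∼⟨ *-monoˡ-≼ 0≼c (≼-trans (∑-linear (φ t) (ψ t) F′ H′ (picks xs))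
               (∑-mono (All.map (λ {p} W≼ → ≼-trans (≼W (F′ p) (H′ p) t) W≼) (ih-picks ρ t up)))) ⟩
        fromℚ c ⊗ ∑ (picks xs) next
          ∼⟨ ≡⇒≼ (sym (average-∷ h xs)) ⟩
        average h xs ∎
        where
        F H : ℝ
        F = current h
        H = potential h ρ (toList xs)
        F′ H′ : Fin m × Vec (Fin m) k → ℝ
        F′ p = current (proj₁ p ∷ h)
        H′ p = potential (proj₁ p ∷ h) ρ (toList (proj₂ p))
        xs-unique = Fresh.xs-unique fresh

        F-grows : fromℚ (ι k) ⊗ F ⊕ H ≼ ∑ (picks xs) F′
        F-grows = ≼-trans (gains (alloc h) ρ xs xs-unique) (∑-mono (All.map
          (λ {p} xs↭ → greedy h (proj₁ p) (proj₁ (fresh-pick fresh xs↭)) (ρ (proj₁ p))) (picks-↭ xs)))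

        H-drifts : fromℚ (ι k) ⊗ H ⊕ F ≼ ∑ (picks xs) H′ ⊕ H
        H-drifts = ≼-trans (drift (alloc h) ρ (choice h) xs xs-unique maximal) (+-monoˡ-≼ H
          (∑-mono (All.universal (λ p → ≡⇒≼ (g-cong λ j → ≡.trans
            (∪-solve 3 (λ s t e → (s ⊍ t) ⊍ e ≐ (s ⊍ e) ⊍ t) refl (alloc h j) (targets ρ (toList (proj₂ p)) j) (single (choice h (proj₁ p)) (proj₁ p) j))
            (cong (_∪ targets ρ (toList (proj₂ p)) j) (sym (alloc-∷ (proj₁ p) h j))))) (picks xs))))
          where open ∪-Solver (∪-idempotentCommutativeMonoid m) using () renaming (_⊕_ to _⊍_; _⊜_ to _≐_; solve to ∪-solve)

      module _ (t : ℕ) (up : Rising t) where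

        -- Dropping a target that does not pay raises the potential, so only maximal ρ matter.
        bound-by-size : ∀ s ρ → size ρ (toList xs) ℕ.≤ s → Bound h xs ρ t
        bound-by-size s ρ size≤s = All-≼-cases
          (λ p → potential h ρ (toList (proj₂ p))) (λ _ → potential h ρ (toList xs))
          (All.map (λ {p} xs↭ → decide (proj₁ p) (toList (proj₂ p)) xs↭ (ρ (proj₁ p)) refl s size≤s) (picks-↭ xs))
          (λ maximal → maximal-bound ρ maximal t up)
          where
          decide : ∀ y ys → toList xs ↭ y ∷ ys → ∀ o → ρ y ≡ o → ∀ s → size ρ (toList xs) ℕ.≤ s →
                   potential h ρ ys ≼ potential h ρ (toList xs) ⊎
                   (potential h ρ (toList xs) ≼ potential h ρ ys → Bound h xs ρ t)
          decide y ys xs↭ nothing ρy≡ s _ = inj₁ (≡⇒≼ (g-cong λ j → cong (alloc h j ∪_) (sym (≡.trans (targets-↭ ρ xs↭ j)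
            (≡.trans (cong (λ o → single o y j ∪ targets ρ ys j) ρy≡) (∪-identityˡ _))))))
          decide y ys xs↭ (just o) ρy≡ zero size≤ = contradiction
            (ℕₚ.≤-trans (ℕₚ.≤-reflexive (sym (≡.trans (size-↭ ρ xs↭) (cong (λ o → cost o ℕ.+ size ρ ys) ρy≡)))) size≤) λ ()
          decide y ys xs↭ (just o) ρy≡ (suc s) size≤ = inj₂ λ worse → begin
            W (current h) (potential h ρ (toList xs)) t
              ∼⟨ ≼-trans (W-mono _ _ t (≼-trans worse (≡⇒≼ (g-cong λ j → cong (alloc h j ∪_) (sym (dropped j)))))) (≼W _ _ t) ⟩
            W (current h) (potential h ρ′ (toList xs)) t
              ∼⟨ bound-by-size s ρ′ (ℕₚ.≤-pred (ℕₚ.≤-trans (ℕₚ.≤-reflexive smaller) size≤)) ⟩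
            average h xs ∎
            where
            ρ′ = drop-target y ρ
            same : All (λ z → ρ′ z ≡ ρ z) ys
            same = All.map (drop-target-there y ρ) (proj₁ (proj₂ (fresh-pick fresh xs↭)))
            dropped : targets ρ′ (toList xs) ≗ targets ρ ys
            dropped j = ≡.trans (targets-↭ ρ′ xs↭ j) (≡.trans
              (cong₂ (λ o (T : Allocation n m) → single o y j ∪ T j) (drop-target-here y ρ) (targets-cong same)) (∪-identityˡ _))
            smaller : suc (size ρ′ (toList xs)) ≡ size ρ (toList xs)
            smaller = ≡.trans (cong suc (≡.trans (size-↭ ρ′ xs↭)
                (cong₂ (λ o s → cost o ℕ.+ s) (drop-target-here y ρ) (size-cong same))))
              (sym (≡.trans (size-↭ ρ xs↭) (cong (λ o → cost o ℕ.+ size ρ ys) ρy≡)))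

    average-bound : ∀ {r} h (xs : Vec (Fin m) r) → Fresh h (toList xs) → StepsFit r →
                    ∀ ρ t → Rising t → Bound h xs ρ t
    -- With no items left H equals F, and from H ≤ F the flow does not rise above F.
    average-bound {zero} h [] fresh fit ρ t up = ≼-trans
      (W-below (current h) (potential h ρ []) (≡⇒≼ (g-cong λ j → ∪-identityʳ (alloc h j))) (0≼g _) t up)
      (≡⇒≼ (sym (average-[] h)))
    average-bound {suc k} h xs fresh fit ρ t up =
      Step.bound-by-size h xs fresh (proj₁ (fit k ℕₚ.≤-refl)) (proj₂ (fit k ℕₚ.≤-refl))
        (λ y ys fresh′ → average-bound (y ∷ h) ys fresh′ (λ j j<k → fit j (ℕₚ.m<n⇒m<1+n j<k)))
        t up (size ρ (toList xs)) ρ ℕₚ.≤-refl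

-- Utilities

opaque
  unfolding _⊕_ _⊖_ _⊗_

  +≡⊕ : ∀ x y → x + y ≡ x ⊕ y
  +≡⊕ x y = refl

  -≡⊖ : ∀ x y → x - y ≡ x ⊖ y
  -≡⊖ x y = refl

  *≡⊗ : ∀ x y → x * y ≡ x ⊗ y
  *≡⊗ x y = refl

  𝔼-order≡ : ∀ {m} (G : Vec (Fin m) m → ℝ) → 𝔼-order G ≡
             fromℚ ((+ 1 ℚ./ m ℕ.!) {{m ℕₚ.!≢0}}) ⊗ foldr _+_ 0ℝ (map G (permutations (Vec.allFin m)))
  𝔼-order≡ G = refl

total : ∀ {n} → (Fin n → ℝ) → ℝ
total = Vector.foldr _⊕_ 0ℝ

foldr-cong : ∀ {A B : Set} {_∙_ _◦_ : A → B → B} {e} → (∀ x y → x ∙ y ≡ x ◦ y) →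
             ∀ {n} (v : Fin n → A) → Vector.foldr _∙_ e v ≡ Vector.foldr _◦_ e v
foldr-cong {e = e} eq {zero}  v = refl
foldr-cong {_∙_ = _∙_} eq {suc n} v = ≡.trans (cong (v zero ∙_) (foldr-cong eq (v ∘ suc))) (eq _ _)

foldr≡∑ : ∀ {A : Set} (xs : List A) (G : A → ℝ) → foldr _+_ 0ℝ (map G xs) ≡ ∑ xs G
foldr≡∑ xs G = ≡.trans (Listₚ.foldr-cong +≡⊕ refl (map G xs)) (opened xs)
  where
  opened : ∀ xs → foldr _⊕_ 0ℝ (map G xs) ≡ ∑ xs G
  opened []       = sym (∑-[] G)
  opened (x ∷ xs) = ≡.trans (cong (G x ⊕_) (opened xs)) (sym (∑-∷ x xs G))

total-cong : ∀ {n} {u v : Fin n → ℝ} → u ≗ v → total u ≡ total v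
total-cong {zero}  eq = refl
total-cong {suc n} eq = cong₂ _⊕_ (eq zero) (total-cong (eq ∘ suc))

0≼total : ∀ {n} {v : Fin n → ℝ} → (∀ j → 0ℝ ≼ v j) → 0ℝ ≼ total v
0≼total {zero}  _ = ≼-refl
0≼total {suc n} h = 0≼+ (h zero) (0≼total (h ∘ suc))

module _ where
  open ℚ-Solver.+-*-Solver

  opaque
    unfolding _⊕_ _⊖_ _⊗_

    ⊕-interchange : ∀ a b c d → (a ⊕ b) ⊕ (c ⊕ d) ≼ (a ⊕ c) ⊕ (b ⊕ d)
    ⊕-interchange a b c d = ≼-reflexive λ i →
      solve 4 (λ a b c d → (a :+ b) :+ (c :+ d) := (a :+ c) :+ (b :+ d)) refl (seq a i) (seq b i) (seq c i) (seq d i)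

    ⊕-swap-head : ∀ x t y → (x ⊕ t) ⊕ y ≼ (y ⊕ t) ⊕ x
    ⊕-swap-head x t y = ≼-reflexive λ i →
      solve 3 (λ x t y → (x :+ t) :+ y := (y :+ t) :+ x) refl (seq x i) (seq t i) (seq y i)

    ⊕-swap-tail : ∀ {x t t′ y y′} → t ⊕ y ≼ t′ ⊕ y′ → (x ⊕ t) ⊕ y ≼ (x ⊕ t′) ⊕ y′
    ⊕-swap-tail {x} {t} {t′} {y} {y′} p = ≼-by (≼⇒0≼- p) λ i →
      solve 5 (λ x t t′ y y′ → (x :+ t′) :+ y′ := (x :+ t) :+ y :+ ((t′ :+ y′) :- (t :+ y)))
        refl (seq x i) (seq t i) (seq t′ i) (seq y i) (seq y′ i)

    ⊕-⊖-intro : ∀ {x y s t} → x ⊕ s ≼ y ⊕ t → x ≼ y ⊕ (t ⊖ s)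
    ⊕-⊖-intro {x} {y} {s} {t} p = ≼-by (≼⇒0≼- p) λ i →
      solve 4 (λ x y s t → y :+ (t :- s) := x :+ ((y :+ t) :- (x :+ s))) refl (seq x i) (seq y i) (seq s i) (seq t i)

    ⊕-⊖-elim : ∀ {x y s t} → y ⊕ t ≼ x ⊕ s → y ⊕ (t ⊖ s) ≼ x
    ⊕-⊖-elim {x} {y} {s} {t} p = ≼-by (≼⇒0≼- p) λ i →
      solve 4 (λ x y s t → x := y :+ (t :- s) :+ ((x :+ s) :- (y :+ t))) refl (seq x i) (seq y i) (seq s i) (seq t i)

    ⊕-identityʳ-≼ : ∀ x → x ⊕ 0ℝ ≼ x
    ⊕-identityʳ-≼ x = ≼-reflexive λ i → ℚₚ.+-identityʳ (seq x i)

    drop-nonneg : ∀ {p q F H x} → 0ℚ ℚ.≤ p → 0ℝ ≼ F → fromℚ p ⊗ F ⊕ fromℚ q ⊗ H ≼ x → fromℚ q ⊗ H ≼ x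
    drop-nonneg {p} {q} {F} {H} {x} 0≤p 0≼F h = ≼-by (0≼+ (0≼* (fromℚ-mono 0≤p) 0≼F) (≼⇒0≼- h)) λ i →
      solve 5 (λ p q F H x → x := q :* H :+ (p :* F :+ (x :- (p :* F :+ q :* H)))) refl p q (seq F i) (seq H i) (seq x i)

    split-⊗ : ∀ p q x → fromℚ (p ℚ.+ q) ⊗ x ≼ fromℚ p ⊗ x ⊕ fromℚ q ⊗ x
    split-⊗ p q x = ≼-reflexive λ i → ℚₚ.*-distribʳ-+ (seq x i) p q

total-mono₂ : ∀ {n} {u v w z : Fin n → ℝ} → (∀ j → u j ⊕ v j ≼ w j ⊕ z j) → total u ⊕ total v ≼ total w ⊕ total z
total-mono₂ {zero}  h = ≼-refl
total-mono₂ {suc n} {u} {v} {w} {z} h = begin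
  (u zero ⊕ total (u ∘ suc)) ⊕ (v zero ⊕ total (v ∘ suc))          ∼⟨ ⊕-interchange _ _ _ _ ⟩
  (u zero ⊕ v zero) ⊕ (total (u ∘ suc) ⊕ total (v ∘ suc))          ∼⟨ +-mono-≼ (h zero) (total-mono₂ (h ∘ suc)) ⟩
  (w zero ⊕ z zero) ⊕ (total (w ∘ suc) ⊕ total (z ∘ suc))          ∼⟨ ⊕-interchange _ _ _ _ ⟩
  (w zero ⊕ total (w ∘ suc)) ⊕ (z zero ⊕ total (z ∘ suc))          ∎
  where open ≼-Reasoning

total-update : ∀ {n} (u v : Fin n → ℝ) k → (∀ j → j ≢ k → u j ≡ v j) → total u ⊕ v k ≼ total v ⊕ u k
total-update {suc n} u v zero same = ≼-trans (⊕-swap-head (u zero) (total (u ∘ suc)) (v zero))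
  (≡⇒≼ (cong (λ t → (v zero ⊕ t) ⊕ u zero) (total-cong λ j → same (suc j) λ ())))
total-update {suc n} u v (suc k) same = ≼-trans
  (⊕-swap-tail {u zero} (total-update (u ∘ suc) (v ∘ suc) k λ j j≢k → same (suc j) (j≢k ∘ suc-injective)))
  (≡⇒≼ (cong (λ x → (x ⊕ total (v ∘ suc)) ⊕ u (suc k)) (same zero λ ())))

module _ {n m : ℕ} where

  ∈single⁺ : ∀ i j → i ∈ single {n} {m} (just j) i j
  ∈single⁺ i j = subst (i ∈_) (sym (updateAt-updates j ∅ᴬ)) (x∈p∪q⁺ (inj₂ (x∈⁅x⁆ i)))

  ∈targets⁺ : ∀ (ρ : Fin m → Maybe (Fin n)) {xs i j} → i ∈ₗ xs → ρ i ≡ just j → i ∈ targets ρ xs j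
  ∈targets⁺ ρ {i = i} {j} (here refl)  eq = x∈p∪q⁺ (inj₁ (subst (λ o → i ∈ single o i j) (sym eq) (∈single⁺ i j)))
  ∈targets⁺ ρ             (there i∈xs) eq = x∈p∪q⁺ (inj₂ (∈targets⁺ ρ i∈xs eq))

  ∈targets⁻ : ∀ (ρ : Fin m → Maybe (Fin n)) xs {i} j → i ∈ targets ρ xs j → ρ i ≡ just j
  ∈targets⁻ ρ []       j i∈ = contradiction i∈ ∉⊥
  ∈targets⁻ ρ (x ∷ xs) j i∈ with x∈p∪q⁻ (single (ρ x) x j) (targets ρ xs j) i∈
  ... | inj₂ i∈xs = ∈targets⁻ ρ xs j i∈xs
  ... | inj₁ i∈x with refl , eq ← ∈single (ρ x) x j i∈x = eq

  owner : Allocation n m → Fin m → Maybe (Fin n)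
  owner O i with any? (λ j → i ∈? O j)
  ... | yes (j , _) = just j
  ... | no  _       = nothing

  owner⁻ : ∀ O i {j} → owner O i ≡ just j → i ∈ O j
  owner⁻ O i eq with any? (λ j → i ∈? O j)
  ... | yes (j , i∈) = subst (λ j → i ∈ O j) (Maybeₚ.just-injective eq) i∈
  owner⁻ O i () | no _

  -- The disjointness of the reference allocation enters here: an item has one owner only, whichever
  -- bidder the search finds.
  owner⁺ : ∀ O → PairwiseDisjoint O → ∀ i {j} → i ∈ O j → owner O i ≡ just j
  owner⁺ O disjoint i {j} i∈ with any? (λ j → i ∈? O j)
  ... | no ∄ = contradiction (j , i∈) ∄
  ... | yes (k , i∈k) with k ≟ j
  ...   | yes refl = refl
  ...   | no k≢j   = contradiction (i , x∈p∩q⁺ (i∈k , i∈)) (disjoint k j k≢j)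

  targets-owner : ∀ O → PairwiseDisjoint O → ∀ {xs} → (∀ i → i ∈ₗ xs) → targets (owner O) xs ≗ O
  targets-owner O disjoint {xs} all j = ⊆-antisym
    (λ {i} i∈ → owner⁻ O i (∈targets⁻ (owner O) xs j i∈))
    (λ {i} i∈ → ∈targets⁺ (owner O) (all i) (owner⁺ O disjoint i i∈))

toList-tabulate : ∀ {A : Set} {n} (f : Fin n → A) → toList (Vec.tabulate f) ≡ List.tabulate f
toList-tabulate {n = zero}  f = refl
toList-tabulate {n = suc n} f = cong (f zero ∷_) (toList-tabulate (f ∘ suc))

ι*1/≡1/ : ∀ q M k → q ℕ.* suc k ≡ suc M → ι q ℚ.* (+ 1 ℚ./ suc M) ≡ + 1 ℚ./ suc k
ι*1/≡1/ q M k eq = ≡.trans (sym (/-split q M)) (ℚₚ.≤-antisym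
  (/-mono q (suc M) 1 (suc k) (ℕₚ.≤-reflexive (≡.trans eq (sym (ℕₚ.*-identityˡ (suc M))))))
  (/-mono 1 (suc k) q (suc M) (ℕₚ.≤-reflexive (≡.trans (ℕₚ.*-identityˡ (suc M)) (sym eq)))))

-- M + 1 = (L + 1) m! will be the reciprocal of the Euler step: as fine as desired through `L`, and
-- divisible by every possible number of remaining items.
common-multiple : ∀ m L → ∃[ M ] L ℕ.≤ M × (∀ k → k ℕ.< m → ∃[ q ] q ℕ.* suc k ≡ suc M)
common-multiple m L = ℕ.pred (suc L ℕ.* m ℕ.!) , ℕₚ.≤-pred (ℕₚ.≤-trans (ℕₚ.m≤m*n (suc L) (m ℕ.!)) (ℕₚ.≤-reflexive (sym M+1≡))) , factor
  where
  instance
    _ = m ℕₚ.!≢0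
    _ = ℕₚ.m*n≢0 (suc L) (m ℕ.!)
  M+1≡ : suc (ℕ.pred (suc L ℕ.* m ℕ.!)) ≡ suc L ℕ.* m ℕ.!
  M+1≡ = ℕₚ.suc-pred (suc L ℕ.* m ℕ.!)
  factor : ∀ k → k ℕ.< m → ∃[ q ] q ℕ.* suc k ≡ suc (ℕ.pred (suc L ℕ.* m ℕ.!))
  factor k k<m with ∣-trans (m∣m*n (k ℕ.!)) (m≤n⇒m!∣n! k<m)
  ... | divides d m!≡ = suc L ℕ.* d , ≡.trans (≡.trans (ℕₚ.*-assoc (suc L) d (suc k)) (cong (suc L ℕ.*_) (sym m!≡))) (sym M+1≡)

-- From submodular utilities to the welfare bound

module WelfareBound {n m : ℕ} (f : Utilities n m) (0≤f : ∀ j → NonNegative (f j))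
  (f-submodular : ∀ j → Submodular (f j)) (alg : OnlineAlgorithm n m) (alg-greedy : IsGreedy f alg) where

  open ≼-Reasoning

  g : Allocation n m → ℝ
  g A = total (λ j → f j (A j))

  g-cong : ∀ {A B} → A ≗ B → g A ≡ g B
  g-cong eq = total-cong λ j → cong (f j) (eq j)

  0≼g : ∀ A → 0ℝ ≼ g A
  0≼g A = 0≼total λ j → pack (0≤f j (A j))

  g-submodular : ∀ A B → g (A ∪ᴬ B) ⊕ g (A ∩ᴬ B) ≼ g A ⊕ g B
  g-submodular A B = total-mono₂ λ j → ≼-trans (≡⇒≼ (sym (+≡⊕ (f j (A j ∪ B j)) (f j (A j ∩ B j))))) (≼-trans (le j) (≡⇒≼ (+≡⊕ (f j (A j)) (f j (B j)))))
    where
    le : ∀ j → f j (A j ∪ B j) + f j (A j ∩ B j) ≼ f j (A j) + f j (B j)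
    le j = pack (f-submodular j (A j) (B j))

  module _ (S : Allocation n m) (i : Fin m) where

    gain : Fin n → ℝ
    gain k = f k (S k ∪ ⁅ i ⁆) ⊖ f k (S k)

    same : ∀ k j → j ≢ k → f j (assign (just k) i S j) ≡ f j (S j)
    same k j j≢k = cong (f j) (updateAt-minimal j k S j≢k)

    assign≼ : ∀ k → g (assign (just k) i S) ≼ g S ⊕ gain k
    assign≼ k = ≼-trans (⊕-⊖-intro (total-update _ _ k (same k)))
      (≡⇒≼ (cong (λ A → g S ⊕ (f k A ⊖ f k (S k))) (updateAt-updates k S)))

    ≼assign : ∀ k → g S ⊕ gain k ≼ g (assign (just k) i S)
    ≼assign k = ≼-trans (≡⇒≼ (cong (λ A → g S ⊕ (f k A ⊖ f k (S k))) (sym (updateAt-updates k S))))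
      (⊕-⊖-elim (total-update _ _ k λ j j≢k → sym (same k j j≢k)))

    μ : Fin n → ℝ
    μ k = marginal (f k) (S k) i

    marginal≼ : ∀ k → μ k ≼ gain k
    marginal≼ k = ≡⇒≼ (-≡⊖ (f k (S k ∪ ⁅ i ⁆)) (f k (S k)))

    ≼marginal : ∀ k → gain k ≼ μ k
    ≼marginal k = ≡⇒≼ (sym (-≡⊖ (f k (S k ∪ ⁅ i ⁆)) (f k (S k))))

    greedy-best : ∀ c → GreedyChoice f S i c → ∀ o → g (assign o i S) ≼ g (assign c i S)
    greedy-best (just j) (best , 0≤) nothing = begin
      g S               ∼⟨ ≼-⊕-identityʳ (g S) ⟩
      g S ⊕ 0ℝ          ∼⟨ +-monoʳ-≼ (g S) (≼-trans (pack {0ℝ} {μ j} 0≤) (marginal≼ j)) ⟩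
      g S ⊕ gain j      ∼⟨ ≼assign j ⟩
      g (assign (just j) i S) ∎
    greedy-best (just j) (best , _) (just k) = begin
      g (assign (just k) i S) ∼⟨ assign≼ k ⟩
      g S ⊕ gain k      ∼⟨ +-monoʳ-≼ (g S) (≼-trans (≼marginal k) (≼-trans (pack {μ k} {μ j} (best k)) (marginal≼ j))) ⟩
      g S ⊕ gain j      ∼⟨ ≼assign j ⟩
      g (assign (just j) i S) ∎
    greedy-best nothing none nothing = ≼-refl
    greedy-best nothing none (just k) = begin
      g (assign (just k) i S) ∼⟨ assign≼ k ⟩
      -- A discarded item only refutes nonnegativity of its marginals; by stability of the order
      -- they are at most 0.
      g S ⊕ gain k      ∼⟨ +-monoʳ-≼ (g S) (≼-trans (≼marginal k) (≰⇒≽ {0ℝ} {μ k} λ (pack 0≤) → none k 0≤)) ⟩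
      g S ⊕ 0ℝ          ∼⟨ ⊕-identityʳ-≼ (g S) ⟩
      g S               ∎

  open Analysis g g-cong 0≼g g-submodular (allocation alg) alg
    (λ y h → assign≗∪single (alg h y) y (allocation alg h))
    (λ h y uniq o → ≼-trans (≡⇒≼ (g-cong λ j → sym (assign≗∪single o y (allocation alg h) j)))
      (greedy-best (allocation alg h) y (alg h y) (alg-greedy h y uniq) o))

  items : Vec (Fin m) m
  items = Vec.allFin m

  fresh : Fresh [] (toList items)
  fresh = record
    { h-unique  = []
    ; xs-unique = subst Unique (sym (toList-tabulate id)) (Uniqueₚ.allFin⁺ m)
    ; apart     = All.universal (λ _ → []) (toList items) }

  welfare≡g : ∀ A → welfare f A ≡ g A
  welfare≡g A = foldr-cong +≡⊕ λ j → f j (A j)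

  expected≡ : expectedWelfare f alg ≡ 𝔼-order (λ σ → welfare f (allocation alg (reverse (toList σ))))
  expected≡ = refl

  average≼expected : average [] items ≼ expectedWelfare f alg
  average≼expected = begin
    average [] items
      ∼⟨ average≼ [] items ⟩
    fromℚ ((+ 1 ℚ./ m ℕ.!) {{m ℕₚ.!≢0}}) ⊗ ∑ (permutations items) (outcome [])
      ∼⟨ ≡⇒≼ (cong (fromℚ ((+ 1 ℚ./ m ℕ.!) {{m ℕₚ.!≢0}}) ⊗_)
           (∑-cong (permutations items) λ σ → sym (welfare≡g (allocation alg (reverse (toList σ)))))) ⟩
    fromℚ ((+ 1 ℚ./ m ℕ.!) {{m ℕₚ.!≢0}}) ⊗ ∑ (permutations items) (λ σ → welfare f (allocation alg (reverse (toList σ))))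
      ∼⟨ ≡⇒≼ (cong (fromℚ ((+ 1 ℚ./ m ℕ.!) {{m ℕₚ.!≢0}}) ⊗_)
           (sym (foldr≡∑ (permutations items) (λ σ → welfare f (allocation alg (reverse (toList σ))))))) ⟩
    fromℚ ((+ 1 ℚ./ m ℕ.!) {{m ℕₚ.!≢0}}) ⊗ foldr _+_ 0ℝ (map (λ σ → welfare f (allocation alg (reverse (toList σ)))) (permutations items))
      ∼⟨ ≡⇒≼ (sym (𝔼-order≡ (λ σ → welfare f (allocation alg (reverse (toList σ)))))) ⟩
    𝔼-order (λ σ → welfare f (allocation alg (reverse (toList σ))))
      ∼⟨ ≡⇒≼ (sym expected≡) ⟩
    expectedWelfare f alg ∎

  module _ (ratio : ℝ)
    (ratio-limit : ∀ ε → 0ℚ ℚ.< ε → ∃[ N ] ∀ M → N ℕ.≤ M → ∃[ t ] ratio ≼ fromℚ (Euler.ψ (+ 1 ℚ./ suc M) t ℚ.+ ε)) where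

    disjoint-bound : ∀ O → PairwiseDisjoint O → ratio ⊗ g O ≼ average [] items
    disjoint-bound O disjoint = ≼-limit approximate
      where
      module _ (M : ℕ) (2≤M : 2 ℕ.≤ M) (factor : ∀ k → k ℕ.< m → ∃[ q ] q ℕ.* suc k ≡ suc M) where
        δ = + 1 ℚ./ suc M
        open Euler δ
        open Bounds (0≤/ M) (3/≤1 M 2≤M)
        open Potential δ (0≤/ M) (3/≤1 M 2≤M)

        ψ-bound : ∀ t → fromℚ (ψ t) ⊗ g O ≼ average [] items
        -- `average-bound` asks for a time before the peak, so `t` is replaced by a rising time
        -- whose value of `ψ` is at least as large.
        ψ-bound t = let k , up , ψt≤ψk , _ = ψ-peak t in begin
          fromℚ (ψ t) ⊗ g O
            ∼⟨ *-monoʳ-≼ (0≼g O) (fromℚ-mono ψt≤ψk) ⟩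
          fromℚ (ψ k) ⊗ g O
            ∼⟨ ≡⇒≼ (cong (fromℚ (ψ k) ⊗_) (g-cong λ j → sym (≡.trans (∪-identityˡ _)
                 (targets-owner O disjoint (λ i → ∈-toList⁺ (∈-allFin⁺ i)) j)))) ⟩
          fromℚ (ψ k) ⊗ potential [] (owner O) (toList items)
            ∼⟨ drop-nonneg (0≤φ k) (0≼g _) (≼-trans (≼W (current []) (potential [] (owner O) (toList items)) k)
                 (average-bound δ (0≤/ M) (3/≤1 M 2≤M) [] items fresh
                   (λ j j<m → proj₁ (factor j j<m) , ι*1/≡1/ (proj₁ (factor j j<m)) M j (proj₂ (factor j j<m))) (owner O) k up)) ⟩
          average [] items ∎

        ratio-bound : ∀ ε t → ratio ≼ fromℚ (ψ t ℚ.+ ε) → ratio ⊗ g O ≼ average [] items ⊕ fromℚ ε ⊗ g O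
        ratio-bound ε t ratio≼ = begin
          ratio ⊗ g O                              ∼⟨ *-monoʳ-≼ (0≼g O) ratio≼ ⟩
          fromℚ (ψ t ℚ.+ ε) ⊗ g O                  ∼⟨ split-⊗ (ψ t) ε (g O) ⟩
          fromℚ (ψ t) ⊗ g O ⊕ fromℚ ε ⊗ g O        ∼⟨ +-monoˡ-≼ (fromℚ ε ⊗ g O) (ψ-bound t) ⟩
          average [] items ⊕ fromℚ ε ⊗ g O         ∎

      approximate : ∀ ε → 0ℚ ℚ.< ε → ratio ⊗ g O ≼ average [] items ⊕ fromℚ ε ⊗ g O
      approximate ε 0<ε =
        let N , limit = ratio-limit ε 0<ε
            M , L≤M , factor = common-multiple m (N ℕ.⊔ 2)
            t , ratio≼ = limit M (ℕₚ.m⊔n≤o⇒m≤o N 2 L≤M)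
        in ratio-bound M (ℕₚ.m⊔n≤o⇒n≤o N 2 L≤M) factor ε t ratio≼

    optimum-bound : ratio ⊗ optimalWelfare f ≼ expectedWelfare f alg
    optimum-bound = ≼-trans (Listₚ.foldr-preservesᵇ {P = λ w → ratio ⊗ w ≼ average [] items} *-max-≼
        (≼-trans (≡⇒≼ (cong (ratio ⊗_) (welfare≡g ∅ᴬ))) (disjoint-bound ∅ᴬ λ j k _ (i , i∈) → ∉⊥ (proj₁ (x∈p∩q⁻ ∅ ∅ i∈))))
        (Allₚ.map⁺ (All.map (λ {O} disjoint → ≼-trans (≡⇒≼ (cong (ratio ⊗_) (welfare≡g O))) (disjoint-bound O disjoint))
          (Allₚ.all-filter pairwiseDisjoint? (map lookup (vectors (allSubsets m) n))))))
      average≼expected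

seq-ratio : ∀ i → seq competitiveRatio i ≡ ratioAt x* i
seq-ratio i = refl

0≤x* : ∀ i → 0ℚ ℚ.≤ seq x* i
0≤x* i = 0≤* {lnApprox (seq b/a i) i} {recip (√-approx 5 i)} (0≤lnApprox (seq b/a i) i) (recip-nonNeg {√-approx 5 i} (ℚₚ.<-≤-trans (ℚₚ.positive⁻¹ (ι 2)) (2≤√5 i)))

eventually⇒≼ : ∀ {c : ℝ} {v : ℕ → ℚ} → (∀ i → seq c i ≡ v i) → ∀ {q} → (∃[ N ] ∀ i → N ℕ.≤ i → v i ℚ.≤ q) → c ≼ fromℚ q
eventually⇒≼ eq {q} (N , below) = pack λ η 0<η → N , λ i N≤i →
  ℚₚ.≤-trans (ℚₚ.≤-reflexive (eq i)) (ℚₚ.≤-trans (below i N≤i) (p≤p+ q (ℚₚ.<⇒≤ 0<η)))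

ratio-limit : ∀ ε → 0ℚ ℚ.< ε → ∃[ N ] ∀ M → N ℕ.≤ M → ∃[ t ] competitiveRatio ≼ fromℚ (Euler.ψ (+ 1 ℚ./ suc M) t ℚ.+ ε)
ratio-limit ε 0<ε = map₂ (λ close M N≤M → map₂ (eventually⇒≼ {competitiveRatio} {ratioAt x*} seq-ratio) (close M N≤M)) (RatioLimit.limit x* 0≤x* ε 0<ε)

theorem3 : (n m : ℕ) (f : Utilities n m) →
    (∀ j → NonNegative (f j)) →
    (∀ j → Submodular (f j)) →
    (alg : OnlineAlgorithm n m) → IsGreedy f alg →
    competitiveRatio * optimalWelfare f ≤ expectedWelfare f alg
theorem3 n m f 0≤f f-submodular alg alg-greedy = _≼_.unpack (≼-trans (≡⇒≼ (*≡⊗ competitiveRatio (optimalWelfare f)))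
  (WelfareBound.optimum-bound f 0≤f f-submodular alg alg-greedy competitiveRatio ratio-limit))
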